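{- Let $v$ be a positive integer, $n=v-3$, and write $\binom{v-3}{2}_2=\frac{(2^{v-3}-1)(2^{v-4}-1)}{3}$ for the number of $2$-dimensional subspaces of $\mathbb{F}_2^{v-3}$. (i) If $v\equiv 7\pmod 8$, then there exist a $3$-dimensional $\mathbb{F}_2$-subspace $W$ of $\mathbb{F}_{2^n}$ and a $(v,M,4;3)_2$ subspace code with ambient space $V=W\times\mathbb{F}_{2^n}$ that is invariant under $\Sigma_v$ and satisfies $$M\ \ge\ 2^{2(v-3)}+\tfrac{9}{8}\binom{v-3}{2}_2 .$$ Consequently $A_2(v,4;3)\ge 2^{2(v-3)}+\frac98\binom{v-3}{2}_2$. (ii) If $v\equiv 3\pmod 8$ and $v\ge 11$, then there exist a $3$-dimensional $\mathbb{F}_2$-subspace $W$ of $\mathbb{F}_{2^n}$ and a $(v,M,4;3)_2$ subspace code with ambient space $V=W\times\mathbb{F}_{2^n}$ that is invariant under $\Sigma_v$ and satisfies $$M\ \ge\ 2^{2(v-3)}+\tfrac{81}{64}\binom{v-3}{2}_2 .$$ Consequently $A_2(v,4;3)\ge 2^{2(v-3)}+\frac{81}{64}\binom{v-3}{2}_2$.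
   Context: For subspaces $X,Y$ of a finite-dimensional $\mathbb{F}_2$-vector space $V$, the subspace distance is $d_s(X,Y)=\dim X+\dim Y-2\dim(X\cap Y)$. A $(v,M,d;k)_2$ subspace code with ambient space $V$ ($\dim_{\mathbb{F}_2}V=v$) is a set of $M$ distinct $k$-dimensional $\mathbb{F}_2$-subspaces of $V$ with minimum subspace distance $d$ between distinct members. $A_2(v,d;k)$ is the maximum $M$ for which a $(v,M,d;k)_2$ code exists. For $V=W\times\mathbb{F}_{2^n}$, $\Sigma_v\le\mathrm{GL}(V)$ is the group of all maps $(x,y)\mapsto(x,ry)$ with $r\in\mathbb{F}_{2^n}^\times$. A code $\mathcal{C}$ is $\Sigma_v$-invariant if $g(X)\in\mathcal{C}$ for all $X\in\mathcal{C}$, $g\in\Sigma_v$. -}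

module Defs where

open import Algebra.Bundles using (CommutativeRing)
open import Algebra.Module.Bundles using (LeftModule)
import Algebra.Module.Construct.DirectProduct as DirectProduct
import Algebra.Properties.CommutativeMonoid.Sum as Sum
open import Data.Bool.Base using (Bool; true; false; if_then_else_)
open import Data.Bool.Properties using (xor-∧-commutativeRing)
open import Data.Fin.Base using (Fin)
open import Data.Integer.Base using (+_)
open import Data.Nat.Base using (ℕ; _+_; _*_; _∸_; _^_; _≤_)
open import Data.Product.Base using (Σ; ∃; _×_; _,_; proj₁; proj₂; ∃-syntax)
open import Data.Rational.Base as ℚ using (ℚ)
open import Data.Unit.Base using (⊤; tt)
open import Data.Vec.Functional using (Vector)
open import Function.Base using (id)
open import Function.Bundles using (Inverse)
open import Level using (0ℓ)
open import Relation.Binary.PropositionalEquality as ≡ using (_≡_; _≢_)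
open import Relation.Nullary.Negation using (¬_)
open import Relation.Unary using (Pred; _∈_; _∩_; _≐_)

𝔽₂ : CommutativeRing 0ℓ 0ℓ
𝔽₂ = xor-∧-commutativeRing

VectorSpace : Set₁
VectorSpace = LeftModule (CommutativeRing.ring 𝔽₂) 0ℓ 0ℓ

module _ (V : VectorSpace) where
  open LeftModule V
  open Sum +ᴹ-commutativeMonoid using (sum)

  record Subspace : Set₁ where
    field
      member    : Pred Carrierᴹ 0ℓ
      resp      : ∀ {x y} → x ≈ᴹ y → x ∈ member → y ∈ member
      0-closed  : 0ᴹ ∈ member
      +-closed  : ∀ {x y} → x ∈ member → y ∈ member → (x +ᴹ y) ∈ member
      *ₗ-closed : ∀ a {x} → x ∈ member → (a *ₗ x) ∈ member

  open Subspace

  whole : Subspace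
  whole = record
    { member    = λ _ → ⊤
    ; resp      = λ _ _ → tt
    ; 0-closed  = tt
    ; +-closed  = λ _ _ → tt
    ; *ₗ-closed = λ _ _ → tt
    }

  _⊓_ : Subspace → Subspace → Subspace
  X ⊓ Y = record
    { member    = member X ∩ member Y
    ; resp      = λ x≈y (p , q) → resp X x≈y p , resp Y x≈y q
    ; 0-closed  = 0-closed X , 0-closed Y
    ; +-closed  = λ (p , q) (p′ , q′) → +-closed X p p′ , +-closed Y q q′
    ; *ₗ-closed = λ a (p , q) → *ₗ-closed X a p , *ₗ-closed Y a q
    }

  lincomb : ∀ {k} → Vector Bool k → Vector Carrierᴹ k → Carrierᴹ
  lincomb a b = sum (λ i → a i *ₗ b i)

  record IsBasis (X : Subspace) {k : ℕ} (b : Vector Carrierᴹ k) : Set where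
    field
      inside      : ∀ i → b i ∈ member X
      independent : ∀ a → lincomb a b ≈ᴹ 0ᴹ → ∀ i → a i ≡ false
      spanning    : ∀ {x} → x ∈ member X → ∃[ a ] lincomb a b ≈ᴹ x

  HasDim : Subspace → ℕ → Set
  HasDim X k = Σ (Vector Carrierᴹ k) (IsBasis X)

  -- The defining equation δ = dim X + dim Y - 2 dim (X ∩ Y), rearranged so
  -- that no truncated subtraction is involved.
  SubspaceDistance : Subspace → Subspace → ℕ → Set
  SubspaceDistance X Y δ =
    ∃[ a ] ∃[ b ] ∃[ c ]
      HasDim X a × HasDim Y b × HasDim (X ⊓ Y) c × δ + 2 * c ≡ a + b

  -- A (v,M,d;k)₂ code with ambient space V. Subspaces are predicates, so two
  -- of them are the same when they have the same members (_≐_). The minimum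
  -- distance is exactly d: it is a lower bound and it is attained.
  record Code (v M d k : ℕ) : Set₁ where
    field
      ambient  : HasDim whole v
      word     : Fin M → Subspace
      distinct : ∀ {i j} → i ≢ j → ¬ (member (word i) ≐ member (word j))
      word-dim : ∀ i → HasDim (word i) k
      distance : ∀ {i j} → i ≢ j →
                 ∃[ δ ] SubspaceDistance (word i) (word j) δ × d ≤ δ
      attained : ∃[ i ] ∃[ j ] i ≢ j × SubspaceDistance (word i) (word j) d

  Image : (Carrierᴹ → Carrierᴹ) → Subspace → Pred Carrierᴹ 0ℓ
  Image g X y = ∃[ x ] x ∈ member X × g x ≈ᴹ y

  Invariant : ∀ {v M d k} → Pred (Carrierᴹ → Carrierᴹ) 0ℓ → Code v M d k → Set
  Invariant G C = ∀ g → g ∈ G → ∀ i → ∃[ j ] Image g (word i) ≐ member (word j)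
    where open Code C

-- A is the maximum M for which a (v,M,d;k)₂ code exists, i.e. A = A₂(v,d;k).
record IsA₂ (v d k A : ℕ) : Set₁ where
  field
    attained : Σ VectorSpace λ V → Code V v A d k
    maximal  : ∀ M (V : VectorSpace) → Code V v M d k → M ≤ A

module _ {V : VectorSpace} (W : Subspace V) where
  open LeftModule V
  open Subspace W

  private
    x+x≈0 : ∀ x → x +ᴹ x ≈ᴹ 0ᴹ
    x+x≈0 x = ≈ᴹ-trans
      (+ᴹ-cong (≈ᴹ-sym (*ₗ-identityˡ x)) (≈ᴹ-sym (*ₗ-identityˡ x)))
      (≈ᴹ-trans (≈ᴹ-sym (*ₗ-distribʳ x true true)) (*ₗ-zeroˡ x))

  -- Negation is the identity because scalars are in 𝔽₂.
  asSpace : VectorSpace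
  asSpace = record
    { Carrierᴹ = ∃ member
    ; _≈ᴹ_     = λ x y → proj₁ x ≈ᴹ proj₁ y
    ; _+ᴹ_     = λ (x , p) (y , q) → x +ᴹ y , +-closed p q
    ; _*ₗ_     = λ a (x , p) → a *ₗ x , *ₗ-closed a p
    ; 0ᴹ       = 0ᴹ , 0-closed
    ; -ᴹ_      = id
    ; isLeftModule = record
      { isLeftSemimodule = record
        { +ᴹ-isCommutativeMonoid = record
          { isMonoid = record
            { isSemigroup = record
              { isMagma = record
                { isEquivalence = record
                  { refl = ≈ᴹ-refl ; sym = ≈ᴹ-sym ; trans = ≈ᴹ-trans }
                ; ∙-cong = +ᴹ-cong
                }
              ; assoc = λ (x , _) (y , _) (z , _) → +ᴹ-assoc x y z
              }
            ; identity = (λ (x , _) → +ᴹ-identityˡ x) , (λ (x , _) → +ᴹ-identityʳ x)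
            }
          ; comm = λ (x , _) (y , _) → +ᴹ-comm x y
          }
        ; isPreleftSemimodule = record
          { *ₗ-cong      = *ₗ-cong
          ; *ₗ-zeroˡ     = λ (x , _) → *ₗ-zeroˡ x
          ; *ₗ-distribʳ  = λ (x , _) a b → *ₗ-distribʳ x a b
          ; *ₗ-identityˡ = λ (x , _) → *ₗ-identityˡ x
          ; *ₗ-assoc     = λ a b (x , _) → *ₗ-assoc a b x
          ; *ₗ-zeroʳ     = *ₗ-zeroʳ
          ; *ₗ-distribˡ  = λ a (x , _) (y , _) → *ₗ-distribˡ a x y
          }
        }
      ; -ᴹ‿cong    = id
      ; -ᴹ‿inverse = (λ (x , _) → x+x≈0 x) , (λ (x , _) → x+x≈0 x)
      }
    }

-- The field with 2ⁿ elements, unique up to isomorphism. Characteristic 2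
-- follows from the cardinality (for n ≥ 1); it is a field of the record
-- because the 𝔽₂-vector space structure below is built from it.
record GF2^ (n : ℕ) : Set₁ where
  field
    commutativeRing : CommutativeRing 0ℓ 0ℓ
  open CommutativeRing commutativeRing public
    renaming (_+_ to _+ꟳ_; _*_ to _*ꟳ_)
  field
    1≉0         : 1# ≉ 0#
    inverses    : ∀ x → x ≉ 0# → ∃[ y ] x *ꟳ y ≈ 1#
    1+1≈0       : 1# +ꟳ 1# ≈ 0#
    cardinality : Inverse setoid (≡.setoid (Fin (2 ^ n)))

  private
    x+x≈0 : ∀ x → x +ꟳ x ≈ 0#
    x+x≈0 x = trans (+-cong (sym (*-identityˡ x)) (sym (*-identityˡ x)))
      (trans (sym (distribʳ x 1# 1#)) (trans (*-congʳ 1+1≈0) (zeroˡ x)))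

    scale : Bool → Carrier → Carrier
    scale a x = if a then x else 0#

  space : VectorSpace
  space = record
    { Carrierᴹ = Carrier
    ; _≈ᴹ_     = _≈_
    ; _+ᴹ_     = _+ꟳ_
    ; _*ₗ_     = scale
    ; 0ᴹ       = 0#
    ; -ᴹ_      = -_
    ; isLeftModule = record
      { isLeftSemimodule = record
        { +ᴹ-isCommutativeMonoid = +-isCommutativeMonoid
        ; isPreleftSemimodule = record
          { *ₗ-cong      = λ { {true} ≡.refl x≈y → x≈y ; {false} ≡.refl _ → refl }
          ; *ₗ-zeroˡ     = λ _ → refl
          ; *ₗ-distribʳ  = λ where
              x true  true  → sym (x+x≈0 x)
              x true  false → sym (+-identityʳ x)
              x false b     → sym (+-identityˡ (scale b x))
          ; *ₗ-identityˡ = λ _ → refl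
          ; *ₗ-assoc     = λ { true _ _ → refl ; false _ _ → refl }
          ; *ₗ-zeroʳ     = λ { true → refl ; false → refl }
          ; *ₗ-distribˡ  = λ { true _ _ → refl ; false _ _ → sym (+-identityˡ 0#) }
          }
        }
      ; -ᴹ‿cong    = -‿cong
      ; -ᴹ‿inverse = -‿inverse
      }
    }

module _ {n : ℕ} (F : GF2^ n) (W : Subspace (GF2^.space F)) where
  open GF2^ F

  W×F : VectorSpace
  W×F = DirectProduct.leftModule (asSpace W) space

  open LeftModule W×F using (Carrierᴹ; _≈ᴹ_)

  -- Σᵥ as a set of self-maps of V = W × F, maps being equal pointwise.
  Σᵥ : Pred (Carrierᴹ → Carrierᴹ) 0ℓ
  Σᵥ g = ∃[ r ] r ≉ 0# × (∀ x y → g (x , y) ≈ᴹ (x , r *ꟳ y))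

-- The number (2ⁿ - 1)(2ⁿ⁻¹ - 1)/3 of 2-dimensional subspaces of 𝔽₂ⁿ, n ≥ 1.
gauss₂ : ℕ → ℚ
gauss₂ n = + ((2 ^ n ∸ 1) * (2 ^ (n ∸ 1) ∸ 1)) ℚ./ 3

bound : ℕ → ℚ → ℚ
bound v c = (+ (2 ^ (2 * (v ∸ 3))) ℚ./ 1) ℚ.+ c ℚ.* gauss₂ (v ∸ 3)

{-# OPTIONS --safe #-}
module Submission where

-- Let K ⊂ F with K = 𝔽₁₆ or 𝔽₂₅₆, and let W ⊂ 𝔽₁₆ be the span of 1, ω, α, where
-- ω² + ω = 1 and α² + α = ω.  The planes {(x, c₁x² + c₀x) : x ∈ W} with c₁, c₀ ∈ F
-- pairwise meet in dimension at most 1.  For a line Z ⊂ W with product δ of its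
-- nonzero points, the four polynomials (c₁, c₀) + r(z, z²), z ∈ Z, take on Z
-- values that agree modulo ⟨rδ⟩, so they can be traded for the single plane
-- spanned by (0, rδ) and the common graph over Z.  All polynomials with c₁ ≠ 0 whose
-- coefficient of c₀ along K c₁, relative to a complement U of K c₁, lies
-- outside a hyperplane of K are removed.  The planes put in their place are
-- given by (c₁, c₀) = (A r, B r + u) with r ∈ F nonzero, u ∈ U and (Z, A, B)
-- from a finite list over K, found by computer search.  Since F = K r ⊕ U, two
-- of these planes share a line only if this already happens inside K, which is
-- a finite check.
--
-- That F contains K follows from Hilbert's Theorem 90: x² + x = c is solvable
-- in 𝔽_{2ⁿ} if c lies in a subfield 𝔽_{2ᵏ} with 2k ∣ n.  The construction uses
-- only the K-algebra structure of F, and for the bound on A₂ the field is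
-- replaced by the ring Kᵐ, which avoids constructing the fields 𝔽_{2ⁿ}.

open import Algebra.Bundles using (CommutativeRing)
open import Algebra.Module.Bundles using (LeftModule)
open import Data.Bool.Base using (Bool; true; false)
import Data.Bool.Properties as Bool
open import Data.Fin.Base using (Fin; zero; suc)
import Data.Fin.Properties as Fin
open import Data.Integer.Base using (+_)
open import Data.Nat.Base as ℕ using (ℕ; zero; suc; NonZero; _∸_; _≤_)
open import Data.Nat.DivMod using (_%_)
import Data.Nat.Properties as ℕ
open import Data.Product.Base as Product using (Σ; ∃; _×_; _,_; proj₁; proj₂; ∃-syntax)
open import Data.Rational.Base as ℚ using ()
open import Data.Vec.Base as Vec using (Vec; []; _∷_)
import Data.Vec.Properties as Vec
open import Defs
open import Function.Base using (_∘_; id)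
open import Function.Bundles using (_↔_; Inverse)
open import Level using (0ℓ)
open import Relation.Binary.PropositionalEquality as ≡ using (_≡_; _≢_)
open import Relation.Nullary.Decidable using (Dec; yes; no)
open import Relation.Nullary.Negation using (¬_; contradiction)

module Char2 where
  open import Algebra.Structures using (IsCommutativeRing)
  open import Data.Bool.Base using (if_then_else_; _xor_; _∧_)
  open import Data.Maybe.Base using (Maybe; just; nothing)
  open import Relation.Binary.PropositionalEquality using (cong₂)

  record Char2Ring : Set₁ where
    field
      commutativeRing : CommutativeRing 0ℓ 0ℓ
    open CommutativeRing commutativeRing public hiding (zero)
    field
      1+1≈0 : 1# + 1# ≈ 0#

    open import Algebra.Properties.AbelianGroup +-abelianGroup using (inverseˡ-unique)

    x+x≈0 : ∀ x → x + x ≈ 0#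
    x+x≈0 x = trans (+-cong (sym (*-identityˡ x)) (sym (*-identityˡ x)))
      (trans (sym (distribʳ x 1# 1#)) (trans (*-congʳ 1+1≈0) (zeroˡ x)))

    -x≈x : ∀ x → - x ≈ x
    -x≈x x = sym (inverseˡ-unique x x (x+x≈0 x))

    sum≈0⇒≈ : ∀ {x y} → x + y ≈ 0# → x ≈ y
    sum≈0⇒≈ {x} {y} p = trans (inverseˡ-unique x y p) (-x≈x y)

    ≈⇒sum≈0 : ∀ {x y} → x ≈ y → x + y ≈ 0#
    ≈⇒sum≈0 {x} {y} p = trans (+-congʳ p) (x+x≈0 y)

    fromBool : Bool → Carrier
    fromBool b = if b then 1# else 0#

    fromBool-+ : ∀ a b → fromBool (a xor b) ≈ fromBool a + fromBool b
    fromBool-+ true  true  = sym 1+1≈0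
    fromBool-+ true  false = sym (+-identityʳ 1#)
    fromBool-+ false b     = sym (+-identityˡ (fromBool b))

    fromBool-* : ∀ a b → fromBool (a ∧ b) ≈ fromBool a * fromBool b
    fromBool-* true  b = sym (*-identityˡ (fromBool b))
    fromBool-* false b = sym (zeroˡ (fromBool b))

    open import Algebra.Solver.Ring.AlmostCommutativeRing
      using (AlmostCommutativeRing; fromCommutativeRing; _-Raw-AlmostCommutative⟶_)

    -- Negation on the coefficients is the identity, so the solver proves
    -- exactly the identities of commutative rings of characteristic 2.
    coefficients : AlmostCommutativeRing 0ℓ 0ℓ
    coefficients = fromCommutativeRing Bool.xor-∧-commutativeRing

    coefficientMap : AlmostCommutativeRing.rawRing coefficients
      -Raw-AlmostCommutative⟶ fromCommutativeRing commutativeRing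
    coefficientMap = record
      { ⟦_⟧    = fromBool
      ; +-homo = fromBool-+
      ; *-homo = fromBool-*
      ; -‿homo = λ b → sym (-x≈x (fromBool b))
      ; 0-homo = refl
      ; 1-homo = refl
      }

    sameCoefficient : ∀ a b → Maybe (fromBool a ≈ fromBool b)
    sameCoefficient true  true  = just refl
    sameCoefficient false false = just refl
    sameCoefficient _     _     = nothing

    module Solver where
      open import Algebra.Solver.Ring (AlmostCommutativeRing.rawRing coefficients)
        (fromCommutativeRing commutativeRing) coefficientMap sameCoefficient public
        using (solve; _:=_; _:+_; _:*_; con)

  record Ring₂ : Set₁ where
    infixl 6 _⊕_
    infixl 7 _⊗_
    field
      Carrier           : Set
      _⊕_ _⊗_           : Carrier → Carrier → Carrier
      0# 1#             : Carrier
      isCommutativeRing : IsCommutativeRing _≡_ _⊕_ _⊗_ (λ x → x) 0# 1#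

    commutativeRing : CommutativeRing 0ℓ 0ℓ
    commutativeRing = record { isCommutativeRing = isCommutativeRing }

    char2Ring : Char2Ring
    char2Ring = record
      { commutativeRing = commutativeRing
      ; 1+1≈0 = CommutativeRing.-‿inverseˡ commutativeRing 1#
      }

  bits : Ring₂
  bits = record { isCommutativeRing = CommutativeRing.isCommutativeRing Bool.xor-∧-commutativeRing }

  -- The extension R[β] with β² = β + γ; the pair (a , b) stands for a + bβ.
  module Quadratic (R : Ring₂) (γ : Ring₂.Carrier R) where
    open Ring₂ R
    open Char2Ring char2Ring using (module Solver)
    open CommutativeRing commutativeRing
      using (+-assoc; +-comm; +-identityˡ; +-identityʳ; -‿inverseˡ; -‿inverseʳ)
    open Solver

    infixl 6 _⊞_
    infixl 7 _⊠_

    _⊞_ _⊠_ : Carrier × Carrier → Carrier × Carrier → Carrier × Carrier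
    (a , b) ⊞ (c , d) = a ⊕ c , b ⊕ d
    (a , b) ⊠ (c , d) = a ⊗ c ⊕ b ⊗ d ⊗ γ , a ⊗ d ⊕ b ⊗ c ⊕ b ⊗ d

    private
      ⊠-assoc : ∀ x y z → (x ⊠ y) ⊠ z ≡ x ⊠ (y ⊠ z)
      ⊠-assoc (a , b) (c , d) (e , f) = cong₂ _,_
        (solve 7 (λ a b c d e f g →
          (a :* c :+ b :* d :* g) :* e :+ (a :* d :+ b :* c :+ b :* d) :* f :* g :=
          a :* (c :* e :+ d :* f :* g) :+ b :* (c :* f :+ d :* e :+ d :* f) :* g)
          ≡.refl a b c d e f γ)
        (solve 7 (λ a b c d e f g →
          (a :* c :+ b :* d :* g) :* f :+ (a :* d :+ b :* c :+ b :* d) :* e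
            :+ (a :* d :+ b :* c :+ b :* d) :* f :=
          a :* (c :* f :+ d :* e :+ d :* f) :+ b :* (c :* e :+ d :* f :* g)
            :+ b :* (c :* f :+ d :* e :+ d :* f))
          ≡.refl a b c d e f γ)

      ⊠-comm : ∀ x y → x ⊠ y ≡ y ⊠ x
      ⊠-comm (a , b) (c , d) = cong₂ _,_
        (solve 5 (λ a b c d g → a :* c :+ b :* d :* g := c :* a :+ d :* b :* g)
          ≡.refl a b c d γ)
        (solve 4 (λ a b c d → a :* d :+ b :* c :+ b :* d := c :* b :+ d :* a :+ d :* b)
          ≡.refl a b c d)

      ⊠-identityˡ : ∀ x → (1# , 0#) ⊠ x ≡ x
      ⊠-identityˡ (a , b) = cong₂ _,_
        (solve 3 (λ a b g → con true :* a :+ con false :* b :* g := a) ≡.refl a b γ)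
        (solve 2 (λ a b → con true :* b :+ con false :* a :+ con false :* b := b) ≡.refl a b)

      ⊠-distribˡ : ∀ x y z → x ⊠ (y ⊞ z) ≡ x ⊠ y ⊞ x ⊠ z
      ⊠-distribˡ (a , b) (c , d) (e , f) = cong₂ _,_
        (solve 7 (λ a b c d e f g →
          a :* (c :+ e) :+ b :* (d :+ f) :* g :=
          a :* c :+ b :* d :* g :+ (a :* e :+ b :* f :* g))
          ≡.refl a b c d e f γ)
        (solve 6 (λ a b c d e f →
          a :* (d :+ f) :+ b :* (c :+ e) :+ b :* (d :+ f) :=
          a :* d :+ b :* c :+ b :* d :+ (a :* f :+ b :* e :+ b :* f))
          ≡.refl a b c d e f)

    extension : Ring₂
    extension = record
      { Carrier = Carrier × Carrier
      ; _⊕_ = _⊞_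
      ; _⊗_ = _⊠_
      ; 0#  = 0# , 0#
      ; 1#  = 1# , 0#
      ; isCommutativeRing = record
        { isRing = record
          { +-isAbelianGroup = record
            { isGroup = record
              { isMonoid = record
                { isSemigroup = record
                  { isMagma = record { isEquivalence = ≡.isEquivalence ; ∙-cong = cong₂ _⊞_ }
                  ; assoc = λ (a , b) (c , d) (e , f) → cong₂ _,_ (+-assoc a c e) (+-assoc b d f)
                  }
                ; identity = (λ (a , b) → cong₂ _,_ (+-identityˡ a) (+-identityˡ b))
                           , (λ (a , b) → cong₂ _,_ (+-identityʳ a) (+-identityʳ b))
                }
              ; inverse = (λ (a , b) → cong₂ _,_ (-‿inverseˡ a) (-‿inverseˡ b))
                        , (λ (a , b) → cong₂ _,_ (-‿inverseʳ a) (-‿inverseʳ b))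
              ; ⁻¹-cong = λ p → p
              }
            ; comm = λ (a , b) (c , d) → cong₂ _,_ (+-comm a c) (+-comm b d)
            }
          ; *-cong = cong₂ _⊠_
          ; *-assoc = ⊠-assoc
          ; *-identity = ⊠-identityˡ , λ x → ≡.trans (⊠-comm x _) (⊠-identityˡ x)
          ; distrib = ⊠-distribˡ , λ x y z → ≡.trans (⊠-comm (y ⊞ z) x)
              (≡.trans (⊠-distribˡ x y z) (cong₂ _⊞_ (⊠-comm x y) (⊠-comm x z)))
          }
        ; *-comm = ⊠-comm
        }
      }

  record Homomorphism (K : Ring₂) (R : Char2Ring) : Set where
    open Ring₂ K
    open Char2Ring R using (_≈_; _+_; _*_; trans; reflexive; x+x≈0)
    field
      ι   : Carrier → Char2Ring.Carrier R
      ι-+ : ∀ κ μ → ι (κ ⊕ μ) ≈ ι κ + ι μ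
      ι-* : ∀ κ μ → ι (κ ⊗ μ) ≈ ι κ * ι μ
      ι-1 : ι 1# ≈ Char2Ring.1# R

    ι-0 : ι 0# ≈ Char2Ring.0# R
    ι-0 = trans (reflexive (≡.cong ι (≡.sym (CommutativeRing.-‿inverseˡ commutativeRing 0#))))
      (trans (ι-+ 0# 0#) (x+x≈0 (ι 0#)))

  bitsHomomorphism : ∀ R → Homomorphism bits R
  bitsHomomorphism R = record { ι = fromBool ; ι-+ = fromBool-+ ; ι-* = fromBool-* ; ι-1 = refl }
    where open Char2Ring R

  adjoin : ∀ {K R} (h : Homomorphism K R) {γ} β →
    (let open Char2Ring R in β * β + β ≈ Homomorphism.ι h γ) → Homomorphism (Quadratic.extension K γ) R
  adjoin {K} {R} h {γ} β root = record
    { ι   = λ (a , b) → ι a + ι b * β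
    ; ι-+ = λ (a , b) (c , d) → trans (+-cong (ι-+ a c) (*-congʳ (ι-+ b d)))
        (solve 5 (λ a b c d x → a :+ c :+ (b :+ d) :* x := a :+ b :* x :+ (c :+ d :* x)) refl
          (ι a) (ι b) (ι c) (ι d) β)
    ; ι-* = λ (a , b) (c , d) → begin
        ι (a ⊗ c ⊕ b ⊗ d ⊗ γ) + ι (a ⊗ d ⊕ b ⊗ c ⊕ b ⊗ d) * β
          ≈⟨ +-cong (trans (ι-+ _ _) (+-cong (ι-* a c) (trans (ι-* _ γ) (*-cong (ι-* b d) (sym root)))))
               (*-congʳ (trans (ι-+ _ _)
                 (+-cong (trans (ι-+ _ _) (+-cong (ι-* a d) (ι-* b c))) (ι-* b d)))) ⟩
        ι a * ι c + ι b * ι d * (β * β + β) + (ι a * ι d + ι b * ι c + ι b * ι d) * β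
          ≈⟨ solve 5 (λ a b c d x →
               a :* c :+ b :* d :* (x :* x :+ x) :+ (a :* d :+ b :* c :+ b :* d) :* x :=
               (a :+ b :* x) :* (c :+ d :* x)) refl (ι a) (ι b) (ι c) (ι d) β ⟩
        (ι a + ι b * β) * (ι c + ι d * β) ∎
    ; ι-1 = trans (+-cong ι-1 (trans (*-congʳ ι-0) (zeroˡ β))) (+-identityʳ _)
    }
    where
    open Ring₂ K using (_⊕_; _⊗_)
    open Char2Ring R
    open Homomorphism h
    open Solver
    open import Relation.Binary.Reasoning.Setoid setoid

module Enumeration where
  open import Data.Fin.Base using (punchIn; punchOut)
  open import Data.Fin.Properties as Fin using (any?; *↔×; +↔⊎; 1↔⊤; 2↔Bool; injective⇒≤)
  open import Data.Nat.Base using (_+_; _*_; _^_; _≤_; s≤s; z≤n)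
  open import Data.Product.Base using (uncurry)
  open import Data.Product.Function.NonDependent.Propositional using (_×-↔_)
  open import Data.Sum.Base using (_⊎_)
  open import Data.Sum.Function.Propositional using (_⊎-↔_)
  open import Data.Unit.Base using (tt)
  open import Data.Vec.Base using (uncons)
  open import Function.Bundles using (mk↔ₛ′)
  open import Function.Properties.Inverse using (↔-sym; ↔-trans)
  open import Relation.Binary.Bundles using (Setoid)
  open import Relation.Binary.Definitions using (DecidableEquality)
  open import Relation.Binary.PropositionalEquality using (refl)
  open import Relation.Nullary.Decidable using (map′)
  open import Relation.Unary using (Pred; Decidable)

  private
    variable
      A B : Set
      m n : ℕ

  search : ∀ {p} {P : Pred A p} → A ↔ Fin n → Decidable P → Dec (∃ P)
  search {P = P} e P? = map′
    (λ (i , p) → from i , p)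
    (λ (x , p) → to x , ≡.subst P (≡.sym (strictlyInverseʳ x)) p)
    (any? (λ i → P? (from i)))
    where open Inverse e

  searchAll : ∀ {p} {P : Pred A p} → A ↔ Fin n → Decidable P → Dec (∀ x → P x)
  searchAll {P = P} e P? = map′
    (λ f x → ≡.subst P (strictlyInverseʳ x) (f (to x)))
    (λ f i → f (from i))
    (Fin.all? (λ i → P? (from i)))
    where open Inverse e

  Inverse-injective : {S T : Setoid 0ℓ 0ℓ} (e : Inverse S T) → ∀ {x y} →
    Setoid._≈_ T (Inverse.to e x) (Inverse.to e y) → Setoid._≈_ S x y
  Inverse-injective {S} e {x} {y} p =
    trans (sym (strictlyInverseʳ x)) (trans (from-cong p) (strictlyInverseʳ y))
    where
    open Inverse e
    open Setoid S

  ↔⇒decidable : A ↔ Fin n → DecidableEquality A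
  ↔⇒decidable e x y = map′ (Inverse-injective e) (≡.cong to) (to x Fin.≟ to y)
    where open Inverse e

  ×-finite : A ↔ Fin m → B ↔ Fin n → (A × B) ↔ Fin (m * n)
  ×-finite e f = ↔-trans (e ×-↔ f) (↔-sym *↔×)

  ⊎-finite : A ↔ Fin m → B ↔ Fin n → (A ⊎ B) ↔ Fin (m + n)
  ⊎-finite e f = ↔-trans (e ⊎-↔ f) (↔-sym +↔⊎)

  Vec-finite : A ↔ Fin m → ∀ k → Vec A k ↔ Fin (m ^ k)
  Vec-finite e zero = ↔-trans
    (mk↔ₛ′ (λ _ → tt) (λ _ → []) (λ _ → refl) λ { [] → refl })
    (↔-sym 1↔⊤)
  Vec-finite e (suc k) = ↔-trans
    (mk↔ₛ′ uncons (uncurry _∷_) (λ _ → refl) (λ { (_ ∷ _) → refl }))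
    (×-finite e (Vec-finite e k))

  Bool-finite : Bool ↔ Fin 2
  Bool-finite = ↔-sym 2↔Bool

  injection⇒≤ : A ↔ Fin m → B ↔ Fin n → (f : A → B) → (∀ {x y} → f x ≡ f y → x ≡ y) → m ≤ n
  injection⇒≤ e f g g-injective = injective⇒≤ {f = λ i → Inverse.to f (g (Inverse.from e i))}
    λ eq → Inverse-injective (↔-sym e) (g-injective (Inverse-injective f eq))

  2^-cancel-≤ : 2 ^ m ≤ 2 ^ n → m ≤ n
  2^-cancel-≤ {m} {n} le = ℕ.≮⇒≥ λ n<m →
    ℕ.<⇒≱ (ℕ.^-monoʳ-< 2 (s≤s (s≤s z≤n)) n<m) le

  2^-injective : 2 ^ m ≡ 2 ^ n → m ≡ n
  2^-injective eq = ℕ.≤-antisym (2^-cancel-≤ (ℕ.≤-reflexive eq)) (2^-cancel-≤ (ℕ.≤-reflexive (≡.sym eq)))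

  module Nonzero (S : Setoid 0ℓ 0ℓ) (0# : Setoid.Carrier S) (f : ℕ)
    (size : Inverse S (≡.setoid (Fin (suc f)))) where
    open Setoid S
    open Inverse size using (to; from; to-cong; from-cong; strictlyInverseˡ; strictlyInverseʳ)

    from-injective : ∀ {i j} → from i ≈ from j → i ≡ j
    from-injective p =
      ≡.trans (≡.sym (strictlyInverseˡ _)) (≡.trans (to-cong p) (strictlyInverseˡ _))

    nz : Fin f → Carrier
    nz i = from (punchIn (to 0#) i)

    nz≉0 : ∀ i → ¬ nz i ≈ 0#
    nz≉0 i p = Fin.punchInᵢ≢i (to 0#) i (≡.trans (≡.sym (strictlyInverseˡ _)) (to-cong p))

    nz-injective : ∀ {i j} → nz i ≈ nz j → i ≡ j
    nz-injective p = Fin.punchIn-injective (to 0#) _ _ (from-injective p)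

    nz-surjective : ∀ {r} → ¬ r ≈ 0# → ∃ λ i → nz i ≈ r
    nz-surjective {r} r≉0 = punchOut 0≢r ,
      trans (from-cong (Fin.punchIn-punchOut 0≢r)) (strictlyInverseʳ r)
      where
      0≢r : to 0# ≢ to r
      0≢r p = r≉0 (Inverse-injective size (≡.sym p))

module LinearAlgebra where
  import Algebra.Properties.CommutativeMonoid.Sum as Sum
  open Char2
  open import Data.Fin.Permutation using (↔⇒≡)
  open import Data.List.Base using (List; []; _∷_; allFin)
  open import Data.List.Membership.Propositional.Properties using (∈-allFin)
  open import Data.List.Relation.Unary.All as All using (All; []; _∷_)
  open import Data.Nat.Base using (_*_; _^_)
  open import Data.Vec.Base using (lookup; replicate; zipWith; map)
  open import Data.Vec.Functional as Vector using (Vector)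
  open Enumeration
  open import Function.Bundles using (mk↔ₛ′)
  open import Function.Properties.Inverse using (↔-trans)
  open import Relation.Nullary.Decidable using (map′)

  record FiniteField₂ : Set₁ where
    field
      ring₂ : Ring₂
    open Ring₂ ring₂ public
    field
      degree  : ℕ
      finite  : Carrier ↔ Fin (2 ^ degree)
      _⁻¹     : Carrier → Carrier
      inverse : ∀ {x} → x ≢ 0# → x ⊗ x ⁻¹ ≡ 1#
      1≢0     : 1# ≢ 0#

    ring = CommutativeRing.ring commutativeRing

  bitField : FiniteField₂
  bitField = record
    { ring₂ = bits ; degree = 1 ; finite = Bool-finite ; _⁻¹ = id
    ; inverse = λ { {true} _ → ≡.refl ; {false} p → contradiction ≡.refl p } ; 1≢0 = λ () }

  module Combination (K : Ring₂)
    (M : LeftModule (CommutativeRing.ring (Ring₂.commutativeRing K)) 0ℓ 0ℓ) where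
    open Ring₂ K
    open LeftModule M public
    open Sum +ᴹ-commutativeMonoid using (sum; sum-cong-≋; ∑-distrib-+; sum-replicate-zero)
    private module R = CommutativeRing commutativeRing

    -- By characteristic 2, subtraction in K is addition.
    infixl 6 _⊞_
    _⊞_ : ∀ {k} → Vec Carrier k → Vec Carrier k → Vec Carrier k
    _⊞_ = zipWith _⊕_

    𝟎 : ∀ {k} → Vec Carrier k
    𝟎 = replicate _ 0#

    -- Opaque because unfolding the sums makes type checking slow.
    opaque
      combination : ∀ {k} → Vec Carrier k → Vector Carrierᴹ k → Carrierᴹ
      combination a v = sum (λ i → lookup a i *ₗ v i)

      combination-lookup : ∀ {k} (a : Vec Carrier k) v →
        combination a v ≈ᴹ sum (λ i → lookup a i *ₗ v i)
      combination-lookup a v = ≈ᴹ-refl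

      combination-[] : ∀ v → combination [] v ≈ᴹ 0ᴹ
      combination-[] v = ≈ᴹ-refl

      combination-∷ : ∀ {k} κ (a : Vec Carrier k) v →
        combination (κ ∷ a) v ≈ᴹ κ *ₗ v zero +ᴹ combination a (v ∘ suc)
      combination-∷ κ a v = ≈ᴹ-refl

      combination-cong : ∀ {k} (a : Vec Carrier k) {v w : Vector Carrierᴹ k} →
        (∀ i → v i ≈ᴹ w i) → combination a v ≈ᴹ combination a w
      combination-cong a p = sum-cong-≋ (λ i → *ₗ-congˡ (p i))

      combination-+ : ∀ {k} (a b : Vec Carrier k) v →
        combination (a ⊞ b) v ≈ᴹ combination a v +ᴹ combination b v
      combination-+ a b v = ≈ᴹ-trans
        (sum-cong-≋ (λ i → ≈ᴹ-trans (*ₗ-congʳ (Vec.lookup-zipWith _⊕_ i a b))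
          (*ₗ-distribʳ (v i) (lookup a i) (lookup b i))))
        (∑-distrib-+ (λ i → lookup a i *ₗ v i) (λ i → lookup b i *ₗ v i))

      combination-0 : ∀ {k} (v : Vector Carrierᴹ k) → combination 𝟎 v ≈ᴹ 0ᴹ
      combination-0 {k} v = ≈ᴹ-trans
        (sum-cong-≋ (λ i → ≈ᴹ-trans (*ₗ-congʳ (Vec.lookup-replicate i 0#)) (*ₗ-zeroˡ (v i))))
        (sum-replicate-zero k)

      *ₗ-sum : ∀ κ {k} (v : Vector Carrierᴹ k) → κ *ₗ sum v ≈ᴹ sum (λ i → κ *ₗ v i)
      *ₗ-sum κ {zero}  v = *ₗ-zeroʳ κ
      *ₗ-sum κ {suc k} v = ≈ᴹ-trans (*ₗ-distribˡ κ _ _) (+ᴹ-congˡ (*ₗ-sum κ (v ∘ suc)))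

      combination-* : ∀ {k} κ (a : Vec Carrier k) v →
        combination (map (κ ⊗_) a) v ≈ᴹ κ *ₗ combination a v
      combination-* κ a v = ≈ᴹ-trans
        (sum-cong-≋ (λ i → ≈ᴹ-trans (*ₗ-congʳ (Vec.lookup-map i (κ ⊗_) a))
          (*ₗ-assoc κ (lookup a i) (v i))))
        (≈ᴹ-sym (*ₗ-sum κ (λ i → lookup a i *ₗ v i)))

    combination-1 : ∀ (v : Vector Carrierᴹ 1) → combination (1# ∷ []) v ≈ᴹ v zero
    combination-1 v = ≈ᴹ-trans (combination-∷ 1# [] v)
      (≈ᴹ-trans (+ᴹ-cong (*ₗ-identityˡ (v zero)) (combination-[] _)) (+ᴹ-identityʳ (v zero)))

    x+x≈0 : ∀ x → x +ᴹ x ≈ᴹ 0ᴹ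
    x+x≈0 x = ≈ᴹ-trans
      (+ᴹ-cong (≈ᴹ-sym (*ₗ-identityˡ x)) (≈ᴹ-sym (*ₗ-identityˡ x)))
      (≈ᴹ-trans (≈ᴹ-sym (*ₗ-distribʳ x 1# 1#))
        (≈ᴹ-trans (*ₗ-congʳ (Char2Ring.1+1≈0 char2Ring)) (*ₗ-zeroˡ x)))

    sum≈0⇒≈ : ∀ {x y} → x +ᴹ y ≈ᴹ 0ᴹ → x ≈ᴹ y
    sum≈0⇒≈ {x} {y} p = begin
      x               ≈⟨ +ᴹ-identityʳ x ⟨
      x +ᴹ 0ᴹ         ≈⟨ +ᴹ-congˡ (x+x≈0 y) ⟨
      x +ᴹ (y +ᴹ y)   ≈⟨ +ᴹ-assoc x y y ⟨
      (x +ᴹ y) +ᴹ y   ≈⟨ +ᴹ-congʳ p ⟩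
      0ᴹ +ᴹ y         ≈⟨ +ᴹ-identityˡ y ⟩
      y               ∎
      where open import Relation.Binary.Reasoning.Setoid ≈ᴹ-setoid

    ≈⇒sum≈0 : ∀ {x y} → x ≈ᴹ y → x +ᴹ y ≈ᴹ 0ᴹ
    ≈⇒sum≈0 {x} {y} p = ≈ᴹ-trans (+ᴹ-congʳ p) (x+x≈0 y)

    +ᴹ-interchange : ∀ x y z w → (x +ᴹ y) +ᴹ (z +ᴹ w) ≈ᴹ (x +ᴹ z) +ᴹ (y +ᴹ w)
    +ᴹ-interchange x y z w = begin
      (x +ᴹ y) +ᴹ (z +ᴹ w)   ≈⟨ +ᴹ-assoc x y (z +ᴹ w) ⟩
      x +ᴹ (y +ᴹ (z +ᴹ w))   ≈⟨ +ᴹ-congˡ (+ᴹ-assoc y z w) ⟨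
      x +ᴹ ((y +ᴹ z) +ᴹ w)   ≈⟨ +ᴹ-congˡ (+ᴹ-congʳ (+ᴹ-comm y z)) ⟩
      x +ᴹ ((z +ᴹ y) +ᴹ w)   ≈⟨ +ᴹ-congˡ (+ᴹ-assoc z y w) ⟩
      x +ᴹ (z +ᴹ (y +ᴹ w))   ≈⟨ +ᴹ-assoc x z (y +ᴹ w) ⟨
      (x +ᴹ z) +ᴹ (y +ᴹ w)   ∎
      where open import Relation.Binary.Reasoning.Setoid ≈ᴹ-setoid

    ⊞≡𝟎⇒≡ : ∀ {k} (a b : Vec Carrier k) → a ⊞ b ≡ 𝟎 → a ≡ b
    ⊞≡𝟎⇒≡ []      []      _ = ≡.refl
    ⊞≡𝟎⇒≡ (x ∷ a) (y ∷ b) p = ≡.cong₂ _∷_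
      (Char2Ring.sum≈0⇒≈ char2Ring (≡.cong Vec.head p)) (⊞≡𝟎⇒≡ a b (≡.cong Vec.tail p))

    ⊞-self : ∀ {k} (a : Vec Carrier k) → a ⊞ a ≡ 𝟎
    ⊞-self []      = ≡.refl
    ⊞-self (x ∷ a) = ≡.cong₂ _∷_ (R.-‿inverseˡ x) (⊞-self a)

    combine : ∀ {k l} → Vector Carrierᴹ k → Vector Carrierᴹ l →
      Vec Carrier k × Vec Carrier l → Carrierᴹ
    combine p v (a , b) = combination a p +ᴹ combination b v

    Independent : ∀ {k} → Vector Carrierᴹ k → Set
    Independent v = ∀ a → combination a v ≈ᴹ 0ᴹ → a ≡ 𝟎

    JointlyIndependent : ∀ {k l} → Vector Carrierᴹ k → Vector Carrierᴹ l → Set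
    JointlyIndependent p v = ∀ a b → combine p v (a , b) ≈ᴹ 0ᴹ → a ≡ 𝟎 × b ≡ 𝟎

    independent⇒injective : ∀ {k} {v : Vector Carrierᴹ k} → Independent v →
      ∀ a b → combination a v ≈ᴹ combination b v → a ≡ b
    independent⇒injective {v = v} ind a b p = ⊞≡𝟎⇒≡ a b
      (ind (a ⊞ b) (≈ᴹ-trans (combination-+ a b v) (≈⇒sum≈0 p)))

    combine-+ : ∀ {k l} (p : Vector Carrierᴹ k) (v : Vector Carrierᴹ l) a b a′ b′ →
      combine p v (a ⊞ a′ , b ⊞ b′) ≈ᴹ combine p v (a , b) +ᴹ combine p v (a′ , b′)
    combine-+ p v a b a′ b′ = ≈ᴹ-trans
      (+ᴹ-cong (combination-+ a a′ p) (combination-+ b b′ v)) (+ᴹ-interchange _ _ _ _)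

    jointlyIndependent⇒injective : ∀ {k l} {p : Vector Carrierᴹ k} {v : Vector Carrierᴹ l} →
      JointlyIndependent p v → ∀ c d → combine p v c ≈ᴹ combine p v d → c ≡ d
    jointlyIndependent⇒injective {p = p} {v} ind (a , b) (a′ , b′) eq
      with ind (a ⊞ a′) (b ⊞ b′) (≈ᴹ-trans (combine-+ p v a b a′ b′) (≈⇒sum≈0 eq))
    ... | q , r = ≡.cong₂ _,_ (⊞≡𝟎⇒≡ a a′ q) (⊞≡𝟎⇒≡ b b′ r)

  module Extension (K : FiniteField₂) (M : LeftModule (FiniteField₂.ring K) 0ℓ 0ℓ)
    (c : ℕ) (size : Inverse (LeftModule.≈ᴹ-setoid M) (≡.setoid (Fin c))) where
    open FiniteField₂ K
    open Combination ring₂ M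
    open Inverse size using (to; from; to-cong; strictlyInverseʳ)
    private
      module S = Inverse size
      module R = CommutativeRing commutativeRing

    _≈?_ : ∀ x y → Dec (x ≈ᴹ y)
    x ≈? y = map′ (Inverse-injective size) to-cong (to x Fin.≟ to y)

    Spans : ∀ {k l} → Vector Carrierᴹ k → Vector Carrierᴹ l → Carrierᴹ → Set
    Spans p v x = ∃[ ab ] combine p v ab ≈ᴹ x

    spans? : ∀ {k l} (p : Vector Carrierᴹ k) (v : Vector Carrierᴹ l) x → Dec (Spans p v x)
    spans? {k} {l} p v x =
      search (×-finite (Vec-finite finite k) (Vec-finite finite l)) (λ ab → combine p v ab ≈? x)

    combination-0∷ : ∀ {l} (b : Vec Carrier l) x v →
      combination (0# ∷ b) (x Vector.∷ v) ≈ᴹ combination b v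
    combination-0∷ b x v = ≈ᴹ-trans (combination-∷ 0# b _)
      (≈ᴹ-trans (+ᴹ-congʳ (*ₗ-zeroˡ x)) (+ᴹ-identityˡ _))

    cons-independent : ∀ {k l} {p : Vector Carrierᴹ k} {v : Vector Carrierᴹ l} {x} →
      JointlyIndependent p v → ¬ Spans p v x → JointlyIndependent p (x Vector.∷ v)
    cons-independent {p = p} {v} {x} ind x∉ a (κ ∷ b) eq
      with ↔⇒decidable finite κ 0#
    ... | yes ≡.refl = Product.map₂ (≡.cong (0# ∷_)) (ind a b (≈ᴹ-trans
      (≈ᴹ-sym (+ᴹ-congˡ (combination-0∷ b x v))) eq))
    ... | no κ≢0 = contradiction ((map (κ ⁻¹ ⊗_) a , map (κ ⁻¹ ⊗_) b) , spanned) x∉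
      where
      open import Relation.Binary.Reasoning.Setoid ≈ᴹ-setoid
      s = combination a p
      t = combination b v
      s+t≈κx : s +ᴹ t ≈ᴹ κ *ₗ x
      s+t≈κx = sum≈0⇒≈ (begin
        (s +ᴹ t) +ᴹ κ *ₗ x     ≈⟨ +ᴹ-assoc s t _ ⟩
        s +ᴹ (t +ᴹ κ *ₗ x)     ≈⟨ +ᴹ-congˡ (+ᴹ-comm t _) ⟩
        s +ᴹ (κ *ₗ x +ᴹ t)     ≈⟨ +ᴹ-congˡ (combination-∷ κ b _) ⟨
        _                      ≈⟨ eq ⟩
        0ᴹ                     ∎)
      spanned : combine p v (map (κ ⁻¹ ⊗_) a , map (κ ⁻¹ ⊗_) b) ≈ᴹ x
      spanned = begin
        _                             ≈⟨ +ᴹ-cong (combination-* (κ ⁻¹) a p) (combination-* (κ ⁻¹) b v) ⟩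
        κ ⁻¹ *ₗ s +ᴹ κ ⁻¹ *ₗ t        ≈⟨ *ₗ-distribˡ (κ ⁻¹) s t ⟨
        κ ⁻¹ *ₗ (s +ᴹ t)              ≈⟨ *ₗ-congˡ s+t≈κx ⟩
        κ ⁻¹ *ₗ (κ *ₗ x)              ≈⟨ *ₗ-assoc (κ ⁻¹) κ x ⟨
        (κ ⁻¹ ⊗ κ) *ₗ x               ≈⟨ *ₗ-congʳ (≡.trans (R.*-comm (κ ⁻¹) κ) (inverse κ≢0)) ⟩
        1# *ₗ x                       ≈⟨ *ₗ-identityˡ x ⟩
        x                             ∎

    spans-cons : ∀ {k l} {p : Vector Carrierᴹ k} {v : Vector Carrierᴹ l} {x y} →
      Spans p v y → Spans p (x Vector.∷ v) y
    spans-cons {x = x} ((a , b) , eq) = (a , 0# ∷ b) , ≈ᴹ-trans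
      (+ᴹ-congˡ (combination-0∷ b x _)) eq

    spans-head : ∀ {k l} {p : Vector Carrierᴹ k} {v : Vector Carrierᴹ l} {x} →
      Spans p (x Vector.∷ v) x
    spans-head {p = p} {v} {x} = (𝟎 , 1# ∷ 𝟎) , ≈ᴹ-trans
      (+ᴹ-cong (combination-0 p) (≈ᴹ-trans (combination-∷ 1# 𝟎 _)
        (+ᴹ-cong (*ₗ-identityˡ x) (combination-0 v))))
      (≈ᴹ-trans (+ᴹ-identityˡ _) (+ᴹ-identityʳ x))

    extendOver : ∀ {k} {p : Vector Carrierᴹ k} → Independent p → (is : List (Fin c)) →
      ∃[ l ] Σ (Vector Carrierᴹ l) λ v → JointlyIndependent p v × All (Spans p v ∘ from) is
    extendOver ind [] = 0 , Vector.[] , (λ { a [] eq →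
      ind a (≈ᴹ-trans (≈ᴹ-sym (≈ᴹ-trans (+ᴹ-congˡ (combination-[] _)) (+ᴹ-identityʳ _))) eq)
      , ≡.refl }) , []
    extendOver {p = p} ind (i ∷ is) with extendOver ind is
    ... | l , v , ind′ , all with spans? p v (from i)
    ... | yes s = l , v , ind′ , s ∷ all
    ... | no ¬s = suc l , from i Vector.∷ v , cons-independent ind′ ¬s
                , spans-head ∷ All.map spans-cons all

    extend : ∀ {k} {p : Vector Carrierᴹ k} → Independent p →
      ∃[ l ] Σ (Vector Carrierᴹ l) λ v → JointlyIndependent p v × (∀ x → Spans p v x)
    extend ind with extendOver ind (allFin c)
    ... | l , v , ind′ , all = l , v , ind′ , λ x →
      let ab , eq = All.lookup all (∈-allFin (to x)) in ab , ≈ᴹ-trans eq (strictlyInverseʳ x)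

    count : ∀ {k l} {p : Vector Carrierᴹ k} {v : Vector Carrierᴹ l} →
      JointlyIndependent p v → (∀ x → Spans p v x) → c ≡ (2 ^ degree) ^ k * (2 ^ degree) ^ l
    count {k} {l} {p} {v} ind spans = ↔⇒≡ (↔-trans bijection
      (×-finite (Vec-finite finite k) (Vec-finite finite l)))
      where
      bijection : Fin c ↔ (Vec Carrier k × Vec Carrier l)
      bijection = mk↔ₛ′ (proj₁ ∘ spans ∘ from) (to ∘ combine p v)
        (λ ab → jointlyIndependent⇒injective ind _ ab
          (≈ᴹ-trans (proj₂ (spans (from (to (combine p v ab))))) (strictlyInverseʳ (combine p v ab))))
        (λ i → ≡.trans (to-cong (proj₂ (spans (from i)))) (S.strictlyInverseˡ i))

module PlaneFamilies where
  open Char2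
  open import Data.Bool.Base using (_∧_)
  open import Data.Empty using (⊥-elim)
  open import Data.Fin.Patterns using (0F; 1F)
  open import Data.Nat.Base using (_≤_)
  open import Data.Vec.Base using (lookup; tabulate)
  open import Data.Vec.Functional as Vector using (Vector)
  open Enumeration
  open LinearAlgebra
  open import Relation.Nullary.Decidable using (_×-dec_; ¬?)

  _≟ᵇ_ : ∀ {k} (a b : Vec Bool k) → Dec (a ≡ b)
  _≟ᵇ_ {k} = ↔⇒decidable (Vec-finite Bool-finite k)

  module Spans (V : VectorSpace) where
    open Combination bits V public

    unit : ∀ {k} → Fin k → Vec Bool k
    unit zero    = true ∷ 𝟎
    unit (suc i) = false ∷ unit i

    combination-unit : ∀ {k} (i : Fin k) v → combination (unit i) v ≈ᴹ v i
    combination-unit zero v = ≈ᴹ-trans (combination-∷ true 𝟎 v) (≈ᴹ-trans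
      (+ᴹ-cong (*ₗ-identityˡ (v zero)) (combination-0 (v ∘ suc))) (+ᴹ-identityʳ (v zero)))
    combination-unit (suc i) v = ≈ᴹ-trans (combination-∷ false (unit i) v)
      (≈ᴹ-trans (≈ᴹ-trans (+ᴹ-congʳ (*ₗ-zeroˡ (v zero))) (+ᴹ-identityˡ _)) (combination-unit i (v ∘ suc)))

    unit≢𝟎 : ∀ {k} (i : Fin k) → unit i ≢ 𝟎
    unit≢𝟎 (suc i) eq = unit≢𝟎 i (≡.cong Vec.tail eq)

    additive-0 : ∀ {k} (h : Vec Bool k → Carrierᴹ) → (∀ a b → h (a ⊞ b) ≈ᴹ h a +ᴹ h b) → h 𝟎 ≈ᴹ 0ᴹ
    additive-0 h h-+ = ≈ᴹ-trans (≈ᴹ-reflexive (≡.cong h (≡.sym (⊞-self 𝟎)))) (≈ᴹ-trans (h-+ 𝟎 𝟎) (x+x≈0 _))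

    combination-additive : ∀ {k} (h : Vec Bool k → Carrierᴹ) →
      (∀ a b → h (a ⊞ b) ≈ᴹ h a +ᴹ h b) → ∀ a → combination a (h ∘ unit) ≈ᴹ h a
    combination-additive h h-+ [] = ≈ᴹ-trans (combination-[] _) (≈ᴹ-sym (additive-0 h h-+))
    combination-additive h h-+ (κ ∷ a) = ≈ᴹ-trans (combination-∷ κ a _) (≈ᴹ-trans
      (+ᴹ-cong (leading κ) (combination-additive (h ∘ (false ∷_)) (λ a b → h-+ (false ∷ a) (false ∷ b)) a))
      (≈ᴹ-trans (≈ᴹ-sym (h-+ (κ ∷ 𝟎) (false ∷ a)))
        (≈ᴹ-reflexive (≡.cong h (≡.cong₂ _∷_ (Bool.xor-identityʳ κ) (⊞-identityˡ a))))))
      where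
      ⊞-identityˡ : ∀ {k} (a : Vec Bool k) → 𝟎 ⊞ a ≡ a
      ⊞-identityˡ []      = ≡.refl
      ⊞-identityˡ (κ ∷ a) = ≡.cong (κ ∷_) (⊞-identityˡ a)
      leading : ∀ κ → κ *ₗ h (unit zero) ≈ᴹ h (κ ∷ 𝟎)
      leading true  = *ₗ-identityˡ _
      leading false = ≈ᴹ-trans (*ₗ-zeroˡ _) (≈ᴹ-sym (additive-0 h h-+))

    tabulate-combination : ∀ {k} (a : Vector Bool k) v →
      combination (tabulate a) v ≈ᴹ lincomb V a v
    tabulate-combination {zero}  a v = combination-[] v
    tabulate-combination {suc k} a v = ≈ᴹ-trans (combination-∷ (a zero) (tabulate (a ∘ suc)) v)
      (+ᴹ-congˡ (tabulate-combination (a ∘ suc) (v ∘ suc)))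

    span : ∀ {k} → Vector Carrierᴹ k → Subspace V
    span v = record
      { member    = λ x → ∃[ a ] combination a v ≈ᴹ x
      ; resp      = λ x≈y (a , p) → a , ≈ᴹ-trans p x≈y
      ; 0-closed  = 𝟎 , combination-0 v
      ; +-closed  = λ (a , p) (b , q) → a ⊞ b , ≈ᴹ-trans (combination-+ a b v) (+ᴹ-cong p q)
      ; *ₗ-closed = λ κ (a , p) → Vec.map (κ ∧_) a , ≈ᴹ-trans (combination-* κ a v) (*ₗ-congˡ p)
      }

    independent⇒basis : ∀ {k} {v : Vector Carrierᴹ k} (X : Subspace V) → Independent v →
      (∀ i → Subspace.member X (v i)) →
      (∀ {x} → Subspace.member X x → ∃[ a ] combination a v ≈ᴹ x) → IsBasis V X v
    independent⇒basis {v = v} X ind inside spanning = record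
      { inside      = inside
      ; independent = λ a eq i → ≡.trans (≡.sym (Vec.lookup∘tabulate a i))
          (≡.trans (≡.cong (λ b → lookup b i)
            (ind (tabulate a) (≈ᴹ-trans (tabulate-combination a v) eq)))
            (Vec.lookup-replicate i false))
      ; spanning    = λ x∈X → let a , eq = spanning x∈X in
          lookup a , ≈ᴹ-trans (≈ᴹ-sym (combination-lookup a v)) eq
      }

    basis⇒independent : ∀ {X k} {v : Vector Carrierᴹ k} → IsBasis V X v → Independent v
    basis⇒independent {v = v} basis a eq = ≡.trans (≡.sym (Vec.tabulate∘lookup a))
      (≡.trans (Vec.tabulate-cong λ i →
          ≡.trans (IsBasis.independent basis (lookup a)
            (≈ᴹ-trans (≈ᴹ-sym (combination-lookup a v)) eq) i) (≡.sym (Vec.lookup-replicate i false)))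
        (Vec.tabulate∘lookup 𝟎))

    basis⇒spanning : ∀ {X k} {v : Vector Carrierᴹ k} → IsBasis V X v →
      ∀ {x} → Subspace.member X x → ∃[ a ] combination a v ≈ᴹ x
    basis⇒spanning {v = v} basis x∈X with IsBasis.spanning basis x∈X
    ... | a , eq = tabulate a , ≈ᴹ-trans (tabulate-combination a v) eq

    combination-∈ : ∀ (X : Subspace V) {k} {v : Vector Carrierᴹ k} →
      (∀ i → Subspace.member X (v i)) → ∀ a → Subspace.member X (combination a v)
    combination-∈ X inside []      = Subspace.resp X (≈ᴹ-sym (combination-[] _)) (Subspace.0-closed X)
    combination-∈ X inside (κ ∷ a) = Subspace.resp X (≈ᴹ-sym (combination-∷ κ a _)) (Subspace.+-closed X
      (Subspace.*ₗ-closed X κ (inside zero)) (combination-∈ X (inside ∘ suc) a))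

    dimension-≤ : ∀ {X k l} → HasDim V X k → HasDim V X l → k ≤ l
    dimension-≤ {X} {k} {l} (v , B) (w , C) = 2^-cancel-≤
      (injection⇒≤ (Vec-finite Bool-finite k) (Vec-finite Bool-finite l) (proj₁ ∘ coordinates)
        λ {a} {b} eq → independent⇒injective (basis⇒independent B) a b
          (≈ᴹ-trans (≈ᴹ-sym (proj₂ (coordinates a)))
            (≈ᴹ-trans (≡.subst (λ c → combination (proj₁ (coordinates a)) w ≈ᴹ combination c w)
              eq ≈ᴹ-refl) (proj₂ (coordinates b)))))
      where
      coordinates : ∀ a → ∃[ c ] combination c w ≈ᴹ combination a v
      coordinates a = basis⇒spanning C (combination-∈ X (IsBasis.inside B) a)

    dimension-unique : ∀ {X k l} → HasDim V X k → HasDim V X l → k ≡ l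
    dimension-unique D E = ℕ.≤-antisym (dimension-≤ D E) (dimension-≤ E D)

    -- Any two planes have at most one nonzero vector in common, and some two
    -- of them do meet.
    record IsPlaneFamily {M : ℕ} (plane : Fin M → Vector Carrierᴹ 3) : Set where
      constructor isPlaneFamily
      field
        independent : ∀ i → Independent (plane i)
        meet        : ∀ i j a a′ c c′ →
                      combination a (plane i) ≈ᴹ combination a′ (plane j) →
                      combination c (plane i) ≈ᴹ combination c′ (plane j) →
                      a ≢ 𝟎 → c ≢ 𝟎 → a ≢ c → i ≡ j
        touching    : ∃[ i ] ∃[ j ] i ≢ j × (∃[ a ] ∃[ a′ ]
                      a ≢ 𝟎 × combination a (plane i) ≈ᴹ combination a′ (plane j))

    PlaneFamily : ℕ → Set
    PlaneFamily M = ∃ λ (plane : Fin M → Vector Carrierᴹ 3) → IsPlaneFamily plane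

    module _ {v M} (_≈?_ : ∀ x y → Dec (x ≈ᴹ y)) (ambient : HasDim V (whole V) v)
      (P : PlaneFamily M) where
      open IsPlaneFamily (proj₂ P)

      private
        plane = proj₁ P

        word : Fin M → Subspace V
        word i = span (plane i)

        plane∈word : ∀ i k → Subspace.member (word i) (plane i k)
        plane∈word i k = unit k , combination-unit k (plane i)

        word-dim : ∀ i → HasDim V (word i) 3
        word-dim i = plane i , independent⇒basis (word i) (independent i) (plane∈word i) λ x∈ → x∈

        Meeting : Fin M → Fin M → Set
        Meeting i j = ∃[ a ] a ≢ 𝟎 × ∃[ a′ ] combination a (plane i) ≈ᴹ combination a′ (plane j)

        meeting? : ∀ i j → Dec (Meeting i j)
        meeting? i j = search bits³ λ a → ¬? (a ≟ᵇ 𝟎) ×-dec search bits³ λ a′ → _ ≈? _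
          where bits³ = Vec-finite Bool-finite 3

        meeting-distance : ∀ {i j} → i ≢ j → Meeting i j → SubspaceDistance V (word i) (word j) 4
        meeting-distance {i} {j} i≢j (a , a≢𝟎 , a′ , eq) =
          3 , 3 , 1 , word-dim i , word-dim j ,
          (b , independent⇒basis X b-independent inside spanning) , ≡.refl
          where
          p = combination a (plane i)
          b = Vector._∷_ p Vector.[]
          X = _⊓_ V (word i) (word j)
          b-independent : Independent b
          b-independent (true ∷ []) p≈0 = ⊥-elim (a≢𝟎 (independent i a
            (≈ᴹ-trans (≈ᴹ-sym (combination-1 b)) p≈0)))
          b-independent (false ∷ []) _ = ≡.refl
          inside : ∀ k → Subspace.member X (b k)
          inside zero = (a , ≈ᴹ-refl) , (a′ , ≈ᴹ-sym eq)
          spanning : ∀ {x} → Subspace.member X x → ∃[ c ] combination c b ≈ᴹ x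
          spanning {x} ((c , p) , (c′ , q)) with c ≟ᵇ 𝟎 | c ≟ᵇ a
          ... | yes ≡.refl | _ = 𝟎 , ≈ᴹ-trans (combination-0 b)
                (≈ᴹ-trans (≈ᴹ-sym (combination-0 (plane i))) p)
          ... | no _ | yes ≡.refl = true ∷ [] , ≈ᴹ-trans (combination-1 b) p
          ... | no c≢𝟎 | no c≢a =
                contradiction (meet i j c c′ a a′ (≈ᴹ-trans p (≈ᴹ-sym q)) eq c≢𝟎 a≢𝟎 c≢a) i≢j

        disjoint-distance : ∀ {i j} → ¬ Meeting i j → SubspaceDistance V (word i) (word j) 6
        disjoint-distance {i} {j} ¬meeting =
          3 , 3 , 0 , word-dim i , word-dim j ,
          (Vector.[] , independent⇒basis _ (λ { [] _ → ≡.refl }) (λ ()) spanning) , ≡.refl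
          where
          spanning : ∀ {x} → Subspace.member (_⊓_ V (word i) (word j)) x →
            ∃[ c ] combination c Vector.[] ≈ᴹ x
          spanning {x} ((c , p) , (c′ , q)) with c ≟ᵇ 𝟎
          ... | yes ≡.refl = [] , ≈ᴹ-trans (combination-[] Vector.[])
                (≈ᴹ-trans (≈ᴹ-sym (combination-0 (plane i))) p)
          ... | no c≢𝟎 = contradiction (c , c≢𝟎 , c′ , ≈ᴹ-trans p (≈ᴹ-sym q)) ¬meeting

      code : Code V v M 4 3
      code = record
        { ambient  = ambient
        ; word     = word
        ; distinct = λ {i} {j} i≢j (to , _) → i≢j
            (meet i j (unit 0F) (proj₁ (to (plane∈word i 0F)))
          (unit 1F) (proj₁ (to (plane∈word i 1F)))
          (≈ᴹ-trans (combination-unit 0F (plane i)) (≈ᴹ-sym (proj₂ (to (plane∈word i 0F)))))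
                      (≈ᴹ-trans (combination-unit 1F (plane i)) (≈ᴹ-sym (proj₂ (to (plane∈word i 1F)))))
                      (λ ()) (λ ()) (λ ()))
        ; word-dim = word-dim
        ; distance = distance
        ; attained = let i , j , i≢j , a , a′ , a≢𝟎 , eq = touching in
            i , j , i≢j , meeting-distance i≢j (a , a≢𝟎 , a′ , eq)
        }
        where
        distance : ∀ {i j} → i ≢ j → ∃[ δ ] SubspaceDistance V (word i) (word j) δ × 4 ≤ δ
        distance {i} {j} i≢j with meeting? i j
        ... | yes m = 4 , meeting-distance i≢j m , ℕ.≤-refl
        ... | no ¬m = 6 , disjoint-distance ¬m , ℕ.m≤m+n 4 2

  -- Additive maps between vector spaces over 𝔽₂ are linear.
  module Transport (U V : VectorSpace) where
    private
      module U = Spans U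
      module V = Spans V

    record Embedding : Set where
      field
        to       : U.Carrierᴹ → V.Carrierᴹ
        cong     : ∀ {x y} → x U.≈ᴹ y → to x V.≈ᴹ to y
        additive : ∀ x y → to (x U.+ᴹ y) V.≈ᴹ to x V.+ᴹ to y
        trivial  : ∀ {x} → to x V.≈ᴹ V.0ᴹ → x U.≈ᴹ U.0ᴹ

      zero-to : to U.0ᴹ V.≈ᴹ V.0ᴹ
      zero-to = V.≈ᴹ-trans (cong (U.≈ᴹ-sym (U.x+x≈0 U.0ᴹ)))
        (V.≈ᴹ-trans (additive _ _) (V.x+x≈0 _))

      injective : ∀ {x y} → to x V.≈ᴹ to y → x U.≈ᴹ y
      injective {x} {y} eq = U.sum≈0⇒≈ (trivial (V.≈ᴹ-trans (additive x y) (V.≈⇒sum≈0 eq)))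

      scale-to : ∀ κ x → to (κ U.*ₗ x) V.≈ᴹ κ V.*ₗ to x
      scale-to true  x = V.≈ᴹ-trans (cong (U.*ₗ-identityˡ x)) (V.≈ᴹ-sym (V.*ₗ-identityˡ (to x)))
      scale-to false x = V.≈ᴹ-trans (cong (U.*ₗ-zeroˡ x))
        (V.≈ᴹ-trans zero-to (V.≈ᴹ-sym (V.*ₗ-zeroˡ (to x))))

      combination-to : ∀ {k} (a : Vec Bool k) v →
        V.combination a (to ∘ v) V.≈ᴹ to (U.combination a v)
      combination-to []      v = V.≈ᴹ-trans (V.combination-[] _)
        (V.≈ᴹ-trans (V.≈ᴹ-sym zero-to) (cong (U.≈ᴹ-sym (U.combination-[] v))))
      combination-to (κ ∷ a) v = V.≈ᴹ-trans (V.combination-∷ κ a _) (V.≈ᴹ-sym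
        (V.≈ᴹ-trans (cong (U.combination-∷ κ a v)) (V.≈ᴹ-trans (additive _ _)
          (V.+ᴹ-cong (scale-to κ (v zero)) (V.≈ᴹ-sym (combination-to a (v ∘ suc)))))))

      family-to : ∀ {M} → U.PlaneFamily M → V.PlaneFamily M
      family-to (plane , F) = (λ i → to ∘ plane i) , record
        { independent = λ i a eq → independent i a
            (trivial (V.≈ᴹ-trans (V.≈ᴹ-sym (combination-to a (plane i))) eq))
        ; meet = λ i j a a′ c c′ p q → meet i j a a′ c c′ (from-eq i j a a′ p) (from-eq i j c c′ q)
        ; touching = let i , j , i≢j , a , a′ , a≢𝟎 , eq = touching in
            i , j , i≢j , a , a′ , a≢𝟎 , V.≈ᴹ-trans (combination-to a (plane i))
              (V.≈ᴹ-trans (cong eq) (V.≈ᴹ-sym (combination-to a′ (plane j))))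
        }
        where
        open U.IsPlaneFamily F
        from-eq : ∀ i j a a′ →
          V.combination a (to ∘ plane i) V.≈ᴹ V.combination a′ (to ∘ plane j) →
          U.combination a (plane i) U.≈ᴹ U.combination a′ (plane j)
        from-eq i j a a′ eq = injective (V.≈ᴹ-trans (V.≈ᴹ-sym (combination-to a (plane i)))
          (V.≈ᴹ-trans eq (combination-to a′ (plane j))))

    changeBasis : ∀ {v} → HasDim U (whole U) v → HasDim V (whole V) v → Embedding
    changeBasis (e , E) (f , F) = record
      { to       = λ x → V.combination (coordinate x) f
      ; cong     = λ {x} {y} x≈y → V.≈ᴹ-reflexive (≡.cong (λ a → V.combination a f)
          (unique (coordinate x) (coordinate y)
            (U.≈ᴹ-trans (correct x) (U.≈ᴹ-trans x≈y (U.≈ᴹ-sym (correct y))))))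
      ; additive = λ x y → V.≈ᴹ-trans (V.≈ᴹ-reflexive (≡.cong (λ a → V.combination a f)
          (unique (coordinate (x U.+ᴹ y)) (coordinate x U.⊞ coordinate y)
            (U.≈ᴹ-trans (correct (x U.+ᴹ y)) (U.≈ᴹ-sym (U.≈ᴹ-trans
            (U.combination-+ (coordinate x) (coordinate y) e) (U.+ᴹ-cong (correct x) (correct y))))))))
          (V.combination-+ (coordinate x) (coordinate y) f)
      ; trivial  = λ {x} eq → U.≈ᴹ-trans (U.≈ᴹ-sym (correct x)) (U.≈ᴹ-trans
          (U.≈ᴹ-reflexive (≡.cong (λ a → U.combination a e)
            (V.basis⇒independent F (coordinate x) eq)))
          (U.combination-0 e))
      }
      where
      coordinate : U.Carrierᴹ → Vec Bool _
      coordinate x = proj₁ (U.basis⇒spanning E {x} _)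
      correct : ∀ x → U.combination (coordinate x) e U.≈ᴹ x
      correct x = proj₂ (U.basis⇒spanning E {x} _)
      unique : ∀ a b → U.combination a e U.≈ᴹ U.combination b e → a ≡ b
      unique = U.independent⇒injective (U.basis⇒independent E)

module Maximum where
  open import Data.Fin.Patterns using (0F; 1F)
  open import Data.Nat.Base using (_+_; _*_; _^_; _≤_; s≤s; z≤n)
  open import Data.Vec.Base using (lookup; tabulate)
  open import Data.Vec.Functional using (Vector)
  open Enumeration
  open import Function.Properties.Inverse using (↔-refl)
  open PlaneFamilies
  open import Relation.Nullary.Decidable using (map′; _×-dec_; _→-dec_; ¬?; decidable-stable)

  module FromCode {V : VectorSpace} {v M} (C : Code V v M 4 3) where
    open Spans V
    open Code C

    private
      plane : Fin M → Vector Carrierᴹ 3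
      plane i = proj₁ (word-dim i)

      plane-basis : ∀ i → IsBasis V (word i) (plane i)
      plane-basis i = proj₂ (word-dim i)

      independent : ∀ i → Independent (plane i)
      independent i = basis⇒independent (plane-basis i)

      combination∈word : ∀ i a → Subspace.member (word i) (combination a (plane i))
      combination∈word i = combination-∈ (word i) (IsBasis.inside (plane-basis i))

      2*-cancel : ∀ c → 4 + 2 * c ≤ 6 → c ≤ 1
      2*-cancel zero          _ = z≤n
      2*-cancel (suc zero)    _ = ℕ.≤-refl
      2*-cancel (suc (suc c)) p = contradiction
        (ℕ.≤-trans (ℕ.+-monoʳ-≤ 4 (ℕ.*-monoʳ-≤ 2 (s≤s (s≤s (z≤n {c}))))) p)
        λ { (s≤s (s≤s (s≤s (s≤s (s≤s (s≤s ())))))) }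

      meet-equal : ∀ {X c} → HasDim V X c → c ≤ 1 → ∀ {x y} →
        Subspace.member X x → Subspace.member X y → ¬ x ≈ᴹ 0ᴹ → ¬ y ≈ᴹ 0ᴹ → x ≈ᴹ y
      meet-equal (b , B) c≤1 x∈ y∈ x≉0 y≉0
        with basis⇒spanning B x∈ | basis⇒spanning B y∈ | c≤1
      ... | []         , p | _              | z≤n     =
        contradiction (≈ᴹ-trans (≈ᴹ-sym p) (combination-[] b)) x≉0
      ... | false ∷ [] , p | _              | s≤s z≤n =
        contradiction (≈ᴹ-trans (≈ᴹ-sym p) (combination-0 b)) x≉0
      ... | true ∷ []  , p | false ∷ [] , q | s≤s z≤n =
        contradiction (≈ᴹ-trans (≈ᴹ-sym q) (combination-0 b)) y≉0
      ... | true ∷ []  , p | true ∷ []  , q | s≤s z≤n = ≈ᴹ-trans (≈ᴹ-sym p) q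

      nonzero : ∀ i a → a ≢ 𝟎 → ¬ combination a (plane i) ≈ᴹ 0ᴹ
      nonzero i a a≢𝟎 eq = a≢𝟎 (independent i a eq)

      intersection : ∀ i j {δ} → SubspaceDistance V (word i) (word j) δ →
        ∃[ m ] HasDim V (_⊓_ V (word i) (word j)) m × δ + 2 * m ≡ 6
      intersection i j (k , l , m , K , L , X , eq) = m , X , ≡.trans eq
        (≡.cong₂ _+_ (dimension-unique K (word-dim i)) (dimension-unique L (word-dim j)))

      meet : ∀ i j a a′ c c′ →
        combination a (plane i) ≈ᴹ combination a′ (plane j) →
        combination c (plane i) ≈ᴹ combination c′ (plane j) →
        a ≢ 𝟎 → c ≢ 𝟎 → a ≢ c → i ≡ j
      meet i j a a′ c c′ p q a≢𝟎 c≢𝟎 a≢c = decidable-stable (i Fin.≟ j) λ i≢j →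
        let δ , d , 4≤δ = distance {i} {j} i≢j
            m , X , eq = intersection i j {δ} d
        in a≢c (independent⇒injective (independent i) a c
          (meet-equal {_⊓_ V (word i) (word j)} X
            (2*-cancel m (ℕ.≤-trans (ℕ.+-monoˡ-≤ (2 * m) 4≤δ) (ℕ.≤-reflexive eq)))
            (∈-both a a′ p) (∈-both c c′ q) (nonzero i a a≢𝟎) (nonzero i c c≢𝟎)))
        where
        ∈-both : ∀ a a′ → combination a (plane i) ≈ᴹ combination a′ (plane j) →
          Subspace.member (_⊓_ V (word i) (word j)) (combination a (plane i))
        ∈-both a a′ p = combination∈word i a ,
          Subspace.resp (word j) (≈ᴹ-sym p) (combination∈word j a′)

      common-vector : ∀ i j {X} → (∀ {x} → Subspace.member X x →
        Subspace.member (word i) x × Subspace.member (word j) x) → HasDim V X 1 →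
        ∃[ a ] ∃[ a′ ] a ≢ 𝟎 × combination a (plane i) ≈ᴹ combination a′ (plane j)
      common-vector i j X⊆ (b , B) = proj₁ aᵢ , proj₁ aⱼ
        , (λ a≡𝟎 → unit≢𝟎 0F (basis⇒independent B (unit 0F) (≈ᴹ-trans (combination-1 b)
            (≈ᴹ-trans (≈ᴹ-sym (proj₂ aᵢ))
              (≈ᴹ-trans (≈ᴹ-reflexive (≡.cong (λ a → combination a (plane i)) a≡𝟎))
                (combination-0 (plane i)))))))
        , ≈ᴹ-trans (proj₂ aᵢ) (≈ᴹ-sym (proj₂ aⱼ))
        where
        aᵢ = basis⇒spanning (plane-basis i) (proj₁ (X⊆ (IsBasis.inside B 0F)))
        aⱼ = basis⇒spanning (plane-basis j) (proj₂ (X⊆ (IsBasis.inside B 0F)))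

      touching : ∃[ i ] ∃[ j ] i ≢ j × (∃[ a ] ∃[ a′ ]
        a ≢ 𝟎 × combination a (plane i) ≈ᴹ combination a′ (plane j))
      touching =
        let i , j , i≢j , d = attained
            m , X , eq = intersection i j {4} d
        in i , j , i≢j , common-vector i j {_⊓_ V (word i) (word j)} (λ x∈ → x∈)
          (≡.subst (HasDim V (_⊓_ V (word i) (word j)))
            (ℕ.*-cancelˡ-≡ m 1 2 (ℕ.+-cancelˡ-≡ 4 (2 * m) 2 eq)) X)

    planeFamily : PlaneFamily M
    planeFamily = plane , isPlaneFamily independent meet touching

  greatest : ∀ {P : ℕ → Set} → (∀ m → Dec (P m)) → ∀ b → (∀ m → P m → m ≤ b) →
    ∀ {m₀} → P m₀ → ∃[ A ] P A × (∀ m → P m → m ≤ A)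
  greatest P? zero    bound {m₀} p with ℕ.n≤0⇒n≡0 (bound m₀ p)
  ... | ≡.refl = 0 , p , bound
  greatest P? (suc b) bound p with P? (suc b)
  ... | yes q = suc b , q , bound
  ... | no ¬q = greatest P? b (λ m r → ℕ.≤-pred (ℕ.≤∧≢⇒< (bound m r) λ { ≡.refl → ¬q r })) p

  module Search (V : VectorSpace) {v} (size : Inverse (LeftModule.≈ᴹ-setoid V) (≡.setoid (Fin (2 ^ v))))
    (ambient : HasDim V (whole V) v) where
    open Spans V
    open Inverse size using (to; from; to-cong; strictlyInverseʳ)

    _≈?_ : ∀ x y → Dec (x ≈ᴹ y)
    x ≈? y = map′ (Inverse-injective size) to-cong (to x Fin.≟ to y)

    private
      bits³ = Vec-finite Bool-finite 3

      independent? : ∀ w → Dec (Independent {3} w)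
      independent? w = searchAll bits³ λ a → (_ ≈? _) →-dec (a ≟ᵇ 𝟎)

    isPlaneFamily? : ∀ {M} (plane : Fin M → Vector Carrierᴹ 3) → Dec (IsPlaneFamily plane)
    isPlaneFamily? plane = map′
      (λ (p , q , r) → isPlaneFamily p q r)
      (λ (isPlaneFamily p q r) → p , q , r)
      (Fin.all? (λ i → independent? (plane i))
        ×-dec Fin.all? (λ i → Fin.all? λ j →
          searchAll bits³ λ a → searchAll bits³ λ a′ → searchAll bits³ λ c → searchAll bits³ λ c′ →
            (_ ≈? _) →-dec ((_ ≈? _) →-dec
              (¬? (a ≟ᵇ 𝟎) →-dec (¬? (c ≟ᵇ 𝟎) →-dec (¬? (a ≟ᵇ c) →-dec (i Fin.≟ j))))))
        ×-dec Fin.any? λ i → Fin.any? λ j → ¬? (i Fin.≟ j) ×-dec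
          search bits³ λ a → search bits³ λ a′ → ¬? (a ≟ᵇ 𝟎) ×-dec (_ ≈? _))

    isPlaneFamily-cong : ∀ {M} {p q : Fin M → Vector Carrierᴹ 3} → (∀ i k → p i k ≈ᴹ q i k) →
      IsPlaneFamily p → IsPlaneFamily q
    isPlaneFamily-cong {p = p} {q} eq (isPlaneFamily ind meet (i , j , i≢j , a , a′ , a≢𝟎 , t)) =
      isPlaneFamily
        (λ i a z → ind i a (≈ᴹ-trans (change i a) z))
        (λ i j a a′ c c′ r s → meet i j a a′ c c′ (back i j a a′ r) (back i j c c′ s))
        (i , j , i≢j , a , a′ , a≢𝟎 ,
          ≈ᴹ-trans (≈ᴹ-sym (change i a)) (≈ᴹ-trans t (change j a′)))
      where
      change : ∀ i a → combination a (p i) ≈ᴹ combination a (q i)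
      change i a = combination-cong a (eq i)
      back : ∀ i j a a′ → combination a (q i) ≈ᴹ combination a′ (q j) →
        combination a (p i) ≈ᴹ combination a′ (p j)
      back i j a a′ r = ≈ᴹ-trans (change i a) (≈ᴹ-trans r (≈ᴹ-sym (change j a′)))

    private
      Index : Set
      Index = Vec (Fin (2 ^ v)) 3

      index-finite : Index ↔ Fin ((2 ^ v) ^ 3)
      index-finite = Vec-finite ↔-refl 3

      decode : Index → Vector Carrierᴹ 3
      decode t k = from (lookup t k)

      encode : Vector Carrierᴹ 3 → Index
      encode w = tabulate (to ∘ w)

      decode-encode : ∀ w k → decode (encode w) k ≈ᴹ w k
      decode-encode w k = ≈ᴹ-trans
        (≈ᴹ-reflexive (≡.cong from (Vec.lookup∘tabulate (to ∘ w) k))) (strictlyInverseʳ (w k))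

    planeFamily? : ∀ M → Dec (PlaneFamily M)
    planeFamily? M = map′
      (λ (ts , F) → (decode ∘ lookup ts) , F)
      (λ (plane , F) → tabulate (encode ∘ plane) , isPlaneFamily-cong
        (λ i k → ≈ᴹ-sym (≈ᴹ-trans
          (≈ᴹ-reflexive (≡.cong (λ t → decode t k) (Vec.lookup∘tabulate (encode ∘ plane) i)))
          (decode-encode (plane i) k))) F)
      (search (Vec-finite index-finite M) λ ts → isPlaneFamily? (decode ∘ lookup ts))

    planeFamily-≤ : ∀ M → PlaneFamily M → M ≤ (2 ^ v) ^ 3
    planeFamily-≤ M (plane , isPlaneFamily _ meet _) = injection⇒≤ ↔-refl index-finite (encode ∘ plane)
      λ {i} {j} eq → meet i j (unit 0F) (unit 0F) (unit 1F) (unit 1F)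
        (same eq (unit 0F)) (same eq (unit 1F)) (λ ()) (λ ()) (λ ())
      where
      same : ∀ {i j} → encode (plane i) ≡ encode (plane j) → ∀ a →
        combination a (plane i) ≈ᴹ combination a (plane j)
      same {i} {j} eq a = combination-cong a λ k → ≈ᴹ-trans (≈ᴹ-sym (decode-encode (plane i) k))
        (≈ᴹ-trans (≈ᴹ-reflexive (≡.cong (λ t → decode t k) eq)) (decode-encode (plane j) k))

    maximum : ∀ {M} → PlaneFamily M → ∃[ A ] IsA₂ v 4 3 A × M ≤ A
    maximum F =
      let A , G , bound = greatest planeFamily? ((2 ^ v) ^ 3) planeFamily-≤ F in
      A , record { attained = V , code _≈?_ ambient G ; maximal = λ N U C → bound N (transfer U C) }
        , bound _ F
      where
      transfer : ∀ {N} U → Code U v N 4 3 → PlaneFamily N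
      transfer U C = Transport.Embedding.family-to
        (Transport.changeBasis U V (Code.ambient C) ambient) (FromCode.planeFamily C)

module Configurations where
  open Char2
  open import Data.Bool.Base using (if_then_else_; _xor_)
  open import Data.Bool.Properties using (xor-same)
  open import Data.Fin.Patterns
  open import Data.Vec.Base using (replicate; zipWith)
  open Enumeration
  open LinearAlgebra
  open import Relation.Binary.PropositionalEquality using (cong; cong₂)
  open import Relation.Nullary.Decidable using (_→-dec_; ¬?; from-yes)

  Bits : ℕ → Set
  Bits = Vec Bool

  infixl 6 _+ᵇ_
  _+ᵇ_ : ∀ {k} → Bits k → Bits k → Bits k
  _+ᵇ_ = zipWith _xor_

  0ᵇ : ∀ {k} → Bits k
  0ᵇ = replicate _ false

  +ᵇ≡0⇒≡ : ∀ {k} (x y : Bits k) → x +ᵇ y ≡ 0ᵇ → x ≡ y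
  +ᵇ≡0⇒≡ []      []      _ = ≡.refl
  +ᵇ≡0⇒≡ (a ∷ x) (b ∷ y) p = cong₂ _∷_
    (Char2Ring.sum≈0⇒≈ (Ring₂.char2Ring bits) (cong Vec.head p)) (+ᵇ≡0⇒≡ x y (cong Vec.tail p))

  +ᵇ-self : ∀ {k} (x : Bits k) → x +ᵇ x ≡ 0ᵇ
  +ᵇ-self []      = ≡.refl
  +ᵇ-self (a ∷ x) = cong₂ _∷_ (xor-same a) (+ᵇ-self x)

  infixr 7 _·ᵇ_
  _·ᵇ_ : ∀ {k} → Bool → Bits k → Bits k
  κ ·ᵇ x = if κ then x else 0ᵇ

  lineBasis : Fin 7 → Bits 3 × Bits 3
  lineBasis 0F = (true  ∷ false ∷ false ∷ []) , (false ∷ true  ∷ false ∷ [])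
  lineBasis 1F = (true  ∷ false ∷ false ∷ []) , (false ∷ false ∷ true  ∷ [])
  lineBasis 2F = (true  ∷ false ∷ false ∷ []) , (false ∷ true  ∷ true  ∷ [])
  lineBasis 3F = (false ∷ true  ∷ false ∷ []) , (false ∷ false ∷ true  ∷ [])
  lineBasis 4F = (false ∷ true  ∷ false ∷ []) , (true  ∷ false ∷ true  ∷ [])
  lineBasis 5F = (true  ∷ true  ∷ false ∷ []) , (false ∷ false ∷ true  ∷ [])
  lineBasis 6F = (true  ∷ true  ∷ false ∷ []) , (true  ∷ false ∷ true  ∷ [])

  point : Fin 7 → Bits 2 → Bits 3
  point l (a ∷ b ∷ []) = a ·ᵇ proj₁ (lineBasis l) +ᵇ b ·ᵇ proj₂ (lineBasis l)

  private
    bits² = Vec-finite Bool-finite 2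

    _≟²_ : (s t : Bits 2) → Dec (s ≡ t)
    _≟²_ = ↔⇒decidable bits²

    _≟³_ : (x y : Bits 3) → Dec (x ≡ y)
    _≟³_ = ↔⇒decidable (Vec-finite Bool-finite 3)

  point-+ : ∀ l s t → point l (s +ᵇ t) ≡ point l s +ᵇ point l t
  point-+ = from-yes (Fin.all? {7} λ l → searchAll bits² λ s → searchAll bits² λ t →
    point l (s +ᵇ t) ≟³ (point l s +ᵇ point l t))

  point-nonzero : ∀ l s → point l s ≡ 0ᵇ → s ≡ 0ᵇ
  point-nonzero = from-yes (Fin.all? {7} λ l → searchAll bits² λ s →
    (point l s ≟³ 0ᵇ) →-dec (s ≟² 0ᵇ))

  point-injective : ∀ l s t → point l s ≡ point l t → s ≡ t
  point-injective l s t p = +ᵇ≡0⇒≡ s t (point-nonzero l (s +ᵇ t)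
    (≡.trans (point-+ l s t) (≡.trans (cong (_+ᵇ point l t) p) (+ᵇ-self (point l t)))))

  lines-meet : ∀ l m s s′ → point l s ≡ point m s′ → s ≢ 0ᵇ →
    ∀ t t′ → point l t ≡ point m t′ → t ≢ 0ᵇ → s ≢ t → l ≡ m
  lines-meet = from-yes (Fin.all? {7} λ l → Fin.all? {7} λ m →
    searchAll bits² λ s → searchAll bits² λ s′ → (point l s ≟³ point m s′) →-dec (¬? (s ≟² 0ᵇ) →-dec
    searchAll bits² λ t → searchAll bits² λ t′ → (point l t ≟³ point m t′) →-dec
      (¬? (t ≟² 0ᵇ) →-dec (¬? (s ≟² t) →-dec (l Fin.≟ m)))))

  -- The 3-dimensional subspace W = w(𝔽₂³) of K and the data of the new planes.
  record Layout : Set₁ where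
    field
      K : FiniteField₂
    open FiniteField₂ K public
    field
      w           : Bits 3 → Carrier
      w-+         : ∀ x y → w (x +ᵇ y) ≡ w x ⊕ w y
      w-nonzero   : ∀ x → w x ≡ 0# → x ≡ 0ᵇ
      newSize     : ℕ
      line        : Fin newSize → Fin 7
      A B         : Fin newSize → Carrier

    scale : Bool → Carrier → Carrier
    scale κ x = if κ then x else 0#

    δ : Fin 7 → Carrier
    δ l = let z₁ , z₂ = lineBasis l in w z₁ ⊗ w z₂ ⊗ (w z₁ ⊕ w z₂)

    ratio : Fin newSize → Bits 2 → Carrier
    ratio i s = let z = w (point (line i) s) in (B i ⊕ z ⊗ z) ⊗ (A i ⊕ z) ⁻¹

    slot : Fin newSize → Bits 2 → Carrier
    slot i s = let z = w (point (line i) s) in (A i ⊗ (z ⊗ z) ⊕ B i ⊗ z) ⊗ δ (line i) ⁻¹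

  record Configuration : Set₁ where
    field
      layout : Layout
    open Layout layout public
    field
      keptSize    : ℕ
      kept        : Fin keptSize → Carrier
      kept-inj    : ∀ {i j} → kept i ≡ kept j → i ≡ j
      removed     : Carrier → Bool
      kept-¬rem   : ∀ i → removed (kept i) ≡ false
      A-nonzero   : ∀ i s → A i ⊕ w (point (line i) s) ≢ 0#
      ratio-rem   : ∀ i s → removed (ratio i s) ≡ true
      ratio-inj   : ∀ i j s t → line i ≡ line j → ratio i s ≡ ratio j t → i ≡ j × s ≡ t
      slot-inj    : ∀ i j s t κ → s ≢ 0ᵇ → point (line i) s ≡ point (line j) t →
                    slot i s ≡ slot j t ⊕ scale κ 1# → i ≡ j

  module ConfigurationProperties (C : Configuration) where
    open Configuration C
    private
      module R = CommutativeRing commutativeRing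
    open Char2Ring char2Ring using (sum≈0⇒≈; module Solver)
    open Solver

    _≟_ : (x y : Carrier) → Dec (x ≡ y)
    _≟_ = ↔⇒decidable finite

    inverseˡ : ∀ {x} → x ≢ 0# → x ⁻¹ ⊗ x ≡ 1#
    inverseˡ x≢0 = ≡.trans (R.*-comm _ _) (inverse x≢0)

    ⊗-nonzero : ∀ {x y} → x ≢ 0# → y ≢ 0# → x ⊗ y ≢ 0#
    ⊗-nonzero {x} {y} x≢0 y≢0 xy≡0 = y≢0 (≡.trans (≡.sym (R.*-identityˡ y))
      (≡.trans (cong (_⊗ y) (≡.sym (inverseˡ x≢0)))
        (≡.trans (R.*-assoc (x ⁻¹) x y) (≡.trans (cong (x ⁻¹ ⊗_) xy≡0) (R.zeroʳ (x ⁻¹))))))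

    ⁻¹-nonzero : ∀ {x} → x ≢ 0# → x ⁻¹ ≢ 0#
    ⁻¹-nonzero {x} x≢0 p = 1≢0 (≡.trans (≡.sym (inverse x≢0)) (≡.trans (cong (x ⊗_) p) (R.zeroʳ x)))

    ⊗-cancelʳ : ∀ {x y z} → z ≢ 0# → x ⊗ z ≡ y ⊗ z → x ≡ y
    ⊗-cancelʳ {x} {y} {z} z≢0 p = ≡.trans (≡.sym (undo x)) (≡.trans (cong (_⊗ z ⁻¹) p) (undo y))
      where
      undo : ∀ a → a ⊗ z ⊗ z ⁻¹ ≡ a
      undo a = ≡.trans (R.*-assoc a z (z ⁻¹)) (≡.trans (cong (a ⊗_) (inverse z≢0)) (R.*-identityʳ a))

    w-0 : w 0ᵇ ≡ 0#
    w-0 = ≡.trans (w-+ 0ᵇ 0ᵇ) (R.-‿inverseˡ (w 0ᵇ))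

    w-· : ∀ κ x → w (κ ·ᵇ x) ≡ scale κ (w x)
    w-· true  x = ≡.refl
    w-· false x = w-0

    w-point : ∀ l a b → w (point l (a ∷ b ∷ [])) ≡
      scale a (w (proj₁ (lineBasis l))) ⊕ scale b (w (proj₂ (lineBasis l)))
    w-point l a b = ≡.trans (w-+ (a ·ᵇ proj₁ (lineBasis l)) (b ·ᵇ proj₂ (lineBasis l)))
      (cong₂ _⊕_ (w-· a _) (w-· b _))

    w-point-nonzero : ∀ l {s} → s ≢ 0ᵇ → w (point l s) ≢ 0#
    w-point-nonzero l s≢0 p = s≢0 (point-nonzero l _ (w-nonzero _ p))

    w-point-+ : ∀ l s t → w (point l (s +ᵇ t)) ≡ w (point l s) ⊕ w (point l t)
    w-point-+ l s t = ≡.trans (cong w (point-+ l s t)) (w-+ (point l s) (point l t))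

    δ-any : ∀ l s t → s ≢ 0ᵇ → t ≢ 0ᵇ → s ≢ t →
      w (point l s) ⊗ w (point l t) ⊗ (w (point l s) ⊕ w (point l t)) ≡ δ l
    δ-any l s@(a ∷ b ∷ []) t@(c ∷ d ∷ []) s≢0 t≢0 s≢t =
      ≡.trans (cong₂ (λ x y → x ⊗ y ⊗ (x ⊕ y)) (w-point l a b) (w-point l c d))
        (cases a b c d s≢0 t≢0 s≢t)
      where
      x = w (proj₁ (lineBasis l))
      y = w (proj₂ (lineBasis l))
      cases : ∀ a b c d → (a ∷ b ∷ []) ≢ 0ᵇ → (c ∷ d ∷ []) ≢ 0ᵇ → (a ∷ b ∷ []) ≢ (c ∷ d ∷ []) →
        (scale a x ⊕ scale b y) ⊗ (scale c x ⊕ scale d y)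
          ⊗ ((scale a x ⊕ scale b y) ⊕ (scale c x ⊕ scale d y)) ≡ x ⊗ y ⊗ (x ⊕ y)
      cases false false _ _ p _ _ = contradiction ≡.refl p
      cases _ _ false false _ p _ = contradiction ≡.refl p
      cases true false true false _ _ p = contradiction ≡.refl p
      cases false true false true _ _ p = contradiction ≡.refl p
      cases true true true true _ _ p = contradiction ≡.refl p
      cases true false false true _ _ _ = solve 2 (λ x y →
        (x :+ con false) :* (con false :+ y) :* ((x :+ con false) :+ (con false :+ y))
        := x :* y :* (x :+ y)) ≡.refl x y
      cases true false true true _ _ _ = solve 2 (λ x y →
        (x :+ con false) :* (x :+ y) :* ((x :+ con false) :+ (x :+ y))
        := x :* y :* (x :+ y)) ≡.refl x y
      cases false true true false _ _ _ = solve 2 (λ x y →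
        (con false :+ y) :* (x :+ con false) :* ((con false :+ y) :+ (x :+ con false))
        := x :* y :* (x :+ y)) ≡.refl x y
      cases false true true true _ _ _ = solve 2 (λ x y →
        (con false :+ y) :* (x :+ y) :* ((con false :+ y) :+ (x :+ y))
        := x :* y :* (x :+ y)) ≡.refl x y
      cases true true true false _ _ _ = solve 2 (λ x y →
        (x :+ y) :* (x :+ con false) :* ((x :+ y) :+ (x :+ con false))
        := x :* y :* (x :+ y)) ≡.refl x y
      cases true true false true _ _ _ = solve 2 (λ x y →
        (x :+ y) :* (con false :+ y) :* ((x :+ y) :+ (con false :+ y))
        := x :* y :* (x :+ y)) ≡.refl x y

    δ-nonzero : ∀ l → δ l ≢ 0#
    δ-nonzero l p = ⊗-nonzero (⊗-nonzero (nz s λ ()) (nz t λ ()))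
        (λ q → nz (s +ᵇ t) (λ ()) (≡.trans (w-point-+ l s t) q))
        (≡.trans (δ-any l s t (λ ()) (λ ()) (λ ())) p)
      where
      s = true ∷ false ∷ []
      t = false ∷ true ∷ []
      nz : ∀ s → s ≢ 0ᵇ → w (point l s) ≢ 0#
      nz s s≢0 = w-point-nonzero l s≢0

    -- The interpolating z of a plane: adding r(z, z²) to (c₁, c₀) changes the
    -- value at x by r x z (x + z), which is 0 or r δ.
    shift : Bool → Bool → Bits 2 → Bits 2 → Bits 2
    shift κ λ′ s t = λ′ ·ᵇ s +ᵇ κ ·ᵇ t

    shift-comm : ∀ κ λ′ s t → shift κ λ′ s t ≡ shift λ′ κ t s
    shift-comm κ λ′ (a ∷ b ∷ []) (c ∷ d ∷ []) = from-yes
      (searchAll Bool-finite λ κ → searchAll Bool-finite λ λ′ → searchAll bits² λ s → searchAll bits² λ t →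
        shift κ λ′ s t ≟² shift λ′ κ t s) κ λ′ (a ∷ b ∷ []) (c ∷ d ∷ [])

    shift-value : ∀ l s t κ λ′ → s ≢ 0ᵇ → t ≢ 0ᵇ → s ≢ t →
      let x = w (point l s) ; z = w (point l (shift κ λ′ s t)) in
      x ⊗ x ⊗ z ⊕ x ⊗ (z ⊗ z) ≡ scale κ (δ l)
    shift-value l s t κ λ′ s≢0 t≢0 s≢t = ≡.trans
      (cong (λ z → x ⊗ x ⊗ z ⊕ x ⊗ (z ⊗ z)) (≡.trans (w-point-+ l (λ′ ·ᵇ s) (κ ·ᵇ t))
        (cong₂ _⊕_ (scaled λ′ s) (scaled κ t)))) (cases κ λ′)
      where
      x = w (point l s)
      y = w (point l t)
      scaled : ∀ κ s → w (point l (κ ·ᵇ s)) ≡ scale κ (w (point l s))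
      scaled true  s = ≡.refl
      scaled false s = ≡.trans (w-point l false false) (R.+-identityˡ 0#)
      value : ∀ κ λ′ → Carrier
      value κ λ′ = let z = scale λ′ x ⊕ scale κ y in x ⊗ x ⊗ z ⊕ x ⊗ (z ⊗ z)
      cases : ∀ κ λ′ → value κ λ′ ≡ scale κ (δ l)
      cases false false = solve 1 (λ x → x :* x :* (con false :+ con false)
        :+ x :* ((con false :+ con false) :* (con false :+ con false)) := con false) ≡.refl x
      cases false true = solve 1 (λ x → x :* x :* (x :+ con false)
        :+ x :* ((x :+ con false) :* (x :+ con false)) := con false) ≡.refl x
      cases true false = ≡.trans (solve 2 (λ x y → x :* x :* (con false :+ y)
        :+ x :* ((con false :+ y) :* (con false :+ y)) := x :* y :* (x :+ y)) ≡.refl x y)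
        (δ-any l s t s≢0 t≢0 s≢t)
      cases true true = ≡.trans (solve 2 (λ x y → x :* x :* (x :+ y)
        :+ x :* ((x :+ y) :* (x :+ y)) := x :* y :* (x :+ y)) ≡.refl x y)
        (δ-any l s t s≢0 t≢0 s≢t)

module Expurgation where
  open Char2
  open Configurations
  open import Data.Bool.Base using (_xor_)
  open Enumeration
  open LinearAlgebra
  open import Relation.Binary.PropositionalEquality using (cong; cong₂)

  -- A ring R containing K, with a complement U r of the line K r for every
  -- nonzero r; π r is the coefficient of r along this complement.
  record Setting (C : Configuration) : Set₁ where
    open Configuration C
    field
      R : Char2Ring
    open Char2Ring R public
      renaming (Carrier to |R|; 0# to 0ᴿ; 1# to 1ᴿ)
    field
      embedding : Homomorphism ring₂ R
    open Homomorphism embedding public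
    field
      N   : ℕ
      U   : |R| → Fin N → |R|
      π   : |R| → |R| → Carrier
      U-cong : ∀ {r s} t → r ≈ s → U r t ≈ U s t
      U-inj  : ∀ {r t t′} → ¬ r ≈ 0ᴿ → U r t ≈ U r t′ → t ≡ t′
      π-cong : ∀ r {x y} → x ≈ y → π r x ≡ π r y
      π-+    : ∀ r x y → π r (x + y) ≡ π r x ⊕ π r y
      π-self : ∀ {r} κ → ¬ r ≈ 0ᴿ → π r (ι κ * r) ≡ κ
      π-U    : ∀ {r κ} t → ¬ r ≈ 0ᴿ → κ ≢ 0# → π r (U (ι κ * r) t) ≡ 0#

  module Words {C : Configuration} (S : Setting C) where
    open Configuration C hiding (commutativeRing; char2Ring; ring)
    open ConfigurationProperties C
    open Setting S hiding (ring)
    open Solver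
    open import Relation.Binary.Reasoning.Setoid setoid
    private
      module K = Ring₂ ring₂
      module F = CommutativeRing K.commutativeRing

    ι-cong : ∀ {κ μ} → κ ≡ μ → ι κ ≈ ι μ
    ι-cong p = reflexive (cong ι p)

    ι-unit : ∀ {κ} → κ ≢ 0# → ι κ * ι (κ ⁻¹) ≈ 1ᴿ
    ι-unit κ≢0 = trans (sym (ι-* _ _)) (trans (ι-cong (inverse κ≢0)) ι-1)

    ι-cancel : ∀ {κ x} → κ ≢ 0# → ι κ * x ≈ 0ᴿ → x ≈ 0ᴿ
    ι-cancel {κ} {x} κ≢0 p = begin
      x                       ≈⟨ *-identityˡ x ⟨
      1ᴿ * x                  ≈⟨ *-congʳ (ι-unit κ≢0) ⟨
      ι κ * ι (κ ⁻¹) * x      ≈⟨ solve 3 (λ a b x → a :* b :* x := b :* (a :* x)) refl (ι κ) (ι (κ ⁻¹)) x ⟩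
      ι (κ ⁻¹) * (ι κ * x)    ≈⟨ *-congˡ p ⟩
      ι (κ ⁻¹) * 0ᴿ           ≈⟨ zeroʳ _ ⟩
      0ᴿ                      ∎

    ι-cancel-≈ : ∀ {κ x y} → κ ≢ 0# → ι κ * x ≈ ι κ * y → x ≈ y
    ι-cancel-≈ κ≢0 p = sum≈0⇒≈ (ι-cancel κ≢0 (trans (distribˡ _ _ _) (≈⇒sum≈0 p)))

    ι-nonzero : ∀ {κ r} → κ ≢ 0# → ¬ r ≈ 0ᴿ → ¬ ι κ * r ≈ 0ᴿ
    ι-nonzero κ≢0 r≉0 p = r≉0 (ι-cancel κ≢0 p)

    -- If y = μ r + u with u ∈ U r, then y has coordinate μ/κ along κ r.
    π-ratio : ∀ {κ μ r y c} t → κ ≢ 0# → ¬ r ≈ 0ᴿ → c ≈ ι κ * r → y ≈ ι μ * r + U r t →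
      π c y ≡ μ ⊗ κ ⁻¹
    π-ratio {κ} {μ} {r} {y} {c} t κ≢0 r≉0 c≈ y≈ =
      ≡.trans (π-cong c y≈′) (≡.trans (π-+ c _ _)
        (≡.trans (cong₂ _⊕_ (π-self (μ ⊗ κ ⁻¹) c≉0) (π-U t c≉0 (⁻¹-nonzero κ≢0))) (F.+-identityʳ _)))
      where
      c≉0 : ¬ c ≈ 0ᴿ
      c≉0 p = ι-nonzero κ≢0 r≉0 (trans (sym c≈) p)
      r≈ : r ≈ ι (κ ⁻¹) * c
      r≈ = sym (begin
        ι (κ ⁻¹) * c           ≈⟨ *-congˡ c≈ ⟩
        ι (κ ⁻¹) * (ι κ * r)   ≈⟨ solve 3 (λ a b x → b :* (a :* x) := a :* b :* x) refl (ι κ) (ι (κ ⁻¹)) r ⟩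
        ι κ * ι (κ ⁻¹) * r     ≈⟨ *-congʳ (ι-unit κ≢0) ⟩
        1ᴿ * r                 ≈⟨ *-identityˡ r ⟩
        r                      ∎)
      y≈′ : y ≈ ι (μ ⊗ κ ⁻¹) * c + U (ι (κ ⁻¹) * c) t
      y≈′ = trans y≈ (+-cong (begin
        ι μ * r                  ≈⟨ *-congˡ r≈ ⟩
        ι μ * (ι (κ ⁻¹) * c)     ≈⟨ *-assoc _ _ _ ⟨
        ι μ * ι (κ ⁻¹) * c       ≈⟨ *-congʳ (ι-* μ (κ ⁻¹)) ⟨
        ι (μ ⊗ κ ⁻¹) * c         ∎) (U-cong t r≈))

    q : |R| → |R| → Bits 3 → |R|
    q c₁ c₀ x = ι (w x) * ι (w x) * c₁ + ι (w x) * c₀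

    q-+ : ∀ c₁ c₀ x y → q c₁ c₀ (x +ᵇ y) ≈ q c₁ c₀ x + q c₁ c₀ y
    q-+ c₁ c₀ x y = begin
      ι (w (x +ᵇ y)) * ι (w (x +ᵇ y)) * c₁ + ι (w (x +ᵇ y)) * c₀
        ≈⟨ +-cong (*-congʳ (*-cong ι-sum ι-sum)) (*-congʳ ι-sum) ⟩
      (ι (w x) + ι (w y)) * (ι (w x) + ι (w y)) * c₁ + (ι (w x) + ι (w y)) * c₀
        ≈⟨ solve 4 (λ x y c d → (x :+ y) :* (x :+ y) :* c :+ (x :+ y) :* d
             := x :* x :* c :+ x :* d :+ (y :* y :* c :+ y :* d)) refl (ι (w x)) (ι (w y)) c₁ c₀ ⟩
      q c₁ c₀ x + q c₁ c₀ y ∎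
      where
      ι-sum : ι (w (x +ᵇ y)) ≈ ι (w x) + ι (w y)
      ι-sum = trans (ι-cong (w-+ x y)) (ι-+ (w x) (w y))

    q-interpolation : ∀ {c₁ c₀ d₁ d₀} x y → x ≢ 0ᵇ → y ≢ 0ᵇ → x ≢ y →
      q c₁ c₀ x ≈ q d₁ d₀ x → q c₁ c₀ y ≈ q d₁ d₀ y → c₁ ≈ d₁ × c₀ ≈ d₀
    q-interpolation {c₁} {c₀} {d₁} {d₀} x y x≢0 y≢0 x≢y px py = sum≈0⇒≈ e₁≈0 , sum≈0⇒≈ e₀≈0
      where
      e₁ = c₁ + d₁
      e₀ = c₀ + d₀
      root : ∀ x → x ≢ 0ᵇ → q c₁ c₀ x ≈ q d₁ d₀ x → ι (w x) * e₁ + e₀ ≈ 0ᴿ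
      root x x≢0 p = ι-cancel (λ wx≡0 → x≢0 (w-nonzero x wx≡0)) (trans
        (solve 5 (λ x a b c d → x :* (x :* (a :+ c) :+ (b :+ d))
          := x :* x :* a :+ x :* b :+ (x :* x :* c :+ x :* d)) refl (ι (w x)) c₁ c₀ d₁ d₀)
        (≈⇒sum≈0 p))
      x+y≢0 : w x ⊕ w y ≢ 0#
      x+y≢0 p = x≢y (+ᵇ≡0⇒≡ x y (w-nonzero (x +ᵇ y) (≡.trans (w-+ x y) p)))
      e₁≈0 : e₁ ≈ 0ᴿ
      e₁≈0 = ι-cancel x+y≢0 (begin
        ι (w x ⊕ w y) * e₁                                ≈⟨ *-congʳ (ι-+ (w x) (w y)) ⟩
        (ι (w x) + ι (w y)) * e₁                          ≈⟨ solve 4 (λ x y e f →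
          (x :+ y) :* e := x :* e :+ f :+ (y :* e :+ f)) refl (ι (w x)) (ι (w y)) e₁ e₀ ⟩
        ι (w x) * e₁ + e₀ + (ι (w y) * e₁ + e₀)           ≈⟨ +-cong (root x x≢0 px) (root y y≢0 py) ⟩
        0ᴿ + 0ᴿ                                           ≈⟨ +-identityˡ 0ᴿ ⟩
        0ᴿ                                                ∎)
      e₀≈0 : e₀ ≈ 0ᴿ
      e₀≈0 = trans (sym (trans (+-congʳ (trans (*-congˡ e₁≈0) (zeroʳ _))) (+-identityˡ e₀))) (root x x≢0 px)

    Point : Set
    Point = Bits 3 × |R|

    infix 4 _≋_
    _≋_ : Point → Point → Set
    (x , y) ≋ (x′ , y′) = x ≡ x′ × y ≈ y′

    oldWord : |R| → |R| → Bits 3 → Point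
    oldWord c₁ c₀ x = x , q c₁ c₀ x

    value : Fin newSize → |R| → |R| → Bits 2 → Bool → |R|
    value i r u s κ = q (ι (A i) * r) (ι (B i) * r + u) (point (line i) s) + ι (scale κ (δ (line i))) * r

    newWord : Fin newSize → |R| → |R| → Bits 3 → Point
    newWord i r u (a ∷ b ∷ κ ∷ []) = point (line i) (a ∷ b ∷ []) , value i r u (a ∷ b ∷ []) κ

    -- The expurgated polynomial that agrees with the new plane over the
    -- point z of its line.
    shifted₁ shifted₀ : Fin newSize → |R| → |R| → Bits 2 → |R|
    shifted₁ i r u z = ι (A i ⊕ w (point (line i) z)) * r
    shifted₀ i r u z = ι (B i ⊕ w (point (line i) z) ⊗ w (point (line i) z)) * r + u

    value-shift : ∀ i r u s t κ λ′ → s ≢ 0ᵇ → t ≢ 0ᵇ → s ≢ t →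
      let z = shift κ λ′ s t in
      value i r u s κ ≈ q (shifted₁ i r u z) (shifted₀ i r u z) (point (line i) s)
    value-shift i r u s t κ λ′ s≢0 t≢0 s≢t = sym (begin
      X * X * (ι (A i ⊕ z) * r) + X * (ι (B i ⊕ z ⊗ z) * r + u)
        ≈⟨ +-cong (*-congˡ (*-congʳ (ι-+ (A i) z)))
             (*-congˡ (+-congʳ (*-congʳ (trans (ι-+ (B i) (z ⊗ z)) (+-congˡ (ι-* z z)))))) ⟩
      X * X * ((ι (A i) + Z) * r) + X * ((ι (B i) + Z * Z) * r + u)
        ≈⟨ solve 6 (λ X Z a b r u →
             X :* X :* ((a :+ Z) :* r) :+ X :* ((b :+ Z :* Z) :* r :+ u) :=
             X :* X :* (a :* r) :+ X :* (b :* r :+ u) :+ (X :* X :* Z :+ X :* (Z :* Z)) :* r)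
             refl X Z (ι (A i)) (ι (B i)) r u ⟩
      q (ι (A i) * r) (ι (B i) * r + u) (point l s) + (X * X * Z + X * (Z * Z)) * r
        ≈⟨ +-congˡ (*-congʳ (sym ι-shift)) ⟩
      value i r u s κ ∎)
      where
      l = line i
      x = w (point l s)
      z = w (point l (shift κ λ′ s t))
      X = ι x
      Z = ι z
      ι-shift : ι (scale κ (δ l)) ≈ X * X * Z + X * (Z * Z)
      ι-shift = begin
        ι (scale κ (δ l))               ≈⟨ ι-cong (shift-value l s t κ λ′ s≢0 t≢0 s≢t) ⟨
        ι (x ⊗ x ⊗ z ⊕ x ⊗ (z ⊗ z))     ≈⟨ ι-+ _ _ ⟩
        ι (x ⊗ x ⊗ z) + ι (x ⊗ (z ⊗ z)) ≈⟨ +-cong (trans (ι-* _ z) (*-congʳ (ι-* x x)))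
                                            (trans (ι-* x _) (*-congˡ (ι-* z z))) ⟩
        X * X * Z + X * (Z * Z)         ∎

    value-shift′ : ∀ i r u s t κ λ′ → s ≢ 0ᵇ → t ≢ 0ᵇ → s ≢ t →
      let z = shift κ λ′ s t in
      value i r u t λ′ ≈ q (shifted₁ i r u z) (shifted₀ i r u z) (point (line i) t)
    value-shift′ i r u s t κ λ′ s≢0 t≢0 s≢t = ≡.subst
      (λ z → value i r u t λ′ ≈ q (shifted₁ i r u z) (shifted₀ i r u z) (point (line i) t))
      (shift-comm λ′ κ t s) (value-shift i r u t s λ′ κ t≢0 s≢0 (λ p → s≢t (≡.sym p)))

    q-0 : ∀ c₁ c₀ → q c₁ c₀ 0ᵇ ≈ 0ᴿ
    q-0 c₁ c₀ = trans (q-+ c₁ c₀ 0ᵇ 0ᵇ) (x+x≈0 (q c₁ c₀ 0ᵇ))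

    q-cong : ∀ {c₁ c₀ d₁ d₀} x → c₁ ≈ d₁ → c₀ ≈ d₀ → q c₁ c₀ x ≈ q d₁ d₀ x
    q-cong x p r = +-cong (*-congˡ p) (*-congˡ r)

    oldWord-+ : ∀ c₁ c₀ x y →
      oldWord c₁ c₀ (x +ᵇ y) ≋ (x +ᵇ y , q c₁ c₀ x + q c₁ c₀ y)
    oldWord-+ c₁ c₀ x y = ≡.refl , q-+ c₁ c₀ x y

    newWord-+ : ∀ i r u x y → let p , v = newWord i r u x ; p′ , v′ = newWord i r u y in
      newWord i r u (x +ᵇ y) ≋ (p +ᵇ p′ , v + v′)
    newWord-+ i r u (a ∷ b ∷ κ ∷ []) (c ∷ d ∷ μ ∷ []) =
      point-+ l (a ∷ b ∷ []) (c ∷ d ∷ []) , (begin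
        q c₁ c₀ (point l (s +ᵇ t)) + ι (scale (κ xor μ) (δ l)) * r
          ≈⟨ +-cong (trans (reflexive (cong (q c₁ c₀) (point-+ l s t))) (q-+ c₁ c₀ _ _))
               (*-congʳ (trans (ι-cong (scale-+ κ μ)) (ι-+ _ _))) ⟩
        q c₁ c₀ (point l s) + q c₁ c₀ (point l t) + (ι (scale κ (δ l)) + ι (scale μ (δ l))) * r
          ≈⟨ solve 5 (λ a b k m r → a :+ b :+ (k :+ m) :* r := a :+ k :* r :+ (b :+ m :* r)) refl
               (q c₁ c₀ (point l s)) (q c₁ c₀ (point l t)) (ι (scale κ (δ l))) (ι (scale μ (δ l))) r ⟩
        value i r u s κ + value i r u t μ ∎)
      where
      l = line i
      s = a ∷ b ∷ []
      t = c ∷ d ∷ []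
      c₁ = ι (A i) * r
      c₀ = ι (B i) * r + u
      scale-+ : ∀ κ μ → scale (κ xor μ) (δ l) ≡ scale κ (δ l) ⊕ scale μ (δ l)
      scale-+ true  true  = ≡.sym (F.-‿inverseˡ (δ l))
      scale-+ true  false = ≡.sym (F.+-identityʳ (δ l))
      scale-+ false μ     = ≡.sym (F.+-identityˡ (scale μ (δ l)))

    apex : Bits 3
    apex = false ∷ false ∷ true ∷ []

    newWord-apex : ∀ i r u → newWord i r u apex ≋ (0ᵇ , ι (δ (line i)) * r)
    newWord-apex i r u = ≡.refl , trans (+-congʳ (q-0 _ _)) (+-identityˡ _)

    newWord-trivial : ∀ i {r u} x → ¬ r ≈ 0ᴿ → newWord i r u x ≋ (0ᵇ , 0ᴿ) → x ≡ 0ᵇ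
    newWord-trivial i {r} {u} (a ∷ b ∷ κ ∷ []) r≉0 (p , v) = glue s≡0 (no-apex κ (begin
        ι (scale κ (δ l)) * r                   ≈⟨ +-identityˡ _ ⟨
        0ᴿ + ι (scale κ (δ l)) * r              ≈⟨ +-congʳ (q-0 c₁ c₀) ⟨
        q c₁ c₀ 0ᵇ + ι (scale κ (δ l)) * r      ≈⟨ +-congʳ (reflexive (cong (q c₁ c₀) p)) ⟨
        value i r u (a ∷ b ∷ []) κ              ≈⟨ v ⟩
        0ᴿ                                      ∎))
      where
      l = line i
      c₁ = ι (A i) * r
      c₀ = ι (B i) * r + u
      s≡0 : a ∷ b ∷ [] ≡ 0ᵇ
      s≡0 = point-nonzero l (a ∷ b ∷ []) p
      glue : ∀ {a b κ} → a ∷ b ∷ [] ≡ 0ᵇ → κ ≡ false → a ∷ b ∷ κ ∷ [] ≡ 0ᵇ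
      glue ≡.refl ≡.refl = ≡.refl
      no-apex : ∀ κ → ι (scale κ (δ l)) * r ≈ 0ᴿ → κ ≡ false
      no-apex false _ = ≡.refl
      no-apex true  e = contradiction e (ι-nonzero (δ-nonzero l) r≉0)

    record Meet (g h : Bits 3 → Point) : Set where
      field
        a a′ c c′ : Bits 3
        p         : g a ≋ h a′
        p′        : g c ≋ h c′
        a≢0       : a ≢ 0ᵇ
        c≢0       : c ≢ 0ᵇ
        a≢c       : a ≢ c

    old-old : ∀ {c₁ c₀ d₁ d₀} → Meet (oldWord c₁ c₀) (oldWord d₁ d₀) → c₁ ≈ d₁ × c₀ ≈ d₀
    old-old record { a = a ; c = c ; p = ≡.refl , v ; p′ = ≡.refl , v′
                   ; a≢0 = a≢0 ; c≢0 = c≢0 ; a≢c = a≢c } =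
      q-interpolation a c a≢0 c≢0 a≢c v v′

    old-new : ∀ {c₁ c₀ i r u} → Meet (oldWord c₁ c₀) (newWord i r u) →
      ∃[ z ] c₁ ≈ shifted₁ i r u z × c₀ ≈ shifted₀ i r u z
    old-new {c₁} {c₀} {i} {r} {u} record
      { a′ = e ∷ f ∷ κ ∷ [] ; c′ = g ∷ h ∷ μ ∷ [] ; p = ≡.refl , v ; p′ = ≡.refl , v′
      ; a≢0 = a≢0 ; c≢0 = c≢0 ; a≢c = a≢c } =
      shift κ μ s t , q-interpolation (point l s) (point l t) a≢0 c≢0 a≢c
        (trans v (value-shift i r u s t κ μ s≢0 t≢0 s≢t))
        (trans v′ (value-shift′ i r u s t κ μ s≢0 t≢0 s≢t))
      where
      l = line i
      s = e ∷ f ∷ []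
      t = g ∷ h ∷ []
      s≢0 : s ≢ 0ᵇ
      s≢0 eq = a≢0 (cong (point l) eq)
      t≢0 : t ≢ 0ᵇ
      t≢0 eq = c≢0 (cong (point l) eq)
      s≢t : s ≢ t
      s≢t eq = a≢c (cong (point l) eq)

    shifted-ratio : ∀ {i r t z c y} → ¬ r ≈ 0ᴿ →
      c ≈ shifted₁ i r (U r t) z → y ≈ shifted₀ i r (U r t) z → π c y ≡ ratio i z
    shifted-ratio {i} {r} {t} {z} r≉0 = π-ratio t (A-nonzero i z) r≉0

    +-cancelˡ-≈ : ∀ {x x′ y y′} → x ≈ x′ → x + y ≈ x′ + y′ → y ≈ y′
    +-cancelˡ-≈ {x} {x′} {y} {y′} p e = sum≈0⇒≈ (begin
      y + y′                  ≈⟨ solve 3 (λ x y z → y :+ z := x :+ y :+ (x :+ z)) refl x y y′ ⟩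
      x + y + (x + y′)        ≈⟨ ≈⇒sum≈0 (trans e (+-congʳ (sym p))) ⟩
      0ᴿ                      ∎)

    same-offset : ∀ {μ μ′ r r′ t t′} → μ ≡ μ′ → r ≈ r′ → ¬ r ≈ 0ᴿ →
      ι μ * r + U r t ≈ ι μ′ * r′ + U r′ t′ → t ≡ t′
    same-offset μ≡ r≈ r≉0 e = U-inj r≉0 (trans (+-cancelˡ-≈ (*-cong (ι-cong μ≡) r≈) e)
      (U-cong _ (sym r≈)))

    SameNew : (i j : Fin newSize) (r r′ : |R|) (t t′ : Fin N) → Set
    SameNew i j r r′ t t′ = i ≡ j × r ≈ r′ × t ≡ t′

    same-shifted : ∀ {i j r r′ t t′ z z′} → ¬ r ≈ 0ᴿ → ¬ r′ ≈ 0ᴿ → line i ≡ line j →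
      shifted₁ i r (U r t) z ≈ shifted₁ j r′ (U r′ t′) z′ →
      shifted₀ i r (U r t) z ≈ shifted₀ j r′ (U r′ t′) z′ → SameNew i j r r′ t t′
    same-shifted {i} {j} {r} {r′} {t} {t′} {z} {z′} r≉0 r′≉0 l≡ e₁ e₀ =
      conclude (ratio-inj i j z z′ l≡ (≡.trans
        (≡.sym (shifted-ratio {i} {r} {t} {z} r≉0 refl refl))
        (shifted-ratio {j} {r′} {t′} {z′} r′≉0 e₁ e₀)))
      where
      conclude : i ≡ j × z ≡ z′ → SameNew i j r r′ t t′
      conclude (≡.refl , ≡.refl) = ≡.refl , r≈ , same-offset ≡.refl r≈ r≉0 e₀
        where
        r≈ : r ≈ r′
        r≈ = ι-cancel-≈ (A-nonzero i z) e₁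

    -- Dividing by z turns the value at z into an element of K r + u.
    numerator : Fin newSize → Bits 2 → Bool → Carrier
    numerator i s κ = let z = w (point (line i) s) in
      A i ⊗ (z ⊗ z) ⊕ B i ⊗ z ⊕ scale κ (δ (line i))

    value-quotient : ∀ i r u s κ → s ≢ 0ᵇ → let z = w (point (line i) s) in
      ι (z ⁻¹) * value i r u s κ ≈ ι (z ⁻¹ ⊗ numerator i s κ) * r + u
    value-quotient i r u s κ s≢0 = begin
      Y * (Z * Z * (a * r) + Z * (b * r + u) + d * r)
        ≈⟨ solve 7 (λ Y Z a b d r u →
             Y :* (Z :* Z :* (a :* r) :+ Z :* (b :* r :+ u) :+ d :* r) :=
             Y :* (a :* (Z :* Z) :+ b :* Z :+ d) :* r :+ Z :* Y :* u) refl Y Z a b d r u ⟩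
      Y * (a * (Z * Z) + b * Z + d) * r + Z * Y * u
        ≈⟨ +-cong (*-congʳ (sym ι-quotient))
             (trans (*-congʳ (ι-unit (w-point-nonzero (line i) s≢0))) (*-identityˡ u)) ⟩
      ι (z ⁻¹ ⊗ numerator i s κ) * r + u ∎
      where
      z = w (point (line i) s)
      Y = ι (z ⁻¹)
      Z = ι z
      a = ι (A i)
      b = ι (B i)
      d = ι (scale κ (δ (line i)))
      ι-quotient : ι (z ⁻¹ ⊗ numerator i s κ) ≈ Y * (a * (Z * Z) + b * Z + d)
      ι-quotient = begin
        ι (z ⁻¹ ⊗ numerator i s κ)              ≈⟨ ι-* _ _ ⟩
        Y * ι (numerator i s κ)                 ≈⟨ *-congˡ (trans (ι-+ _ _) (+-congʳ (ι-+ _ _))) ⟩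
        Y * (ι (A i ⊗ (z ⊗ z)) + ι (B i ⊗ z) + d)
          ≈⟨ *-congˡ (+-congʳ (+-cong (trans (ι-* _ _) (*-congˡ (ι-* z z))) (ι-* _ _))) ⟩
        Y * (a * (Z * Z) + b * Z + d)           ∎

    numerator-slot : ∀ i s κ → numerator i s κ ⊗ δ (line i) ⁻¹ ≡ slot i s ⊕ scale κ 1#
    numerator-slot i s κ = ≡.trans (F.distribʳ (δ (line i) ⁻¹) _ (scale κ (δ (line i))))
      (cong (slot i s ⊕_) (scaled κ))
      where
      scaled : ∀ κ → scale κ (δ (line i)) ⊗ δ (line i) ⁻¹ ≡ scale κ 1#
      scaled true  = inverse (δ-nonzero (line i))
      scaled false = F.zeroˡ _

    apex-coordinate : ∀ {i r t s κ c y} → ¬ r ≈ 0ᴿ → s ≢ 0ᵇ → let z = w (point (line i) s) in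
      c ≈ ι (δ (line i)) * r → y ≈ ι (z ⁻¹) * value i r (U r t) s κ →
      π c y ≡ z ⁻¹ ⊗ (slot i s ⊕ scale κ 1#)
    apex-coordinate {i} {r} {t} {s} {κ} r≉0 s≢0 c≈ y≈ = ≡.trans
      (π-ratio t (δ-nonzero (line i)) r≉0 c≈ (trans y≈ (value-quotient i r (U r t) s κ s≢0)))
      (≡.trans (F.*-assoc _ _ _) (cong (w (point (line i) s) ⁻¹ ⊗_) (numerator-slot i s κ)))

    slots-differ : ∀ {x y} κ μ → x ⊕ scale κ 1# ≡ y ⊕ scale μ 1# → x ≡ y ⊕ scale (κ xor μ) 1#
    slots-differ {x} {y} κ μ p = ≡.trans
      (≡.sym (≡.trans (F.+-assoc x k k) (≡.trans (cong (x ⊕_) (F.-‿inverseˡ k)) (F.+-identityʳ x))))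
      (≡.trans (cong (_⊕ k) p) (≡.trans (F.+-assoc y _ k) (cong (y ⊕_) (cases κ μ))))
      where
      k = scale κ 1#
      cases : ∀ κ μ → scale μ 1# ⊕ scale κ 1# ≡ scale (κ xor μ) 1#
      cases true  true  = F.-‿inverseˡ 1#
      cases true  false = F.+-identityˡ 1#
      cases false μ     = F.+-identityʳ (scale μ 1#)

    same-apex : ∀ {i j r r′ t t′} s s′ κ κ′ → ¬ r ≈ 0ᴿ → ¬ r′ ≈ 0ᴿ →
      ι (δ (line i)) * r ≈ ι (δ (line j)) * r′ → s ≢ 0ᵇ → point (line i) s ≡ point (line j) s′ →
      value i r (U r t) s κ ≈ value j r′ (U r′ t′) s′ κ′ → SameNew i j r r′ t t′
    same-apex {i} {j} {r} {r′} {t} {t′} s s′ κ κ′ r≉0 r′≉0 apex≈ s≢0 p v =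
      conclude (slot-inj i j s s′ (κ xor κ′) s≢0 p (slots-differ κ κ′ slots))
      where
      z = w (point (line i) s)
      z′ = w (point (line j) s′)
      z≢0 : z ≢ 0#
      z≢0 = w-point-nonzero (line i) s≢0
      s′≢0 : s′ ≢ 0ᵇ
      s′≢0 ≡.refl = s≢0 (point-nonzero (line i) s p)
      quotients : ι (z ⁻¹) * value i r (U r t) s κ ≈ ι (z′ ⁻¹) * value j r′ (U r′ t′) s′ κ′
      quotients = *-cong (reflexive (cong (λ x → ι (w x ⁻¹)) p)) v
      slots : slot i s ⊕ scale κ 1# ≡ slot j s′ ⊕ scale κ′ 1#
      slots = ⊗-cancelʳ (⁻¹-nonzero z≢0) (≡.trans (F.*-comm _ _) (≡.trans
        (≡.sym (apex-coordinate {i} {r} {t} {s} {κ} r≉0 s≢0 refl refl))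
        (≡.trans (apex-coordinate {j} {r′} {t′} {s′} {κ′} r′≉0 s′≢0 apex≈ quotients)
          (≡.trans (F.*-comm _ _) (cong (λ x → (slot j s′ ⊕ scale κ′ 1#) ⊗ w x ⁻¹) (≡.sym p))))))
      conclude : i ≡ j → SameNew i j r r′ t t′
      conclude ≡.refl = ≡.refl , r≈ , same-offset
          (⊗-cancelʳ (⁻¹-nonzero (δ-nonzero (line i))) (≡.trans
            (quotient-slot s κ) (≡.trans (cong₂ (λ x y → w x ⁻¹ ⊗ y) p slots)
              (≡.sym (quotient-slot s′ κ′)))))
          r≈ r≉0 (trans (sym (value-quotient i r (U r t) s κ s≢0))
            (trans quotients (value-quotient i r′ (U r′ t′) s′ κ′ s′≢0)))
        where
        r≈ : r ≈ r′
        r≈ = ι-cancel-≈ (δ-nonzero (line i)) apex≈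
        quotient-slot : ∀ s κ → let z = w (point (line i) s) in
          z ⁻¹ ⊗ numerator i s κ ⊗ δ (line i) ⁻¹ ≡ z ⁻¹ ⊗ (slot i s ⊕ scale κ 1#)
        quotient-slot s κ = ≡.trans (F.*-assoc _ _ _)
          (cong (w (point (line i) s) ⁻¹ ⊗_) (numerator-slot i s κ))

    private
      _≟ˢ_ : (s t : Bits 2) → Dec (s ≡ t)
      _≟ˢ_ = ↔⇒decidable (Vec-finite Bool-finite 2)

    ≋-trans : ∀ {x y z} → x ≋ y → y ≋ z → x ≋ z
    ≋-trans (p , v) (p′ , v′) = ≡.trans p p′ , trans v v′

    ≋-sym : ∀ {x y} → x ≋ y → y ≋ x
    ≋-sym (p , v) = ≡.sym p , sym v

    common-apex : ∀ {i j r r′ t t′} a c c′ → ¬ r ≈ 0ᴿ → ¬ r′ ≈ 0ᴿ →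
      newWord i r (U r t) apex ≋ newWord j r′ (U r′ t′) a →
      newWord i r (U r t) c ≋ newWord j r′ (U r′ t′) c′ → c ≢ 0ᵇ → apex ≢ c →
      SameNew i j r r′ t t′
    common-apex {i} {j} {r} {r′} {t} {t′} (e ∷ f ∷ κ ∷ []) (g ∷ h ∷ μ ∷ []) (g′ ∷ h′ ∷ μ′ ∷ [])
      r≉0 r′≉0 (p , v) (p′ , v′) c≢0 apex≢c =
      same-apex (g ∷ h ∷ []) (g′ ∷ h′ ∷ []) μ μ′ r≉0 r′≉0 (apexes κ (trans v (+-congʳ (trans
        (reflexive (cong (q c₁ c₀) (≡.sym p))) (q-0 c₁ c₀))))) (nonzero μ c≢0 apex≢c) p′ v′
      where
      c₁ = ι (A j) * r′
      c₀ = ι (B j) * r′ + U r′ t′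
      nonzero : ∀ μ → g ∷ h ∷ μ ∷ [] ≢ 0ᵇ → apex ≢ g ∷ h ∷ μ ∷ [] → g ∷ h ∷ [] ≢ 0ᵇ
      nonzero true  _   apex≢ ≡.refl = apex≢ ≡.refl
      nonzero false c≢0 _     ≡.refl = c≢0 ≡.refl
      apex-value : value i r (U r t) (false ∷ false ∷ []) true ≈ ι (δ (line i)) * r
      apex-value = proj₂ (newWord-apex i r (U r t))
      apexes : ∀ κ → value i r (U r t) (false ∷ false ∷ []) true
        ≈ 0ᴿ + ι (scale κ (δ (line j))) * r′ → ι (δ (line i)) * r ≈ ι (δ (line j)) * r′
      apexes true  v = trans (sym apex-value) (trans v (+-identityˡ _))
      apexes false v = contradiction (trans (sym apex-value) (trans v
        (trans (+-identityˡ _) (trans (*-congʳ ι-0) (zeroˡ r′)))))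
        (ι-nonzero (δ-nonzero (line i)) r≉0)

    new-new : ∀ {i j r r′ t t′} → ¬ r ≈ 0ᴿ → ¬ r′ ≈ 0ᴿ →
      Meet (newWord i r (U r t)) (newWord j r′ (U r′ t′)) → SameNew i j r r′ t t′
    new-new {i} {j} {r} {r′} {t} {t′} r≉0 r′≉0 record
      { a = a@(e ∷ f ∷ κ ∷ []) ; c = c@(g ∷ h ∷ μ ∷ [])
      ; a′ = a′@(e′ ∷ f′ ∷ κ′ ∷ []) ; c′ = c′@(g′ ∷ h′ ∷ μ′ ∷ [])
      ; p = p , v ; p′ = p′ , v′ ; a≢0 = a≢0 ; c≢0 = c≢0 ; a≢c = a≢c } =
      cases (x ≟ˢ 0ᵇ) (y ≟ˢ 0ᵇ) (x ≟ˢ y)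
      where
      x = e ∷ f ∷ []
      y = g ∷ h ∷ []
      x′ = e′ ∷ f′ ∷ []
      y′ = g′ ∷ h′ ∷ []
      g₁ = newWord i r (U r t)
      g₂ = newWord j r′ (U r′ t′)
      is-apex : ∀ {e f} κ → e ∷ f ∷ [] ≡ 0ᵇ → e ∷ f ∷ κ ∷ [] ≢ 0ᵇ → e ∷ f ∷ κ ∷ [] ≡ apex
      is-apex true  ≡.refl _ = ≡.refl
      is-apex false ≡.refl p = contradiction ≡.refl p
      common : ∀ {b b′ d d′} → b ≡ apex → g₁ b ≋ g₂ b′ → g₁ d ≋ g₂ d′ → d ≢ 0ᵇ → b ≢ d →
        SameNew i j r r′ t t′
      common {b′ = b′} {d} {d′} ≡.refl = common-apex b′ d d′ r≉0 r′≉0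
      sum-nonzero : ∀ {b d} → b ≢ d → b +ᵇ d ≢ 0ᵇ
      sum-nonzero b≢d p = b≢d (+ᵇ≡0⇒≡ _ _ p)
      cases : Dec (x ≡ 0ᵇ) → Dec (y ≡ 0ᵇ) → Dec (x ≡ y) → SameNew i j r r′ t t′
      cases (yes x≡0) _ _ = common {b′ = a′} {c} {c′} (is-apex κ x≡0 a≢0) (p , v) (p′ , v′) c≢0 a≢c
      cases (no _) (yes y≡0) _ =
        common {b′ = c′} {a} {a′} (is-apex μ y≡0 c≢0) (p′ , v′) (p , v) a≢0 (λ e → a≢c (≡.sym e))
      cases (no x≢0) (no _) (yes x≡y) = common {b′ = a′ +ᵇ c′} {a} {a′} a+c≡apex
        (≋-trans (newWord-+ i r (U r t) a c) (≋-trans (cong₂ _+ᵇ_ p p′ , +-cong v v′)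
          (≋-sym (newWord-+ j r′ (U r′ t′) a′ c′))))
        (p , v) a≢0 (λ e → x≢0 (cong (λ { (e ∷ f ∷ _ ∷ []) → e ∷ f ∷ [] }) (≡.trans (≡.sym e) a+c≡apex)))
        where
        a+c≡apex : a +ᵇ c ≡ apex
        a+c≡apex = is-apex (κ xor μ) (≡.trans (cong (_+ᵇ y) x≡y) (+ᵇ-self y)) (sum-nonzero a≢c)
      cases (no x≢0) (no y≢0) (no x≢y) = same-shifted {z = z} {z′} r≉0 r′≉0 lines (proj₁ both) (proj₂ both)
        where
        nonzero′ : ∀ {x x′} → point (line i) x ≡ point (line j) x′ → x ≢ 0ᵇ → x′ ≢ 0ᵇ
        nonzero′ e x≢0 ≡.refl = x≢0 (point-nonzero (line i) _ e)
        lines : line i ≡ line j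
        lines = lines-meet (line i) (line j) x x′ p x≢0 y y′ p′ y≢0 x≢y
        x′≢y′ : x′ ≢ y′
        x′≢y′ e = x≢y (point-injective (line i) x y
          (≡.trans p (≡.trans (cong (point (line j)) e) (≡.sym p′))))
        z = shift κ μ x y
        z′ = shift κ′ μ′ x′ y′
        both : shifted₁ i r (U r t) z ≈ shifted₁ j r′ (U r′ t′) z′
          × shifted₀ i r (U r t) z ≈ shifted₀ j r′ (U r′ t′) z′
        both = q-interpolation (point (line i) x) (point (line i) y)
          (λ e → x≢0 (point-nonzero (line i) x e)) (λ e → y≢0 (point-nonzero (line i) y e))
          (λ e → x≢y (point-injective (line i) x y e))
          (trans (sym (value-shift i r (U r t) x y κ μ x≢0 y≢0 x≢y)) (trans v (trans
            (value-shift j r′ (U r′ t′) x′ y′ κ′ μ′ (nonzero′ p x≢0) (nonzero′ p′ y≢0) x′≢y′)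
            (reflexive (cong (q _ _) (≡.sym p))))))
          (trans (sym (value-shift′ i r (U r t) x y κ μ x≢0 y≢0 x≢y)) (trans v′ (trans
            (value-shift′ j r′ (U r′ t′) x′ y′ κ′ μ′ (nonzero′ p x≢0) (nonzero′ p′ y≢0) x′≢y′)
            (reflexive (cong (q _ _) (≡.sym p′))))))

module Family where
  open Char2
  open Configurations
  open import Data.Sum.Base using (_⊎_; inj₁; inj₂)
  open import Data.Vec.Functional using (Vector)
  open Enumeration
  open Expurgation
  open import Function.Properties.Inverse using (↔-refl)
  open LinearAlgebra
  open PlaneFamilies
  open import Relation.Binary.PropositionalEquality using (cong)

  module WordFamily {C : Configuration} (S : Setting C) (f : ℕ)
    (size : Inverse (Setting.setoid S) (≡.setoid (Fin (suc f)))) where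
    open Configuration C using (K; ring₂; 1#; 1≢0; inverse; w; keptSize; kept; kept-inj; kept-¬rem;
      removed; newSize; A-nonzero; ratio-rem)
    open Ring₂ ring₂ using (_⊗_)
    open Setting S
    open Words S
    open Inverse size using (to; from; strictlyInverseʳ)
    open Solver

    open Nonzero setoid 0ᴿ f size public

    -- Polynomials c₀x, polynomials rx² + (κr + u)x with κ kept and u ∈ U r, and
    -- the new planes.
    Index : Set
    Index = Fin (suc f) ⊎ (Fin f × Fin N × (Fin keptSize ⊎ Fin newSize))

    word : Index → Bits 3 → Point
    word (inj₁ i)                = oldWord 0ᴿ (from i)
    word (inj₂ (r , t , inj₁ k)) = oldWord (nz r) (ι (kept k) * nz r + U (nz r) t)
    word (inj₂ (r , t , inj₂ i)) = newWord i (nz r) (U (nz r) t)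

    word-+ : ∀ j x y → word j (x +ᵇ y) ≋
      (proj₁ (word j x) +ᵇ proj₁ (word j y) , proj₂ (word j x) + proj₂ (word j y))
    word-+ (inj₁ i)                = oldWord-+ _ _
    word-+ (inj₂ (r , t , inj₁ k)) = oldWord-+ _ _
    word-+ (inj₂ (r , t , inj₂ i)) = newWord-+ i _ _

    word-trivial : ∀ j x → word j x ≋ (0ᵇ , 0ᴿ) → x ≡ 0ᵇ
    word-trivial (inj₁ i)                x = proj₁
    word-trivial (inj₂ (r , t , inj₁ k)) x = proj₁
    word-trivial (inj₂ (r , t , inj₂ i)) x = newWord-trivial i x (nz≉0 r)

    word-zero : ∀ j → word j 0ᵇ ≋ (0ᵇ , 0ᴿ)
    word-zero j = ≋-trans (word-+ j 0ᵇ 0ᵇ) (+ᵇ-self _ , x+x≈0 _)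

    word-injective : ∀ j {x y} → word j x ≋ word j y → x ≡ y
    word-injective j {x} {y} (p , v) = +ᵇ≡0⇒≡ x y (word-trivial j (x +ᵇ y) (≋-trans (word-+ j x y)
      (≡.trans (cong (_+ᵇ _) p) (+ᵇ-self _) , ≈⇒sum≈0 v)))

    meet-sym : ∀ j j′ → Meet (word j) (word j′) → Meet (word j′) (word j)
    meet-sym j j′ m = record
      { a = a′ ; a′ = a ; c = c′ ; c′ = c ; p = ≋-sym p ; p′ = ≋-sym p′
      ; a≢0 = λ { ≡.refl → a≢0 (word-trivial j a (≋-trans p (word-zero j′))) }
      ; c≢0 = λ { ≡.refl → c≢0 (word-trivial j c (≋-trans p′ (word-zero j′))) }
      ; a≢c = λ { ≡.refl → a≢c (word-injective j (≋-trans p (≋-sym p′))) }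
      }
      where open Meet m

    private
      ι-1* : ∀ r → r ≈ ι 1# * r
      ι-1* r = sym (trans (*-congʳ ι-1) (*-identityˡ r))

    kept-ratio : ∀ {r t κ c y} → ¬ r ≈ 0ᴿ → c ≈ r → y ≈ ι κ * r + U r t → π c y ≡ κ
    kept-ratio {r} {t} {κ} r≉0 c≈ y≈ = ≡.trans (π-ratio t 1≢0 r≉0 (trans c≈ (ι-1* r)) y≈)
      (≡.trans (cong (κ ⊗_) 1⁻¹) (F.*-identityʳ κ))
      where
      module F = Char2Ring (Ring₂.char2Ring ring₂)
      1⁻¹ : FiniteField₂._⁻¹ K 1# ≡ 1#
      1⁻¹ = ≡.trans (≡.sym (F.*-identityˡ _)) (inverse 1≢0)

    meet-1 : ∀ i i′ → Meet (word (inj₁ i)) (word (inj₁ i′)) → i ≡ i′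
    meet-1 i i′ m = from-injective (proj₂ (old-old m))

    meet-12 : ∀ i r t k → ¬ Meet (word (inj₁ i)) (word (inj₂ (r , t , k)))
    meet-12 i r t (inj₁ k) m = nz≉0 r (sym (proj₁ (old-old m)))
    meet-12 i r t (inj₂ k) m =
      let z , c₁≈ , _ = old-new m in ι-nonzero (A-nonzero k z) (nz≉0 r) (sym c₁≈)

    meet-kept : ∀ r t k r′ t′ k′ → Meet (word (inj₂ (r , t , inj₁ k))) (word (inj₂ (r′ , t′ , inj₁ k′))) →
      (r , t , k) ≡ (r′ , t′ , k′)
    meet-kept r t k r′ t′ k′ m = conclude (nz-injective c₁≈) (kept-inj (≡.trans
        (≡.sym (kept-ratio {nz r} {t} (nz≉0 r) refl refl)) (kept-ratio {nz r′} {t′} (nz≉0 r′) c₁≈ c₀≈)))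
      where
      c₁≈ = proj₁ (old-old m)
      c₀≈ = proj₂ (old-old m)
      conclude : r ≡ r′ → k ≡ k′ → (r , t , k) ≡ (r′ , t′ , k′)
      conclude ≡.refl ≡.refl = cong (λ t → r , t , k)
        (same-offset {kept k} {kept k} ≡.refl refl (nz≉0 r) c₀≈)

    meet-kept-new : ∀ r t k r′ t′ i → ¬ Meet (word (inj₂ (r , t , inj₁ k))) (word (inj₂ (r′ , t′ , inj₂ i)))
    meet-kept-new r t k r′ t′ i m with old-new m
    ... | z , c₁≈ , c₀≈ = contradiction (≡.trans (≡.sym (kept-¬rem k))
      (≡.trans (cong removed (≡.trans (≡.sym (kept-ratio {nz r} {t} (nz≉0 r) refl refl))
        (shifted-ratio {i} {nz r′} {t′} {z} (nz≉0 r′) c₁≈ c₀≈))) (ratio-rem i z))) λ ()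

    separated : ∀ j j′ → Meet (word j) (word j′) → j ≡ j′
    separated (inj₁ i) (inj₁ i′) m = cong inj₁ (meet-1 i i′ m)
    separated (inj₁ i) (inj₂ (r , t , k)) m = contradiction m (meet-12 i r t k)
    separated (inj₂ (r , t , k)) (inj₁ i) m =
      contradiction (meet-sym (inj₂ (r , t , k)) (inj₁ i) m) (meet-12 i r t k)
    separated (inj₂ (r , t , inj₁ k)) (inj₂ (r′ , t′ , inj₁ k′)) m =
      cong (λ (r , t , k) → inj₂ (r , t , inj₁ k)) (meet-kept r t k r′ t′ k′ m)
    separated (inj₂ (r , t , inj₁ k)) (inj₂ (r′ , t′ , inj₂ i)) m =
      contradiction m (meet-kept-new r t k r′ t′ i)
    separated (inj₂ (r , t , inj₂ i)) (inj₂ (r′ , t′ , inj₁ k)) m =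
      contradiction (meet-sym (inj₂ (r , t , inj₂ i)) (inj₂ (r′ , t′ , inj₁ k)) m)
        (meet-kept-new r′ t′ k r t i)
    separated (inj₂ (r , t , inj₂ i)) (inj₂ (r′ , t′ , inj₂ i′)) m
      with new-new {i} {i′} {nz r} {nz r′} {t} {t′} (nz≉0 r) (nz≉0 r′) m
    ... | ≡.refl , r≈ , ≡.refl = cong (λ r → inj₂ (r , t , inj₂ i)) (nz-injective r≈)

    touching-words : Fin f → Fin N → Fin keptSize →
      ∃[ j ] ∃[ j′ ] j ≢ j′ × ∃[ x ] x ≢ 0ᵇ × word j x ≋ word j′ x
    touching-words r t k = inj₂ (r , t , inj₁ k) , inj₁ (to c) , (λ ()) , x , (λ ()) , ≡.refl , (begin
      X * X * nz r + X * y            ≈⟨ solve 3 (λ X r y →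
        X :* X :* r :+ X :* y := X :* X :* con false :+ X :* (X :* r :+ y)) refl X (nz r) y ⟩
      X * X * 0ᴿ + X * c              ≈⟨ +-congˡ (*-congˡ (strictlyInverseʳ c)) ⟨
      X * X * 0ᴿ + X * from (to c)    ∎)
      where
      open import Relation.Binary.Reasoning.Setoid setoid
      x : Bits 3
      x = true ∷ false ∷ false ∷ []
      X = ι (w x)
      y = ι (kept k) * nz r + U (nz r) t
      c = X * nz r + y

    M : ℕ
    M = suc f ℕ.+ f ℕ.* (N ℕ.* (keptSize ℕ.+ newSize))

    index-finite : Index ↔ Fin M
    index-finite = ⊎-finite ↔-refl (×-finite ↔-refl (×-finite ↔-refl (⊎-finite ↔-refl ↔-refl)))

    index : Fin M → Index
    index = Inverse.from index-finite

    record Coordinates (V : VectorSpace) : Set where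
      open Spans V hiding (sum≈0⇒≈; ≈⇒sum≈0; x+x≈0)
      field
        pt         : Point → Carrierᴹ
        pt-cong    : ∀ {p p′} → p ≋ p′ → pt p ≈ᴹ pt p′
        pt-+       : ∀ x y x′ y′ → pt (x +ᵇ x′ , y + y′) ≈ᴹ pt (x , y) +ᴹ pt (x′ , y′)
        pt-trivial : ∀ p → pt p ≈ᴹ 0ᴹ → p ≋ (0ᵇ , 0ᴿ)

      pt-injective : ∀ {p p′} → pt p ≈ᴹ pt p′ → p ≋ p′
      pt-injective {x , y} {x′ , y′} e
        with pt-trivial (x +ᵇ x′ , y + y′) (≈ᴹ-trans (pt-+ x y x′ y′) (Spans.≈⇒sum≈0 V e))
      ... | p , v = +ᵇ≡0⇒≡ x x′ p , sum≈0⇒≈ v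

      plane : Fin M → Vector Carrierᴹ 3
      plane i k = pt (word (index i) (unit k))

      combination-plane : ∀ i a → combination a (plane i) ≈ᴹ pt (word (index i) a)
      combination-plane i = combination-additive (pt ∘ word (index i))
        λ x y → ≈ᴹ-trans (pt-cong (word-+ (index i) x y)) (pt-+ _ _ _ _)

      family : Fin f → Fin N → Fin keptSize → PlaneFamily M
      family r t k = plane , record
        { independent = λ i a e → word-trivial (index i) a
            (pt-trivial _ (≈ᴹ-trans (≈ᴹ-sym (combination-plane i a)) e))
        ; meet = λ i j a a′ c c′ p p′ a≢0 c≢0 a≢c →
            ≡.trans (≡.sym (Inverse.strictlyInverseˡ index-finite i))
              (≡.trans (cong (Inverse.to index-finite) (separated (index i) (index j) (record
                { a = a ; a′ = a′ ; c = c ; c′ = c′ ; p = equal i j a a′ p ; p′ = equal i j c c′ p′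
                ; a≢0 = a≢0 ; c≢0 = c≢0 ; a≢c = a≢c })))
                (Inverse.strictlyInverseˡ index-finite j))
        ; touching = let j , j′ , j≢j′ , x , x≢0 , e = touching-words r t k in
            at j , at j′ , (λ p → j≢j′ (Inverse-injective index-finite p)) , x , x , x≢0 ,
            ≈ᴹ-trans (combination-at j x) (≈ᴹ-trans (pt-cong e) (≈ᴹ-sym (combination-at j′ x)))
        }
        where
        at : Index → Fin M
        at = Inverse.to index-finite
        combination-at : ∀ j a → combination a (plane (at j)) ≈ᴹ pt (word j a)
        combination-at j a = ≈ᴹ-trans (combination-plane (at j) a)
          (≈ᴹ-reflexive (cong (λ j → pt (word j a)) (Inverse.strictlyInverseʳ index-finite j)))
        equal : ∀ i j a a′ → combination a (plane i) ≈ᴹ combination a′ (plane j) →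
          word (index i) a ≋ word (index j) a′
        equal i j a a′ p = pt-injective
          (≈ᴹ-trans (≈ᴹ-sym (combination-plane i a)) (≈ᴹ-trans p (combination-plane j a′)))

    q-scale : ∀ s c₁ c₀ x → q (s * c₁) (s * c₀) x ≈ s * q c₁ c₀ x
    q-scale s c₁ c₀ x = solve 4 (λ s c d x → x :* x :* (s :* c) :+ x :* (s :* d)
      := s :* (x :* x :* c :+ x :* d)) refl s c₁ c₀ (ι (w x))

    module Equivariance (U-equivariant : ∀ s r t → U (s * r) t ≈ s * U r t)
      (no-zero-divisors : ∀ {x y} → x * y ≈ 0ᴿ → ¬ x ≈ 0ᴿ → y ≈ 0ᴿ) where

      scaled-nz : ∀ {s} → ¬ s ≈ 0ᴿ → ∀ r → ∃[ r′ ] nz r′ ≈ s * nz r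
      scaled-nz s≉0 r = nz-surjective λ p → nz≉0 r (no-zero-divisors p s≉0)

      act : ∀ {s} → ¬ s ≈ 0ᴿ → Index → Index
      act {s} s≉0 (inj₁ i)           = inj₁ (to (s * from i))
      act     s≉0 (inj₂ (r , t , k)) = inj₂ (proj₁ (scaled-nz s≉0 r) , t , k)

      offset-scale : ∀ {s r r′} κ t → r′ ≈ s * r → ι κ * r′ + U r′ t ≈ s * (ι κ * r + U r t)
      offset-scale {s} {r} κ t p = trans
        (+-cong (*-congˡ p) (trans (U-cong t p) (U-equivariant s r t)))
        (solve 4 (λ k s r u → k :* (s :* r) :+ s :* u := s :* (k :* r :+ u)) refl (ι κ) s r (U r t))

      scale-swap : ∀ {s r r′} κ → r′ ≈ s * r → ι κ * r′ ≈ s * (ι κ * r)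
      scale-swap {s} {r} κ p = trans (*-congˡ p)
        (solve 3 (λ k s r → k :* (s :* r) := s :* (k :* r)) refl (ι κ) s r)

      word-act : ∀ {s} (s≉0 : ¬ s ≈ 0ᴿ) j x →
        word (act s≉0 j) x ≋ (proj₁ (word j x) , s * proj₂ (word j x))
      word-act {s} s≉0 (inj₁ i) x = ≡.refl , trans
        (q-cong x (sym (zeroʳ s)) (strictlyInverseʳ _)) (q-scale s 0ᴿ (from i) x)
      word-act {s} s≉0 (inj₂ (r , t , inj₁ k)) x = ≡.refl , trans
        (q-cong x r′≈ (offset-scale (kept k) t r′≈)) (q-scale s _ _ x)
        where r′≈ = proj₂ (scaled-nz s≉0 r)
      word-act {s} s≉0 (inj₂ (r , t , inj₂ i)) (a ∷ b ∷ κ ∷ []) = ≡.refl , trans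
        (+-cong
          (trans (q-cong x (scale-swap (A i) r′≈) (offset-scale (B i) t r′≈)) (q-scale s _ _ x))
          (scale-swap _ r′≈))
        (sym (distribˡ s _ _))
        where
        open Configuration C using (A; B; line)
        x = point (line i) (a ∷ b ∷ [])
        r′≈ = proj₂ (scaled-nz s≉0 r)

module FiniteFields where
  import Algebra.Properties.CommutativeMonoid.Sum as Sum
  open Char2
  open import Data.Fin.Permutation using (Permutation; permutation)
  open import Data.Nat.Base using (s≤s; z≤n)
  open Enumeration
  open import Relation.Binary.PropositionalEquality using (cong)
  open import Relation.Nullary.Decidable using (map′; ¬?; decidable-stable)

  -- Polynomial functions, in Horner form; `monic as` has leading term xᵈ.
  module Polynomials (R : Char2Ring) where
    open Char2Ring R
    open Solver
    open import Algebra.Properties.Semiring.Exp semiring using (_^_)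

    poly monic : ∀ {d} → Vec Carrier d → Carrier → Carrier
    poly []        x = 0#
    poly (a ∷ as)  x = a + x * poly as x
    monic []       x = 1#
    monic (a ∷ as) x = a + x * monic as x

    monic-poly : ∀ {d} (as : Vec Carrier d) x → monic as x ≈ poly as x + x ^ d
    monic-poly []       x = sym (+-identityˡ 1#)
    monic-poly {suc d} (a ∷ as) x = trans (+-congˡ (*-congˡ (monic-poly as x)))
      (solve 4 (λ a x p e → a :+ x :* (p :+ e) := a :+ x :* p :+ x :* e) refl a x (poly as x) (x ^ d))

    IsPoly : ℕ → (Carrier → Carrier) → Set
    IsPoly d f = Σ (Vec Carrier d) λ as → ∀ x → poly as x ≈ f x

    zero-poly : ∀ d → IsPoly d (λ _ → 0#)
    zero-poly zero    = [] , λ _ → refl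
    zero-poly (suc d) = let as , p = zero-poly d in 0# ∷ as ,
      λ x → trans (+-congˡ (trans (*-congˡ (p x)) (zeroʳ x))) (+-identityˡ 0#)

    weaken : ∀ {d e f} → d ℕ.≤ e → IsPoly d f → IsPoly e f
    weaken {e = e} z≤n ([] , p) = let as , q = zero-poly e in as , λ x → trans (q x) (p x)
    weaken (s≤s d≤e) (a ∷ as , p) = let bs , q = weaken d≤e (as , λ x → refl) in
      a ∷ bs , λ x → trans (+-congˡ (*-congˡ (q x))) (p x)

    power-poly : ∀ d → IsPoly (suc d) (_^ d)
    power-poly zero    = 1# ∷ [] , λ x → trans (+-congˡ (zeroʳ x)) (+-identityʳ 1#)
    power-poly (suc d) = let as , p = power-poly d in
      0# ∷ as , λ x → trans (+-identityˡ _) (*-congˡ (p x))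

    sum-poly : ∀ {d f g} → IsPoly d f → IsPoly d g → IsPoly d (λ x → f x + g x)
    sum-poly ([] , p) ([] , q) = [] , λ x → trans (sym (+-identityˡ 0#)) (+-cong (p x) (q x))
    sum-poly (a ∷ as , p) (b ∷ bs , q) =
      let cs , r = sum-poly (as , λ x → refl) (bs , λ x → refl) in
      a + b ∷ cs , λ x → trans (+-congˡ (*-congˡ (r x))) (trans
        (solve 5 (λ a b x p q → a :+ b :+ x :* (p :+ q) := a :+ x :* p :+ (b :+ x :* q)) refl
          a b x (poly as x) (poly bs x)) (+-cong (p x) (q x)))

    monic-+ : ∀ {d} r (as : Vec Carrier (suc d)) (bs : Vec Carrier d) →
      Σ (Vec Carrier (suc d)) λ cs → ∀ x → monic cs x ≈ monic as x + r * monic bs x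
    monic-+ r (a ∷ as) [] = a + r ∷ as , λ x → solve 4
      (λ a r x p → a :+ r :+ x :* p := a :+ x :* p :+ r :* con true) refl a r x (monic as x)
    monic-+ r (a ∷ as) (b ∷ bs) = let cs , p = monic-+ r as bs in a + r * b ∷ cs , λ x →
      trans (+-congˡ (*-congˡ (p x))) (solve 6 (λ a r b x p q →
        a :+ r :* b :+ x :* (p :+ r :* q) := a :+ x :* p :+ r :* (b :+ x :* q)) refl
        a r b x (monic as x) (monic bs x))

    factor : ∀ {d} r (as : Vec Carrier (suc d)) → Σ (Vec Carrier d) λ bs →
      ∀ x → monic as x + monic as r ≈ (x + r) * monic bs x
    factor {zero} r (a ∷ []) = [] , λ x → solve 3
      (λ a x r → a :+ x :* con true :+ (a :+ r :* con true) := (x :+ r) :* con true) refl a x r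
    factor {suc d} r (a ∷ as) =
      let bs , p = factor r as ; cs , q = monic-+ r as bs in cs , λ x → trans
        (solve 5 (λ a x r f g → a :+ x :* f :+ (a :+ r :* g) := (x :+ r) :* f :+ r :* (f :+ g)) refl
          a x r (monic as x) (monic as r))
        (trans (+-congˡ (*-congˡ (p x))) (trans
          (solve 4 (λ x r f g → (x :+ r) :* f :+ r :* ((x :+ r) :* g) := (x :+ r) :* (f :+ r :* g)) refl
            x r (monic as x) (monic bs x))
          (*-congˡ (sym (q x)))))

    module _ (1≉0 : ¬ 1# ≈ 0#) (integral : ∀ {x y} → x * y ≈ 0# → ¬ x ≈ 0# → y ≈ 0#) where

      roots-≤ : ∀ {d m} (as : Vec Carrier d) (root : Fin m → Carrier) →
        (∀ {i j} → root i ≈ root j → i ≡ j) → (∀ i → monic as (root i) ≈ 0#) → m ℕ.≤ d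
      roots-≤ {m = zero}  as root inj isRoot = z≤n
      roots-≤ {m = suc m} [] root inj isRoot = contradiction (isRoot zero) 1≉0
      roots-≤ {m = suc m} as@(_ ∷ _) root inj isRoot =
        let bs , p = factor (root zero) as in
        s≤s (roots-≤ bs (root ∘ suc) (λ e → Fin.suc-injective (inj e)) λ i →
          integral (trans (sym (p (root (suc i))))
              (trans (+-cong (isRoot (suc i)) (isRoot zero)) (+-identityˡ 0#)))
            (λ e → contradiction (inj (sum≈0⇒≈ e)) λ ()))

  record FiniteField : Set₁ where
    field
      char2Ring : Char2Ring
    open Char2Ring char2Ring public
    field
      1≉0      : ¬ 1# ≈ 0#
      inverses : ∀ x → ¬ x ≈ 0# → ∃[ y ] x * y ≈ 1#
      f        : ℕ
      size     : Inverse setoid (≡.setoid (Fin (suc f)))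

  module FieldTheory (F : FiniteField) where
    open FiniteField F
    open Polynomials char2Ring
    open Solver
    open Inverse size using (to; from; to-cong)
    open Nonzero setoid 0# f size
    open import Algebra.Properties.Semiring.Exp semiring using (_^_; ^-homo-*)
    open import Relation.Binary.Reasoning.Setoid setoid

    _≈?_ : ∀ x y → Dec (x ≈ y)
    x ≈? y = map′ (Inverse-injective size) to-cong (to x Fin.≟ to y)

    integral : ∀ {x y} → x * y ≈ 0# → ¬ x ≈ 0# → y ≈ 0#
    integral {x} {y} xy≈0 x≉0 = let z , xz≈1 = inverses x x≉0 in begin
      y             ≈⟨ *-identityˡ y ⟨
      1# * y        ≈⟨ *-congʳ xz≈1 ⟨
      x * z * y     ≈⟨ solve 3 (λ x y z → x :* z :* y := z :* (x :* y)) refl x y z ⟩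
      z * (x * y)   ≈⟨ *-congˡ xy≈0 ⟩
      z * 0#        ≈⟨ zeroʳ z ⟩
      0#            ∎

    cancelˡ : ∀ {x y z} → ¬ x ≈ 0# → x * y ≈ x * z → y ≈ z
    cancelˡ {x} {y} {z} x≉0 p = sum≈0⇒≈ (integral (trans (distribˡ x y z) (≈⇒sum≈0 p)) x≉0)

    nonroot : ∀ {d} (as : Vec Carrier d) → d ℕ.≤ f → ∃[ x ] ¬ monic as x ≈ 0#
    nonroot as d≤f with Fin.any? (λ i → ¬? (monic as (from i) ≈? 0#))
    ... | yes (i , p) = from i , p
    ... | no ¬p = contradiction
      (roots-≤ 1≉0 integral as from from-injective
        λ i → decidable-stable (monic as (from i) ≈? 0#) λ q → ¬p (i , q))
      (ℕ.<⇒≱ (s≤s d≤f))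

    φ : Carrier → Carrier
    φ x = x * x

    φ^ : ℕ → Carrier → Carrier
    φ^ zero    x = x
    φ^ (suc k) x = φ^ k (φ x)

    φ-+ : ∀ x y → φ (x + y) ≈ φ x + φ y
    φ-+ = solve 2 (λ x y → (x :+ y) :* (x :+ y) := x :* x :+ y :* y) refl

    φ-cong : ∀ {x y} → x ≈ y → φ x ≈ φ y
    φ-cong p = *-cong p p

    φ-0 : φ 0# ≈ 0#
    φ-0 = zeroʳ 0#

    φ^-cong : ∀ k {x y} → x ≈ y → φ^ k x ≈ φ^ k y
    φ^-cong zero    p = p
    φ^-cong (suc k) p = φ^-cong k (φ-cong p)

    φ^-φ : ∀ k x → φ^ k (φ x) ≈ φ (φ^ k x)
    φ^-φ zero    x = refl
    φ^-φ (suc k) x = φ^-φ k (φ x)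

    φ^-power : ∀ k x → φ^ k x ≈ x ^ (2 ℕ.^ k)
    φ^-power zero    x = sym (*-identityʳ x)
    φ^-power (suc k) x = begin
      φ^ k (φ x)                            ≈⟨ φ^-φ k x ⟩
      φ (φ^ k x)                            ≈⟨ φ-cong (φ^-power k x) ⟩
      x ^ (2 ℕ.^ k) * x ^ (2 ℕ.^ k)         ≈⟨ ^-homo-* x (2 ℕ.^ k) (2 ℕ.^ k) ⟨
      x ^ (2 ℕ.^ k ℕ.+ 2 ℕ.^ k)             ≡⟨ cong (λ e → x ^ (2 ℕ.^ k ℕ.+ e)) (ℕ.+-identityʳ (2 ℕ.^ k)) ⟨
      x ^ (2 ℕ.^ suc k)                     ∎

    private
      open Sum *-commutativeMonoid using ()
        renaming (sum to product; sum-cong-≋ to product-cong; sum-permute to product-permute;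
                  ∑-distrib-+ to product-*; sum-replicate to product-replicate)

      product-nonzero : ∀ {k} (g : Fin k → Carrier) → (∀ i → ¬ g i ≈ 0#) → ¬ product g ≈ 0#
      product-nonzero {zero}  g p q = 1≉0 q
      product-nonzero {suc k} g p q = product-nonzero (g ∘ suc) (p ∘ suc) (integral q (p zero))

    -- Multiplication by x permutes the nonzero elements.
    power-f : ∀ {x} → ¬ x ≈ 0# → x ^ f ≈ 1#
    power-f {x} x≉0 = cancelˡ (product-nonzero nz nz≉0) (begin
      product nz * x ^ f                   ≈⟨ *-comm _ _ ⟩
      x ^ f * product nz                   ≈⟨ *-congʳ (product-replicate f) ⟨
      product {f} (λ _ → x) * product nz   ≈⟨ product-* {f} (λ _ → x) nz ⟨
      product (λ i → x * nz i)             ≈⟨ product-cong (λ i → proj₂ (scaled x≉0 i)) ⟨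
      product (λ i → nz (σ i))             ≈⟨ product-permute nz π ⟨
      product nz                           ≈⟨ *-identityʳ _ ⟨
      product nz * 1#                      ∎)
      where
      y = proj₁ (inverses x x≉0)
      xy≈1 : x * y ≈ 1#
      xy≈1 = proj₂ (inverses x x≉0)
      y≉0 : ¬ y ≈ 0#
      y≉0 p = 1≉0 (trans (sym xy≈1) (trans (*-congˡ p) (zeroʳ x)))
      scaled : ∀ {x} → ¬ x ≈ 0# → ∀ i → ∃[ j ] nz j ≈ x * nz i
      scaled x≉0 i = nz-surjective (λ p → nz≉0 i (integral p x≉0))
      σ τ : Fin f → Fin f
      σ i = proj₁ (scaled x≉0 i)
      τ i = proj₁ (scaled y≉0 i)
      π : Permutation f f
      π = permutation σ τ
        (λ i → nz-injective (begin
          nz (σ (τ i))       ≈⟨ proj₂ (scaled x≉0 (τ i)) ⟩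
          x * nz (τ i)       ≈⟨ *-congˡ (proj₂ (scaled y≉0 i)) ⟩
          x * (y * nz i)     ≈⟨ *-assoc x y _ ⟨
          x * y * nz i       ≈⟨ *-congʳ xy≈1 ⟩
          1# * nz i          ≈⟨ *-identityˡ _ ⟩
          nz i               ∎))
        (λ i → nz-injective (begin
          nz (τ (σ i))       ≈⟨ proj₂ (scaled y≉0 (σ i)) ⟩
          y * nz (σ i)       ≈⟨ *-congˡ (proj₂ (scaled x≉0 i)) ⟩
          y * (x * nz i)     ≈⟨ solve 3 (λ x y z → y :* (x :* z) := x :* y :* z) refl x y (nz i) ⟩
          x * y * nz i       ≈⟨ *-congʳ xy≈1 ⟩
          1# * nz i          ≈⟨ *-identityˡ _ ⟩
          nz i               ∎))

    fermat : ∀ {n} → suc f ≡ 2 ℕ.^ n → ∀ x → φ^ n x ≈ x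
    fermat {n} eq x with x ≈? 0#
    ... | yes x≈0 = trans (φ^-cong n x≈0) (trans (φ^-0 n) (sym x≈0))
      where
      φ^-0 : ∀ k → φ^ k 0# ≈ 0#
      φ^-0 zero    = refl
      φ^-0 (suc k) = trans (φ^-cong k φ-0) (φ^-0 k)
    ... | no x≉0 = begin
      φ^ n x             ≈⟨ φ^-power n x ⟩
      x ^ (2 ℕ.^ n)      ≡⟨ cong (x ^_) eq ⟨
      x * x ^ f          ≈⟨ *-congˡ (power-f x≉0) ⟩
      x * 1#             ≈⟨ *-identityʳ x ⟩
      x                  ∎

    trace : ℕ → Carrier → Carrier
    trace zero    x = 0#
    trace (suc m) x = x + trace m (φ x)

    trace-cong : ∀ m {x y} → x ≈ y → trace m x ≈ trace m y
    trace-cong zero    p = refl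
    trace-cong (suc m) p = +-cong p (trace-cong m (φ-cong p))

    trace-φ : ∀ m x → φ (trace m x) ≈ trace m (φ x)
    trace-φ zero    x = φ-0
    trace-φ (suc m) x = trans (φ-+ x _) (+-congˡ (trace-φ m (φ x)))

    trace-+ : ∀ k m x → trace (k ℕ.+ m) x ≈ trace k x + trace m (φ^ k x)
    trace-+ zero    m x = sym (+-identityˡ _)
    trace-+ (suc k) m x = trans (+-congˡ (trace-+ k m (φ x))) (sym (+-assoc _ _ _))

    trace-suc : ∀ m x → trace (suc m) x ≈ trace m x + φ^ m x
    trace-suc m x = begin
      trace (suc m) x               ≡⟨ cong (λ k → trace k x) (ℕ.+-comm 1 m) ⟩
      trace (m ℕ.+ 1) x             ≈⟨ trace-+ m 1 x ⟩
      trace m x + (φ^ m x + 0#)     ≈⟨ +-congˡ (+-identityʳ _) ⟩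
      trace m x + φ^ m x            ∎

    trace-poly : ∀ m → IsPoly (2 ℕ.^ m) (trace m)
    trace-poly zero    = zero-poly 1
    trace-poly (suc m) =
      let as , p = sum-poly (weaken (ℕ.m≤m+n _ _) (trace-poly m)) (weaken 1+2^m≤ (power-poly (2 ℕ.^ m))) in
      as , λ x → trans (p x) (trans (+-congˡ (sym (φ^-power m x))) (sym (trace-suc m x)))
      where
      1+2^m≤ : suc (2 ℕ.^ m) ℕ.≤ 2 ℕ.^ suc m
      1+2^m≤ = ℕ.≤-trans (ℕ.+-monoˡ-≤ (2 ℕ.^ m) (ℕ.m^n>0 2 m)) (ℕ.+-monoʳ-≤ (2 ℕ.^ m) (ℕ.m≤m+n _ 0))

    trace-nonzero : ∀ m → suc f ≡ 2 ℕ.^ suc m → ∃[ θ ] ¬ trace (suc m) θ ≈ 0#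
    trace-nonzero m eq =
      let as , p = trace-poly m
          x , x≉ = nonroot as (ℕ.≤-pred (≡.subst (2 ℕ.^ m ℕ.<_) (≡.sym eq)
            (ℕ.^-monoʳ-< 2 (s≤s (s≤s z≤n)) (ℕ.n<1+n m))))
      in x , λ e → x≉ (begin
        monic as x                     ≈⟨ monic-poly as x ⟩
        poly as x + x ^ (2 ℕ.^ m)      ≈⟨ +-cong (p x) (sym (φ^-power m x)) ⟩
        trace m x + φ^ m x             ≈⟨ trace-suc m x ⟨
        trace (suc m) x                ≈⟨ e ⟩
        0#                             ∎)

    trace-one : ∀ m → suc f ≡ 2 ℕ.^ suc m → ∃[ θ ] trace (suc m) θ ≈ 1#
    trace-one m eq = let θ , t≉0 = trace-nonzero m eq in θ , cancelˡ t≉0 (begin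
      trace (suc m) θ * trace (suc m) θ   ≈⟨ trace-φ (suc m) θ ⟩
      trace (suc m) (φ θ)                 ≈⟨ trace-suc m (φ θ) ⟩
      trace m (φ θ) + φ^ (suc m) θ        ≈⟨ +-congˡ (fermat {suc m} eq θ) ⟩
      trace m (φ θ) + θ                   ≈⟨ +-comm _ _ ⟩
      trace (suc m) θ                     ≈⟨ *-identityʳ _ ⟨
      trace (suc m) θ * 1#                ∎)

    -- The solution of x² + x = c in Hilbert's Theorem 90.
    hilbert90 : ℕ → Carrier → Carrier → Carrier
    hilbert90 zero    c θ = 0#
    hilbert90 (suc m) c θ = hilbert90 m c θ + trace m c * φ^ m θ

    hilbert90-φ : ∀ m c θ → φ (hilbert90 m c θ) + hilbert90 m c θ ≈
      trace m c * φ^ m θ + c * φ (trace m θ)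
    hilbert90-φ zero c θ = solve 2 (λ c θ →
      con false :* con false :+ con false := con false :* θ :+ c :* (con false :* con false)) refl c θ
    hilbert90-φ (suc m) c θ = begin
      φ (h + t * p) + (h + t * p)
        ≈⟨ solve 3 (λ h t p → (h :+ t :* p) :* (h :+ t :* p) :+ (h :+ t :* p) :=
             h :* h :+ h :+ (t :* t :* (p :* p) :+ t :* p)) refl h t p ⟩
      φ h + h + (φ t * φ p + t * p)
        ≈⟨ +-congʳ (hilbert90-φ m c θ) ⟩
      t * p + c * φ s + (φ t * φ p + t * p)
        ≈⟨ solve 5 (λ t p c s u → t :* p :+ c :* (s :* s) :+ (u :* (p :* p) :+ t :* p) :=
             (c :+ u) :* (p :* p) :+ c :* ((s :+ p) :* (s :+ p))) refl t p c s (φ t) ⟩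
      (c + φ t) * φ p + c * φ (s + p)
        ≈⟨ +-cong (*-cong (+-congˡ (trace-φ m c)) (sym (φ^-φ m θ)))
             (*-congˡ (φ-cong (sym (trace-suc m θ)))) ⟩
      trace (suc m) c * φ^ (suc m) θ + c * φ (trace (suc m) θ) ∎
      where
      h = hilbert90 m c θ
      t = trace m c
      p = φ^ m θ
      s = trace m θ

    artinSchreier : ∀ m → suc f ≡ 2 ℕ.^ suc m → ∀ {c} → trace (suc m) c ≈ 0# → ∃[ x ] x * x + x ≈ c
    artinSchreier m eq {c} tc≈0 = let θ , tθ≈1 = trace-one m eq in hilbert90 (suc m) c θ , (begin
      φ (hilbert90 (suc m) c θ) + hilbert90 (suc m) c θ          ≈⟨ hilbert90-φ (suc m) c θ ⟩
      trace (suc m) c * φ^ (suc m) θ + c * φ (trace (suc m) θ)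
        ≈⟨ +-cong (*-congʳ tc≈0) (*-congˡ (φ-cong tθ≈1)) ⟩
      0# * φ^ (suc m) θ + c * φ 1#
        ≈⟨ solve 2 (λ p c → con false :* p :+ c :* (con true :* con true) := c) refl (φ^ (suc m) θ) c ⟩
      c                                                          ∎)

    trace-multiple : ∀ k j {c} → φ^ k c ≈ c → trace (j ℕ.* (k ℕ.+ k)) c ≈ 0#
    trace-multiple k zero    p = refl
    trace-multiple k (suc j) {c} p = begin
      trace (k ℕ.+ k ℕ.+ j ℕ.* (k ℕ.+ k)) c                        ≈⟨ trace-+ (k ℕ.+ k) _ c ⟩
      trace (k ℕ.+ k) c + trace (j ℕ.* (k ℕ.+ k)) (φ^ (k ℕ.+ k) c)
        ≈⟨ +-cong (trans (trace-+ k k c) (≈⇒sum≈0 (trace-cong k (sym p))))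
             (trans (trace-cong (j ℕ.* (k ℕ.+ k)) (trans (φ^-+ k k c) (trans (φ^-cong k p) p)))
               (trace-multiple k j p)) ⟩
      0# + 0#                                                       ≈⟨ +-identityˡ 0# ⟩
      0#                                                            ∎
      where
      φ^-+ : ∀ k m c → φ^ (k ℕ.+ m) c ≈ φ^ m (φ^ k c)
      φ^-+ zero    m c = refl
      φ^-+ (suc k) m c = φ^-+ k m (φ c)

    solvable : ∀ {n} → suc f ≡ 2 ℕ.^ n → n ≢ 0 → ∀ k j → n ≡ j ℕ.* (k ℕ.+ k) →
      ∀ {c} → φ^ k c ≈ c → ∃[ x ] x * x + x ≈ c
    solvable {zero}  eq n≢0 k j _ p = contradiction ≡.refl n≢0
    solvable {suc m} eq n≢0 k j q {c} p = artinSchreier m eq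
      (trans (reflexive (cong (λ n → trace n c) q)) (trace-multiple k j p))

module Tables where
  open Char2
  open Configurations
  open import Data.Fin.Patterns
  open import Data.List.Base as List using (List; []; _∷_; length)
  open import Data.Nat.Base using (_*_; _/_; _%_; _≡ᵇ_)
  open import Data.Product.Properties using (≡-dec)
  open import Data.Vec.Relation.Unary.AllPairs using (allPairs?)
  open import Data.Vec.Relation.Unary.Unique.Propositional using (Unique)
  open import Data.Vec.Relation.Unary.Unique.Propositional.Properties using (lookup-injective)
  open Enumeration
  open import Function.Properties.Inverse using (↔-refl; ↔-sym)
  open LinearAlgebra
  open import Relation.Binary.Definitions using (DecidableEquality)
  open import Relation.Binary.PropositionalEquality using (cong; cong₂)
  open import Relation.Nullary.Decidable using (_→-dec_; ¬?; from-yes)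

  values : ∀ {A B : Set} {n} → A ↔ Fin n → (A → B) → Vec B n
  values e f = Vec.tabulate (f ∘ Inverse.from e)

  unique⇒injective : ∀ {A B : Set} {n} (e : A ↔ Fin n) (f : A → B) → Unique (values e f) →
    ∀ {x y} → f x ≡ f y → x ≡ y
  unique⇒injective e f unique {x} {y} p = Inverse-injective e
    (lookup-injective unique (to x) (to y) (≡.trans (value x) (≡.trans p (≡.sym (value y)))))
    where
    open Inverse e
    value : ∀ x → Vec.lookup (values e f) (to x) ≡ f x
    value x = ≡.trans (Vec.lookup∘tabulate (f ∘ from) (to x)) (cong f (strictlyInverseʳ x))

  unique? : ∀ {B : Set} {n} → DecidableEquality B → (xs : Vec B n) → Dec (Unique xs)
  unique? _≟_ = allPairs? (λ x y → ¬? (x ≟ y))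

  F₄ F₁₆ F₂₅₆ : Ring₂
  F₄   = Quadratic.extension bits true
  F₁₆  = Quadratic.extension F₄ (false , true)
  F₂₅₆ = Quadratic.extension F₁₆ ((false , false) , (false , true))

  module _ (R : Ring₂) (γ : Ring₂.Carrier R) (_⁻¹ : Ring₂.Carrier R → Ring₂.Carrier R) where
    open Ring₂ R

    quadraticInverse : Carrier × Carrier → Carrier × Carrier
    quadraticInverse (a , b) = let n = (a ⊗ a ⊕ a ⊗ b ⊕ b ⊗ b ⊗ γ) ⁻¹ in (a ⊕ b) ⊗ n , b ⊗ n

  inverse₄ : Bool × Bool → Bool × Bool
  inverse₄ = quadraticInverse bits true id

  inverse₁₆ : Ring₂.Carrier F₁₆ → Ring₂.Carrier F₁₆
  inverse₁₆ = quadraticInverse F₄ (false , true) inverse₄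

  inverse₂₅₆ : Ring₂.Carrier F₂₅₆ → Ring₂.Carrier F₂₅₆
  inverse₂₅₆ = quadraticInverse F₁₆ ((false , false) , (false , true)) inverse₁₆

  _≟₄_ : DecidableEquality (Bool × Bool)
  _≟₄_ = ≡-dec Bool._≟_ Bool._≟_

  _≟₁₆_ : DecidableEquality (Ring₂.Carrier F₁₆)
  _≟₁₆_ = ≡-dec _≟₄_ _≟₄_

  _≟₂₅₆_ : DecidableEquality (Ring₂.Carrier F₂₅₆)
  _≟₂₅₆_ = ≡-dec _≟₁₆_ _≟₁₆_

  finite₁₆ : Ring₂.Carrier F₁₆ ↔ Fin 16
  finite₁₆ = ×-finite (×-finite Bool-finite Bool-finite) (×-finite Bool-finite Bool-finite)

  finite₂₅₆ : Ring₂.Carrier F₂₅₆ ↔ Fin 256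
  finite₂₅₆ = ×-finite finite₁₆ finite₁₆

  inverse₁₆-correct : ∀ x → x ≢ Ring₂.0# F₁₆ → Ring₂._⊗_ F₁₆ x (inverse₁₆ x) ≡ Ring₂.1# F₁₆
  inverse₁₆-correct = from-yes (searchAll finite₁₆ λ x →
    ¬? (x ≟₁₆ Ring₂.0# F₁₆) →-dec (Ring₂._⊗_ F₁₆ x (inverse₁₆ x) ≟₁₆ Ring₂.1# F₁₆))

  inverse₂₅₆-correct : ∀ x → x ≢ Ring₂.0# F₂₅₆ → Ring₂._⊗_ F₂₅₆ x (inverse₂₅₆ x) ≡ Ring₂.1# F₂₅₆
  inverse₂₅₆-correct = from-yes (searchAll finite₂₅₆ λ x →
    ¬? (x ≟₂₅₆ Ring₂.0# F₂₅₆) →-dec (Ring₂._⊗_ F₂₅₆ x (inverse₂₅₆ x) ≟₂₅₆ Ring₂.1# F₂₅₆))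

  field₁₆ field₂₅₆ : FiniteField₂
  field₁₆ = record
    { ring₂ = F₁₆ ; degree = 4 ; finite = finite₁₆ ; _⁻¹ = inverse₁₆
    ; inverse = inverse₁₆-correct _ ; 1≢0 = λ () }
  field₂₅₆ = record
    { ring₂ = F₂₅₆ ; degree = 8 ; finite = finite₂₅₆ ; _⁻¹ = inverse₂₅₆
    ; inverse = inverse₂₅₆-correct _ ; 1≢0 = λ () }

  -- Entries (Z, A, B); bit k of A and B is the coordinate on the k-th element
  -- of the basis 1, ω, α, ωα (times 1, β) of the tower.
  planes₁₆ : List (Fin 7 × ℕ × ℕ)
  planes₁₆ =
      (0F , 8 , 13) ∷ (0F , 12 , 11) ∷ (1F , 8 , 13) ∷ (1F , 10 , 14) ∷ (2F , 8 , 13) ∷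
      (2F , 10 , 14) ∷ (3F , 8 , 13) ∷ (4F , 8 , 13) ∷ (4F , 9 , 12) ∷ (5F , 9 , 12) ∷
      (6F , 8 , 13) ∷ []

  planes₂₅₆ : List (Fin 7 × ℕ × ℕ)
  planes₂₅₆ =
      (0F , 20 , 14) ∷ (0F , 20 , 196) ∷ (0F , 48 , 150) ∷ (0F , 56 , 145) ∷ (0F , 64 , 132) ∷
      (0F , 68 , 210) ∷ (0F , 72 , 67) ∷ (0F , 104 , 137) ∷ (0F , 108 , 128) ∷ (0F , 120 , 86) ∷
      (0F , 124 , 12) ∷ (0F , 136 , 19) ∷ (0F , 144 , 156) ∷ (0F , 148 , 23) ∷ (0F , 152 , 79) ∷
      (0F , 172 , 116) ∷ (0F , 176 , 239) ∷ (0F , 176 , 241) ∷ (0F , 180 , 146) ∷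
      (0F , 184 , 243) ∷ (0F , 192 , 18) ∷ (0F , 192 , 82) ∷ (0F , 236 , 140) ∷ (0F , 240 , 123) ∷
      (0F , 244 , 161) ∷ (0F , 252 , 149) ∷ (1F , 16 , 247) ∷ (1F , 24 , 209) ∷ (1F , 34 , 194) ∷
      (1F , 34 , 200) ∷ (1F , 42 , 183) ∷ (1F , 56 , 214) ∷ (1F , 64 , 93) ∷ (1F , 64 , 122) ∷
      (1F , 88 , 3) ∷ (1F , 96 , 126) ∷ (1F , 98 , 170) ∷ (1F , 114 , 84) ∷ (1F , 120 , 192) ∷
      (1F , 122 , 69) ∷ (1F , 154 , 35) ∷ (1F , 162 , 235) ∷ (1F , 170 , 120) ∷ (1F , 170 , 179) ∷
      (1F , 184 , 116) ∷ (1F , 192 , 148) ∷ (1F , 202 , 63) ∷ (1F , 216 , 143) ∷ (1F , 224 , 76) ∷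
      (1F , 232 , 14) ∷ (1F , 232 , 121) ∷ (1F , 250 , 131) ∷ (2F , 16 , 223) ∷ (2F , 26 , 114) ∷
      (2F , 26 , 131) ∷ (2F , 42 , 22) ∷ (2F , 56 , 200) ∷ (2F , 72 , 106) ∷ (2F , 82 , 233) ∷
      (2F , 88 , 206) ∷ (2F , 96 , 169) ∷ (2F , 104 , 134) ∷ (2F , 112 , 100) ∷ (2F , 138 , 141) ∷
      (2F , 138 , 228) ∷ (2F , 168 , 99) ∷ (2F , 170 , 45) ∷ (2F , 170 , 127) ∷ (2F , 178 , 228) ∷
      (2F , 186 , 43) ∷ (2F , 194 , 16) ∷ (2F , 216 , 209) ∷ (2F , 216 , 217) ∷ (2F , 224 , 58) ∷
      (2F , 240 , 172) ∷ (2F , 240 , 254) ∷ (2F , 242 , 112) ∷ (2F , 248 , 146) ∷ (3F , 1 , 202) ∷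
      (3F , 8 , 1) ∷ (3F , 8 , 129) ∷ (3F , 9 , 60) ∷ (3F , 25 , 104) ∷ (3F , 48 , 31) ∷
      (3F , 64 , 150) ∷ (3F , 80 , 224) ∷ (3F , 104 , 23) ∷ (3F , 104 , 167) ∷ (3F , 105 , 219) ∷
      (3F , 121 , 27) ∷ (3F , 121 , 87) ∷ (3F , 129 , 97) ∷ (3F , 129 , 216) ∷ (3F , 137 , 126) ∷
      (3F , 137 , 145) ∷ (3F , 152 , 32) ∷ (3F , 161 , 56) ∷ (3F , 161 , 86) ∷ (3F , 169 , 30) ∷
      (3F , 184 , 114) ∷ (3F , 208 , 174) ∷ (3F , 216 , 101) ∷ (3F , 225 , 81) ∷ (3F , 233 , 26) ∷
      (3F , 249 , 214) ∷ (4F , 9 , 220) ∷ (4F , 17 , 200) ∷ (4F , 25 , 137) ∷ (4F , 32 , 89) ∷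
      (4F , 40 , 151) ∷ (4F , 49 , 108) ∷ (4F , 49 , 120) ∷ (4F , 57 , 52) ∷ (4F , 64 , 60) ∷
      (4F , 64 , 221) ∷ (4F , 72 , 233) ∷ (4F , 81 , 16) ∷ (4F , 81 , 48) ∷ (4F , 81 , 60) ∷
      (4F , 89 , 212) ∷ (4F , 105 , 186) ∷ (4F , 120 , 142) ∷ (4F , 136 , 228) ∷ (4F , 137 , 52) ∷
      (4F , 168 , 138) ∷ (4F , 177 , 234) ∷ (4F , 185 , 60) ∷ (4F , 192 , 115) ∷
      (4F , 224 , 143) ∷ (4F , 232 , 63) ∷ (4F , 240 , 106) ∷ (5F , 8 , 93) ∷ (5F , 8 , 205) ∷
      (5F , 9 , 12) ∷ (5F , 9 , 165) ∷ (5F , 17 , 233) ∷ (5F , 33 , 206) ∷ (5F , 33 , 252) ∷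
      (5F , 48 , 92) ∷ (5F , 49 , 46) ∷ (5F , 57 , 8) ∷ (5F , 64 , 124) ∷ (5F , 73 , 136) ∷
      (5F , 80 , 193) ∷ (5F , 81 , 186) ∷ (5F , 88 , 233) ∷ (5F , 89 , 135) ∷ (5F , 137 , 116) ∷
      (5F , 160 , 168) ∷ (5F , 177 , 187) ∷ (5F , 193 , 177) ∷ (5F , 200 , 61) ∷
      (5F , 208 , 150) ∷ (5F , 217 , 198) ∷ (5F , 232 , 46) ∷ (5F , 232 , 72) ∷ (5F , 233 , 246) ∷
      (5F , 241 , 177) ∷ (6F , 1 , 110) ∷ (6F , 8 , 86) ∷ (6F , 33 , 192) ∷ (6F , 49 , 247) ∷
      (6F , 56 , 50) ∷ (6F , 57 , 199) ∷ (6F , 65 , 243) ∷ (6F , 88 , 31) ∷ (6F , 89 , 128) ∷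
      (6F , 105 , 159) ∷ (6F , 121 , 34) ∷ (6F , 136 , 96) ∷ (6F , 136 , 173) ∷ (6F , 137 , 88) ∷
      (6F , 137 , 140) ∷ (6F , 145 , 238) ∷ (6F , 169 , 21) ∷ (6F , 177 , 194) ∷
      (6F , 208 , 169) ∷ (6F , 209 , 3) ∷ (6F , 216 , 141) ∷ (6F , 240 , 31) ∷ (6F , 241 , 84) ∷
      (6F , 249 , 153) ∷ []

  private
    bits² = Vec-finite Bool-finite 2

    _≟³_ : DecidableEquality (Bits 3)
    _≟³_ = Vec.≡-dec Bool._≟_

  nonzero : Fin 3 → Bits 2
  nonzero 0F = true  ∷ false ∷ []
  nonzero 1F = false ∷ true  ∷ []
  nonzero 2F = true  ∷ true  ∷ []

  nonzero-surjective : ∀ s → s ≢ 0ᵇ → ∃[ k ] nonzero k ≡ s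
  nonzero-surjective (true  ∷ false ∷ []) _ = 0F , ≡.refl
  nonzero-surjective (false ∷ true  ∷ []) _ = 1F , ≡.refl
  nonzero-surjective (true  ∷ true  ∷ []) _ = 2F , ≡.refl
  nonzero-surjective (false ∷ false ∷ []) p = contradiction ≡.refl p

  -- The functions mod₁ forget the coefficient of 1, i.e. they compute modulo 𝔽₂.
  module Check (L : Layout) (mod₁ : Layout.Carrier L → Layout.Carrier L) where
    open Layout L

    ratioKey : Fin newSize × Bits 2 → Fin 7 × Carrier
    ratioKey (i , s) = line i , ratio i s

    slotKey : Fin newSize × Fin 3 → Bits 3 × Carrier
    slotKey (i , k) = point (line i) (nonzero k) , mod₁ (slot i (nonzero k))

    ratioValues : Vec (Fin 7 × Carrier) (newSize * 4)
    ratioValues = values (×-finite ↔-refl bits²) ratioKey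

    slotValues : Vec (Bits 3 × Carrier) (newSize * 3)
    slotValues = values (×-finite ↔-refl ↔-refl) slotKey

    ratio-injective : Unique ratioValues →
      ∀ i j s t → line i ≡ line j → ratio i s ≡ ratio j t → i ≡ j × s ≡ t
    ratio-injective unique i j s t p q = cong proj₁ same , cong proj₂ same
      where
      same : (i , s) ≡ (j , t)
      same = unique⇒injective (×-finite ↔-refl bits²) ratioKey unique (cong₂ _,_ p q)

    slot-injective : Unique slotValues → (∀ x κ → mod₁ (x ⊕ scale κ 1#) ≡ mod₁ x) →
      ∀ i j s t κ → s ≢ 0ᵇ → point (line i) s ≡ point (line j) t →
      slot i s ≡ slot j t ⊕ scale κ 1# → i ≡ j
    slot-injective unique mod i j s t κ s≢0 p q =
      conclude (nonzero-surjective s s≢0) (nonzero-surjective t t≢0)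
      where
      t≢0 : t ≢ 0ᵇ
      t≢0 ≡.refl = s≢0 (point-nonzero (line i) s p)
      conclude : ∃[ k ] nonzero k ≡ s → ∃[ l ] nonzero l ≡ t → i ≡ j
      conclude (k , ≡.refl) (l , ≡.refl) = cong proj₁
        (unique⇒injective (×-finite ↔-refl ↔-refl) slotKey unique {i , k} {j , l}
          (cong₂ _,_ p (≡.trans (cong mod₁ q) (mod (slot j t) κ))))

  bit : ℕ → Bool
  bit n = n % 2 ≡ᵇ 1

  decode₁₆ : ℕ → Ring₂.Carrier F₁₆
  decode₁₆ n = (bit n , bit (n / 2)) , (bit (n / 4) , bit (n / 8))

  decode₂₅₆ : ℕ → Ring₂.Carrier F₂₅₆
  decode₂₅₆ n = decode₁₆ n , decode₁₆ (n / 16)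

  w₁₆ : Bits 3 → Ring₂.Carrier F₁₆
  w₁₆ (a ∷ b ∷ c ∷ []) = (a , b) , (c , false)

  removed₁₆ : Ring₂.Carrier F₁₆ → Bool
  removed₁₆ (_ , (_ , d)) = d

  mod₁₆ : Ring₂.Carrier F₁₆ → Ring₂.Carrier F₁₆
  mod₁₆ ((_ , b) , y) = (false , b) , y

  layout₁₆ layout₂₅₆ : Layout
  layout₁₆ = record
    { K = field₁₆
    ; w = w₁₆
    ; w-+ = λ { (_ ∷ _ ∷ _ ∷ []) (_ ∷ _ ∷ _ ∷ []) → ≡.refl }
    ; w-nonzero = λ { (false ∷ false ∷ false ∷ []) _ → ≡.refl }
    ; newSize = length planes₁₆
    ; line = λ i → proj₁ (List.lookup planes₁₆ i)
    ; A = λ i → decode₁₆ (proj₁ (proj₂ (List.lookup planes₁₆ i)))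
    ; B = λ i → decode₁₆ (proj₂ (proj₂ (List.lookup planes₁₆ i)))
    }
  layout₂₅₆ = record
    { K = field₂₅₆
    ; w = λ x → w₁₆ x , Ring₂.0# F₁₆
    ; w-+ = λ { (_ ∷ _ ∷ _ ∷ []) (_ ∷ _ ∷ _ ∷ []) → ≡.refl }
    ; w-nonzero = λ { (false ∷ false ∷ false ∷ []) _ → ≡.refl }
    ; newSize = length planes₂₅₆
    ; line = λ i → proj₁ (List.lookup planes₂₅₆ i)
    ; A = λ i → decode₂₅₆ (proj₁ (proj₂ (List.lookup planes₂₅₆ i)))
    ; B = λ i → decode₂₅₆ (proj₂ (proj₂ (List.lookup planes₂₅₆ i)))
    }

  module Check₁₆ = Check layout₁₆ mod₁₆
  module Check₂₅₆ = Check layout₂₅₆ (Product.map₁ mod₁₆)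

  abstract
    ratios-unique₁₆ : Unique Check₁₆.ratioValues
    ratios-unique₁₆ = from-yes (unique? (≡-dec Fin._≟_ _≟₁₆_) Check₁₆.ratioValues)

    slots-unique₁₆ : Unique Check₁₆.slotValues
    slots-unique₁₆ = from-yes (unique? (≡-dec _≟³_ _≟₁₆_) Check₁₆.slotValues)

    mod-unit₁₆ : ∀ x κ → mod₁₆ (Ring₂._⊕_ F₁₆ x (Layout.scale layout₁₆ κ (Ring₂.1# F₁₆))) ≡ mod₁₆ x
    mod-unit₁₆ = from-yes (searchAll finite₁₆ λ x → searchAll Bool-finite λ κ →
      mod₁₆ (Ring₂._⊕_ F₁₆ x (Layout.scale layout₁₆ κ (Ring₂.1# F₁₆))) ≟₁₆ mod₁₆ x)

    A-nonzero₁₆ : let open Layout layout₁₆ in ∀ i s → A i ⊕ w (point (line i) s) ≢ 0#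
    A-nonzero₁₆ = let open Layout layout₁₆ in
      from-yes (Fin.all? {newSize} λ i → searchAll bits² λ s → ¬? ((A i ⊕ w (point (line i) s)) ≟₁₆ 0#))

    ratio-removed₁₆ : let open Layout layout₁₆ in ∀ i s → removed₁₆ (ratio i s) ≡ true
    ratio-removed₁₆ = let open Layout layout₁₆ in
      from-yes (Fin.all? {newSize} λ i → searchAll bits² λ s → removed₁₆ (ratio i s) Bool.≟ true)

    ratios-unique₂₅₆ : Unique Check₂₅₆.ratioValues
    ratios-unique₂₅₆ = from-yes (unique? (≡-dec Fin._≟_ _≟₂₅₆_) Check₂₅₆.ratioValues)

    slots-unique₂₅₆ : Unique Check₂₅₆.slotValues
    slots-unique₂₅₆ = from-yes (unique? (≡-dec _≟³_ _≟₂₅₆_) Check₂₅₆.slotValues)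

    mod-unit₂₅₆ : ∀ x κ →
      Product.map₁ mod₁₆ (Ring₂._⊕_ F₂₅₆ x (Layout.scale layout₂₅₆ κ (Ring₂.1# F₂₅₆))) ≡
      Product.map₁ mod₁₆ x
    mod-unit₂₅₆ = from-yes (searchAll finite₂₅₆ λ x → searchAll Bool-finite λ κ →
      Product.map₁ mod₁₆ (Ring₂._⊕_ F₂₅₆ x (Layout.scale layout₂₅₆ κ (Ring₂.1# F₂₅₆)))
        ≟₂₅₆ Product.map₁ mod₁₆ x)

    A-nonzero₂₅₆ : let open Layout layout₂₅₆ in ∀ i s → A i ⊕ w (point (line i) s) ≢ 0#
    A-nonzero₂₅₆ = let open Layout layout₂₅₆ in
      from-yes (Fin.all? {newSize} λ i → searchAll bits² λ s → ¬? ((A i ⊕ w (point (line i) s)) ≟₂₅₆ 0#))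

    ratio-removed₂₅₆ : let open Layout layout₂₅₆ in ∀ i s → removed₁₆ (proj₁ (ratio i s)) ≡ true
    ratio-removed₂₅₆ = let open Layout layout₂₅₆ in
      from-yes (Fin.all? {newSize} λ i → searchAll bits² λ s → removed₁₆ (proj₁ (ratio i s)) Bool.≟ true)

  kept₁₆ : (Bool × Bool) × Bool → Ring₂.Carrier F₁₆
  kept₁₆ (x , c) = x , (c , false)

  kept₁₆-injective : ∀ {x y} → kept₁₆ x ≡ kept₁₆ y → x ≡ y
  kept₁₆-injective ≡.refl = ≡.refl

  kept-finite : ((Bool × Bool) × Bool) ↔ Fin 8
  kept-finite = ×-finite (×-finite Bool-finite Bool-finite) Bool-finite

  configuration₁₆ configuration₂₅₆ : Configuration
  configuration₁₆ = record
    { layout    = layout₁₆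
    ; keptSize  = 8
    ; kept      = kept₁₆ ∘ Inverse.from kept-finite
    ; kept-inj  = λ p → Inverse-injective (↔-sym kept-finite) (kept₁₆-injective p)
    ; removed   = removed₁₆
    ; kept-¬rem = λ _ → ≡.refl
    ; A-nonzero = A-nonzero₁₆
    ; ratio-rem = ratio-removed₁₆
    ; ratio-inj = Check₁₆.ratio-injective ratios-unique₁₆
    ; slot-inj  = Check₁₆.slot-injective slots-unique₁₆ mod-unit₁₆
    }
  configuration₂₅₆ = record
    { layout    = layout₂₅₆
    ; keptSize  = 128
    ; kept      = Product.map₁ kept₁₆ ∘ Inverse.from kept-finite₂₅₆
    ; kept-inj  = λ p → Inverse-injective (↔-sym kept-finite₂₅₆) (injective p)
    ; removed   = removed₁₆ ∘ proj₁
    ; kept-¬rem = λ _ → ≡.refl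
    ; A-nonzero = A-nonzero₂₅₆
    ; ratio-rem = ratio-removed₂₅₆
    ; ratio-inj = Check₂₅₆.ratio-injective ratios-unique₂₅₆
    ; slot-inj  = Check₂₅₆.slot-injective slots-unique₂₅₆ mod-unit₂₅₆
    }
    where
    kept-finite₂₅₆ : (((Bool × Bool) × Bool) × Ring₂.Carrier F₁₆) ↔ Fin 128
    kept-finite₂₅₆ = ×-finite kept-finite finite₁₆
    injective : ∀ {x y} → Product.map₁ kept₁₆ x ≡ Product.map₁ kept₁₆ y → x ≡ y
    injective ≡.refl = ≡.refl

module Settings where
  open Char2
  open Configurations
  open import Data.Vec.Base using (zipWith; replicate)
  open import Data.Vec.Functional using (Vector)
  open Enumeration
  open Expurgation
  open FiniteFields
  open import Function.Properties.Inverse using (↔-sym)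
  open LinearAlgebra
  open import Relation.Binary.PropositionalEquality using (cong; cong₂)

  module Scalars (K : Ring₂) (R : Char2Ring) (h : Homomorphism K R) where
    open Char2Ring R
    open Homomorphism h
    private module K = Ring₂ K

    scalarModule : LeftModule (CommutativeRing.ring K.commutativeRing) 0ℓ 0ℓ
    scalarModule = record
      { Carrierᴹ = Carrier ; _≈ᴹ_ = _≈_ ; _+ᴹ_ = _+_ ; _*ₗ_ = λ κ x → ι κ * x ; 0ᴹ = 0# ; -ᴹ_ = -_
      ; isLeftModule = record
        { isLeftSemimodule = record
          { +ᴹ-isCommutativeMonoid = +-isCommutativeMonoid
          ; isPreleftSemimodule = record
            { *ₗ-cong      = λ κ≡ x≈ → *-cong (reflexive (cong ι κ≡)) x≈
            ; *ₗ-zeroˡ     = λ x → trans (*-congʳ ι-0) (zeroˡ x)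
            ; *ₗ-distribʳ  = λ x κ μ → trans (*-congʳ (ι-+ κ μ)) (distribʳ x _ _)
            ; *ₗ-identityˡ = λ x → trans (*-congʳ ι-1) (*-identityˡ x)
            ; *ₗ-assoc     = λ κ μ x → trans (*-congʳ (ι-* κ μ)) (*-assoc _ _ x)
            ; *ₗ-zeroʳ     = λ κ → zeroʳ (ι κ)
            ; *ₗ-distribˡ  = λ κ → distribˡ (ι κ)
            }
          }
        ; -ᴹ‿cong    = -‿cong
        ; -ᴹ‿inverse = -‿inverse
        }
      }

  -- In a field the complement of K r is r times a complement of K.
  module FieldSetting (C : Configuration) (F : FiniteField)
    (h : Homomorphism (Configuration.ring₂ C) (FiniteField.char2Ring F)) where
    open FiniteField F
    open FieldTheory F using (_≈?_; cancelˡ)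
    open Homomorphism h
    open Solver
    private
      module C = Configuration C
      module K = CommutativeRing C.commutativeRing
      M = Scalars.scalarModule C.ring₂ char2Ring h
    open Combination C.ring₂ M using (combination; combine; combine-+; combination-0;
      combination-*; JointlyIndependent; Independent;
      jointlyIndependent⇒injective; 𝟎; _⊞_)
    open Extension C.K M (suc f) size using (extend; count)
    open import Relation.Binary.Reasoning.Setoid setoid

    ι-nonzero : ∀ {κ} → κ ≢ C.0# → ¬ ι κ ≈ 0#
    ι-nonzero {κ} κ≢0 p = 1≉0 (begin
      1#                       ≈⟨ ι-1 ⟨
      ι C.1#                   ≡⟨ cong ι (C.inverse κ≢0) ⟨
      ι (κ C.⊗ κ C.⁻¹)         ≈⟨ ι-* _ _ ⟩
      ι κ * ι (κ C.⁻¹)         ≈⟨ trans (*-congʳ p) (zeroˡ _) ⟩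
      0#                       ∎)

    private
      one : Vector Carrier 1
      one _ = 1#

      combination-one : ∀ κ → combination (κ ∷ []) one ≈ ι κ
      combination-one κ = trans (Combination.combination-∷ C.ring₂ M κ [] one) (trans
        (+-cong (*-identityʳ (ι κ)) (Combination.combination-[] C.ring₂ M _)) (+-identityʳ (ι κ)))

      one-independent : Independent one
      one-independent (κ ∷ []) p with ↔⇒decidable C.finite κ C.0#
      ... | yes κ≡0 = cong (_∷ []) κ≡0
      ... | no  κ≢0 = contradiction (trans (sym (combination-one κ)) p) (ι-nonzero κ≢0)

      basis : ∃[ l ] Σ (Vector Carrier l) λ v → JointlyIndependent one v ×
        (∀ x → ∃[ ab ] combine one v ab ≈ x)
      basis = extend one-independent

      l = proj₁ basis

      v : Vector Carrier l
      v = proj₁ (proj₂ basis)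

      independent : JointlyIndependent one v
      independent = proj₁ (proj₂ (proj₂ basis))

      decompose : ∀ x → ∃[ ab ] combine one v ab ≈ x
      decompose = proj₂ (proj₂ (proj₂ basis))

      coefficient : Carrier → C.Carrier
      coefficient x = Vec.head (proj₁ (proj₁ (decompose x)))

      coefficient-unique : ∀ {x} a b → combine one v (a , b) ≈ x → coefficient x ≡ Vec.head a
      coefficient-unique {x} a b p = cong (λ (a , _) → Vec.head a)
        (jointlyIndependent⇒injective independent (proj₁ (decompose x)) (a , b)
          (trans (proj₂ (decompose x)) (sym p)))

      coefficient-cong : ∀ {x y} → x ≈ y → coefficient x ≡ coefficient y
      coefficient-cong {x} {y} p = let (a , b) , q = decompose y in
        coefficient-unique a b (trans q (sym p))

      head-⊞ : ∀ (a a′ : Vec C.Carrier 1) → Vec.head (a ⊞ a′) ≡ Vec.head a C.⊕ Vec.head a′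
      head-⊞ (_ ∷ []) (_ ∷ []) = ≡.refl

      coefficient-+ : ∀ x y → coefficient (x + y) ≡ coefficient x C.⊕ coefficient y
      coefficient-+ x y =
        let (a , b) , p = decompose x
            (a′ , b′) , p′ = decompose y
        in ≡.trans (coefficient-unique (a ⊞ a′) (b ⊞ b′)
            (trans (combine-+ one v a b a′ b′) (+-cong p p′)))
          (head-⊞ a a′)

      coefficient-ι : ∀ κ → coefficient (ι κ) ≡ κ
      coefficient-ι κ = coefficient-unique (κ ∷ []) 𝟎
        (trans (+-cong (combination-one κ) (combination-0 v)) (+-identityʳ (ι κ)))

    N : ℕ
    N = (2 ℕ.^ C.degree) ℕ.^ l

    N-size : suc f ≡ 2 ℕ.^ C.degree ℕ.* N
    N-size = ≡.trans (count independent decompose) (cong (ℕ._* N) (ℕ.*-identityʳ (2 ℕ.^ C.degree)))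

    private
      decode : Fin N → Vec C.Carrier l
      decode = Inverse.from (Vec-finite C.finite l)

      u : Fin N → Carrier
      u t = combination (decode t) v

      u-injective : ∀ {t t′} → u t ≈ u t′ → t ≡ t′
      u-injective {t} {t′} p = Inverse-injective (↔-sym (Vec-finite C.finite l))
        (cong proj₂ (jointlyIndependent⇒injective independent (𝟎 , decode t) (𝟎 , decode t′) (+-congˡ p)))

      coefficient-u : ∀ κ t → coefficient (ι κ * u t) ≡ C.0#
      coefficient-u κ t = coefficient-unique 𝟎 (Vec.map (κ C.⊗_) (decode t))
        (trans (+-cong (combination-0 one) (combination-* κ (decode t) v)) (+-identityˡ _))

      inv : Carrier → Carrier
      inv r with r ≈? 0#
      ... | yes _   = 0#
      ... | no  r≉0 = proj₁ (inverses r r≉0)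

      inv-correct : ∀ {r} → ¬ r ≈ 0# → r * inv r ≈ 1#
      inv-correct {r} r≉0 with r ≈? 0#
      ... | yes r≈0 = contradiction r≈0 r≉0
      ... | no  p   = proj₂ (inverses r p)

    setting : Setting C
    setting = record
      { R = char2Ring ; embedding = h ; N = N
      ; U      = λ r t → r * u t
      ; π      = λ r x → coefficient (x * inv r)
      ; U-cong = λ _ → *-congʳ
      ; U-inj  = λ r≉0 p → u-injective (cancelˡ r≉0 p)
      ; π-cong = λ _ p → coefficient-cong (*-congʳ p)
      ; π-+    = λ r x y → ≡.trans (coefficient-cong (distribʳ (inv r) x y)) (coefficient-+ _ _)
      ; π-self = λ {r} κ r≉0 → ≡.trans (coefficient-cong (begin
          ι κ * r * inv r     ≈⟨ *-assoc _ _ _ ⟩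
          ι κ * (r * inv r)   ≈⟨ *-congˡ (inv-correct r≉0) ⟩
          ι κ * 1#            ≈⟨ *-identityʳ _ ⟩
          ι κ                 ∎)) (coefficient-ι κ)
      ; π-U    = λ {r} {κ} t r≉0 κ≢0 → ≡.trans (coefficient-cong (begin
          ι κ * r * u t * inv r     ≈⟨ solve 4 (λ k r u i →
            k :* r :* u :* i := k :* u :* (r :* i)) refl (ι κ) r (u t) (inv r) ⟩
          ι κ * u t * (r * inv r)   ≈⟨ *-congˡ (inv-correct r≉0) ⟩
          ι κ * u t * 1#            ≈⟨ *-identityʳ _ ⟩
          ι κ * u t                 ∎)) (coefficient-u κ t)
      }

    U-equivariant : ∀ s r t → Setting.U setting (s * r) t ≈ s * Setting.U setting r t
    U-equivariant s r t = *-assoc s r (u t)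

  vectors : Ring₂ → ℕ → Ring₂
  vectors K m = record
    { Carrier = Vec Carrier m
    ; _⊕_ = zipWith _⊕_
    ; _⊗_ = zipWith _⊗_
    ; 0#  = replicate m 0#
    ; 1#  = replicate m 1#
    ; isCommutativeRing = record
      { isRing = record
        { +-isAbelianGroup = record
          { isGroup = record
            { isMonoid = record
              { isSemigroup = record
                { isMagma = record { isEquivalence = ≡.isEquivalence ; ∙-cong = cong₂ (zipWith _⊕_) }
                ; assoc = Vec.zipWith-assoc +-assoc
                }
              ; identity = Vec.zipWith-identityˡ +-identityˡ , Vec.zipWith-identityʳ +-identityʳ
              }
            ; inverse = self-inverse , self-inverse
            ; ⁻¹-cong = λ p → p
            }
          ; comm = Vec.zipWith-comm +-comm
          }
        ; *-cong = cong₂ (zipWith _⊗_)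
        ; *-assoc = Vec.zipWith-assoc *-assoc
        ; *-identity = Vec.zipWith-identityˡ *-identityˡ , Vec.zipWith-identityʳ *-identityʳ
        ; distrib = Vec.zipWith-distribˡ distribˡ , Vec.zipWith-distribʳ distribʳ
        }
      ; *-comm = Vec.zipWith-comm *-comm
      }
    }
    where
    open Ring₂ K
    open CommutativeRing commutativeRing using (+-assoc; +-identityˡ; +-identityʳ; +-comm; -‿inverseˡ;
      *-assoc; *-identityˡ; *-identityʳ; distribˡ; distribʳ; *-comm)
    self-inverse : ∀ {m} (x : Vec Carrier m) → zipWith _⊕_ x x ≡ replicate m 0#
    self-inverse []      = ≡.refl
    self-inverse (a ∷ x) = cong₂ _∷_ (-‿inverseˡ a) (self-inverse x)

  -- In Kᵐ⁺¹ the complement of K r is the hyperplane where the first nonzero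
  -- coordinate of r vanishes.
  module ProductSetting (C : Configuration) (m : ℕ) where
    open Configuration C
    open ConfigurationProperties C using (⊗-nonzero; _≟_)
    private
      module K = CommutativeRing commutativeRing

      Vector′ : ℕ → Set
      Vector′ k = Vec Carrier (suc k)

      _⊕ᵛ_ : ∀ {k} → Vec Carrier k → Vec Carrier k → Vec Carrier k
      _⊕ᵛ_ = zipWith _⊕_

      _·_ : ∀ {k} → Carrier → Vec Carrier k → Vec Carrier k
      κ · x = zipWith _⊗_ (replicate _ κ) x

      insert : ∀ {k} {a : Carrier} → Dec (a ≡ 0#) → (Vec Carrier k → Vector′ k) →
        Vec Carrier (suc k) → Vector′ (suc k)
      insert (yes _) f (t ∷ ts) = t ∷ f ts
      insert (no  _) f ts       = 0# ∷ ts

      hyperplane : ∀ {k} → Vector′ k → Vec Carrier k → Vector′ k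
      hyperplane {zero}  (a ∷ []) [] = 0# ∷ []
      hyperplane {suc k} (a ∷ r)  ts = insert (a ≟ 0#) (hyperplane r) ts

      select : {a : Carrier} → Dec (a ≡ 0#) → Carrier → Carrier → Carrier
      select {a} (yes _) b κ = κ
      select {a} (no  _) b κ = b ⊗ a ⁻¹

      coordinate : ∀ {k} → Vector′ k → Vector′ k → Carrier
      coordinate {zero}  (a ∷ []) (b ∷ []) = b ⊗ a ⁻¹
      coordinate {suc k} (a ∷ r)  (b ∷ x)  = select (a ≟ 0#) b (coordinate r x)

      hyperplane-injective : ∀ {k} (r : Vector′ k) ts ts′ → hyperplane r ts ≡ hyperplane r ts′ → ts ≡ ts′
      hyperplane-injective {zero}  (a ∷ []) [] [] _ = ≡.refl
      hyperplane-injective {suc k} (a ∷ r) = injective (a ≟ 0#)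
        where
        injective : ∀ d ts ts′ → insert {a = a} d (hyperplane r) ts ≡ insert d (hyperplane r) ts′ → ts ≡ ts′
        injective (yes _) (t ∷ ts) (t′ ∷ ts′) p = cong₂ _∷_ (cong Vec.head p)
          (hyperplane-injective r ts ts′ (cong Vec.tail p))
        injective (no _) ts ts′ p = cong Vec.tail p

      coordinate-+ : ∀ {k} (r x y : Vector′ k) → coordinate r (x ⊕ᵛ y) ≡ coordinate r x ⊕ coordinate r y
      coordinate-+ {zero}  (a ∷ []) (b ∷ []) (c ∷ []) = K.distribʳ (a ⁻¹) b c
      coordinate-+ {suc k} (a ∷ r)  (b ∷ x)  (c ∷ y)  = select-+ (a ≟ 0#)
        where
        select-+ : ∀ d → select {a} d (b ⊕ c) (coordinate r (x ⊕ᵛ y)) ≡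
          select d b (coordinate r x) ⊕ select d c (coordinate r y)
        select-+ (yes _) = coordinate-+ r x y
        select-+ (no  _) = K.distribʳ (a ⁻¹) b c

      cancel : ∀ {a} κ → a ≢ 0# → κ ⊗ a ⊗ a ⁻¹ ≡ κ
      cancel κ a≢0 = ≡.trans (K.*-assoc κ _ _) (≡.trans (cong (κ ⊗_) (inverse a≢0)) (K.*-identityʳ κ))

      tail-nonzero : ∀ {k a} {r : Vec Carrier k} → a ≡ 0# → a ∷ r ≢ replicate _ 0# → r ≢ replicate _ 0#
      tail-nonzero a≡0 r≢0 r≡0 = r≢0 (cong₂ _∷_ a≡0 r≡0)

      coordinate-self : ∀ {k} κ (r : Vector′ k) → r ≢ replicate _ 0# → coordinate r (κ · r) ≡ κ
      coordinate-self {zero}  κ (a ∷ []) r≢0 = cancel κ (λ a≡0 → r≢0 (cong (_∷ []) a≡0))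
      coordinate-self {suc k} κ (a ∷ r)  r≢0 = self (a ≟ 0#)
        where
        self : ∀ d → select {a} d (κ ⊗ a) (coordinate r (κ · r)) ≡ κ
        self (yes a≡0) = coordinate-self κ r (tail-nonzero a≡0 r≢0)
        self (no  a≢0) = cancel κ a≢0

      coordinate-hyperplane : ∀ {k} κ (r : Vector′ k) ts → r ≢ replicate _ 0# → κ ≢ 0# →
        coordinate r (hyperplane (κ · r) ts) ≡ 0#
      coordinate-hyperplane {zero}  κ (a ∷ []) [] r≢0 κ≢0 = K.zeroˡ (a ⁻¹)
      coordinate-hyperplane {suc k} κ (a ∷ r)  ts r≢0 κ≢0 = headTail (hyperplane (κ · (a ∷ r)) ts)
        (vanish (a ≟ 0#) ((κ ⊗ a) ≟ 0#) ts)
        where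
        headTail : ∀ x → select (a ≟ 0#) (Vec.head x) (coordinate r (Vec.tail x)) ≡ 0# →
          coordinate (a ∷ r) x ≡ 0#
        headTail (_ ∷ _) p = p
        vanish : ∀ d e ts → let x = insert {a = κ ⊗ a} e (hyperplane (κ · r)) ts in
          select {a} d (Vec.head x) (coordinate r (Vec.tail x)) ≡ 0#
        vanish (yes a≡0) (yes _) (t ∷ ts) = coordinate-hyperplane κ r ts (tail-nonzero a≡0 r≢0) κ≢0
        vanish (no a≢0) (no _) ts = K.zeroˡ (a ⁻¹)
        vanish (yes a≡0) (no κa≢0) ts = contradiction (≡.trans (cong (κ ⊗_) a≡0) (K.zeroʳ κ)) κa≢0
        vanish (no a≢0) (yes κa≡0) ts = contradiction κa≡0 (⊗-nonzero κ≢0 a≢0)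

    N : ℕ
    N = (2 ℕ.^ degree) ℕ.^ m

    productRing : Char2Ring
    productRing = Ring₂.char2Ring (vectors ring₂ (suc m))

    size : Vec Carrier (suc m) ↔ Fin (2 ℕ.^ degree ℕ.* N)
    size = Vec-finite finite (suc m)

    setting : Setting C
    setting = record
      { R      = productRing
      ; embedding = record
        { ι   = replicate (suc m)
        ; ι-+ = λ κ μ → ≡.sym (Vec.zipWith-replicate _⊕_ κ μ)
        ; ι-* = λ κ μ → ≡.sym (Vec.zipWith-replicate _⊗_ κ μ)
        ; ι-1 = ≡.refl
        }
      ; N      = N
      ; U      = λ r t → hyperplane r (Inverse.from (Vec-finite finite m) t)
      ; π      = coordinate
      ; U-cong = λ { _ ≡.refl → ≡.refl }
      ; U-inj  = λ {r} _ p → Inverse-injective (↔-sym (Vec-finite finite m)) (hyperplane-injective r _ _ p)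
      ; π-cong = λ r → cong (coordinate r)
      ; π-+    = coordinate-+
      ; π-self = λ {r} κ → coordinate-self κ r
      ; π-U    = λ {r} {κ} t → coordinate-hyperplane κ r (Inverse.from (Vec-finite finite m) t)
      }

module Construction where
  import Algebra.Module.Construct.DirectProduct as DirectProduct
  open Char2
  open Configurations
  open import Data.Fin.Base using (fromℕ<)
  open import Data.Integer.Base as ℤ using (+_)
  import Data.Integer.Properties as ℤ
  open import Data.Nat.Base using (NonZero; _+_; _*_; _∸_; _^_; _≤_; s≤s; z≤n)
  open import Data.Nat.DivMod using (_%_; _/_; m≡m%n+[m/n]*n)
  open import Data.Nat.Solver using (module +-*-Solver)
  import Data.Rational.Base as ℚ
  import Data.Rational.Properties as ℚ
  open import Data.Rational.Unnormalised.Base as ℚᵘ using (mkℚᵘ; *≤*)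
  import Data.Rational.Unnormalised.Properties as ℚᵘ
  open import Data.Vec.Base using (head)
  open import Data.Vec.Functional as Vector using (Vector)
  open Enumeration
  open Expurgation
  open Family
  open FiniteFields
  open import Function.Properties.Inverse using (↔-refl)
  open LinearAlgebra
  open Maximum
  open PlaneFamilies
  open import Relation.Binary.PropositionalEquality using (cong; cong₂)
  open import Relation.Nullary.Decidable using (decidable-stable)
  open Settings
  open Tables

  codeSize : ℕ → ℕ → ℕ → ℕ
  codeSize f N T = suc f + f * (N * T)

  -- With 2ⁿ = f + 1 = Q N and 2ⁿ⁻¹ = g + 1, this is the bound multiplied by 3 q.
  codeSize-≥ : ∀ p q f g N Q E → suc f ≡ Q * N → p * suc g ≡ q * 3 * (N * E) →
    q * 3 * (suc f * suc f) + p * (f * g) ≤ q * 3 * codeSize f N (Q + E)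
  codeSize-≥ p q f g N Q E f≡ g≡ = begin
    D * (suc f * suc f) + p * (f * g)             ≤⟨ ℕ.+-monoʳ-≤ _ pfg≤ ⟩
    D * (suc f * suc f) + f * (p * suc g)         ≡⟨ cong₂ (λ x y → D * (suc f * x) + f * y) f≡ g≡ ⟩
    D * (suc f * (Q * N)) + f * (D * (N * E))     ≡⟨⟩
    D * (Q * N + f * (Q * N)) + f * (D * (N * E)) ≡⟨ regroup ⟩
    D * (Q * N + f * (N * (Q + E)))               ≡⟨ cong (λ x → D * (x + f * (N * (Q + E)))) f≡ ⟨
    D * codeSize f N (Q + E)                      ∎
    where
    open ℕ.≤-Reasoning
    D = q * 3
    pfg≤ : p * (f * g) ≤ f * (p * suc g)
    pfg≤ = begin
      p * (f * g)       ≤⟨ ℕ.*-monoʳ-≤ p (ℕ.*-monoʳ-≤ f (ℕ.n≤1+n g)) ⟩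
      p * (f * suc g)   ≡⟨ solve 3 (λ p f g → p :* (f :* g) := f :* (p :* g)) ≡.refl p f (suc g) ⟩
      f * (p * suc g)   ∎
      where open +-*-Solver
    regroup : D * (Q * N + f * (Q * N)) + f * (D * (N * E)) ≡ D * (Q * N + f * (N * (Q + E)))
    regroup = solve 5 (λ D Q N f E → D :* (Q :* N :+ f :* (Q :* N)) :+ f :* (D :* (N :* E))
      := D :* (Q :* N :+ f :* (N :* (Q :+ E)))) ≡.refl D Q N f E
      where open +-*-Solver

  rational-≤ : ∀ a p q-1 b M → let q = suc q-1 in q * 3 * a + p * b ≤ q * 3 * M →
    ((+ a ℚ./ 1) ℚ.+ (+ p ℚ./ q) ℚ.* (+ b ℚ./ 3)) ℚ.≤ (+ M ℚ./ 1)
  rational-≤ a p q-1 b M le = ℚ.toℚᵘ-cancel-≤ (begin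
    ℚ.toℚᵘ ((+ a ℚ./ 1) ℚ.+ (+ p ℚ./ q) ℚ.* (+ b ℚ./ 3))
      ≃⟨ ℚ.toℚᵘ-homo-+ (+ a ℚ./ 1) _ ⟩
    ℚ.toℚᵘ (+ a ℚ./ 1) ℚᵘ.+ ℚ.toℚᵘ ((+ p ℚ./ q) ℚ.* (+ b ℚ./ 3))
      ≃⟨ ℚᵘ.+-cong (ℚ.toℚᵘ-fromℚᵘ (mkℚᵘ (+ a) 0)) (ℚᵘ.≃-trans (ℚ.toℚᵘ-homo-* (+ p ℚ./ q) (+ b ℚ./ 3))
           (ℚᵘ.*-cong (ℚ.toℚᵘ-fromℚᵘ (mkℚᵘ (+ p) q-1)) (ℚ.toℚᵘ-fromℚᵘ (mkℚᵘ (+ b) 2)))) ⟩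
    mkℚᵘ (+ a) 0 ℚᵘ.+ mkℚᵘ (+ p) q-1 ℚᵘ.* mkℚᵘ (+ b) 2
      ≤⟨ *≤* (≡.subst₂ ℤ._≤_ left right (ℤ.+≤+ le)) ⟩
    mkℚᵘ (+ M) 0
      ≃⟨ ℚ.toℚᵘ-fromℚᵘ (mkℚᵘ (+ M) 0) ⟨
    ℚ.toℚᵘ (+ M ℚ./ 1) ∎)
    where
    open ℚᵘ.≤-Reasoning
    q = suc q-1
    left : + (q * 3 * a + p * b) ≡ ((+ a) ℤ.* (+ (q * 3)) ℤ.+ (+ p) ℤ.* (+ b) ℤ.* (+ 1)) ℤ.* (+ 1)
    left = ≡.sym (≡.trans (ℤ.*-identityʳ _) (cong₂ ℤ._+_
      (≡.trans (≡.sym (ℤ.pos-* a (q * 3))) (cong +_ (ℕ.*-comm a (q * 3))))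
      (≡.trans (ℤ.*-identityʳ _) (≡.sym (ℤ.pos-* p b)))))
    right : + (q * 3 * M) ≡ (+ M) ℤ.* (+ (1 * (q * 3)))
    right = ≡.trans (cong +_ (≡.trans (ℕ.*-comm (q * 3) M) (cong (M *_) (≡.sym (ℕ.*-identityˡ (q * 3))))))
      (ℤ.pos-* M (1 * (q * 3)))

  bound-≤ : ∀ p q-1 {v f} N Q E → suc f ≡ 2 ^ (v ∸ 3) → suc f ≡ Q * N →
    p * 2 ^ (v ∸ 3 ∸ 1) ≡ suc q-1 * 3 * (N * E) →
    bound v (+ p ℚ./ suc q-1) ℚ.≤ (+ codeSize f N (Q + E) ℚ./ 1)
  bound-≤ p q-1 {v} {f} N Q E f≡ f≡′ g≡ = ≡.subst₂
    (λ a b → ((+ a ℚ./ 1) ℚ.+ (+ p ℚ./ suc q-1) ℚ.* (+ (b * g) ℚ./ 3)) ℚ.≤ (+ codeSize f N (Q + E) ℚ./ 1))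
    square (cong (_∸ 1) f≡)
    (rational-≤ (suc f * suc f) p q-1 (f * g) (codeSize f N (Q + E))
      (codeSize-≥ p (suc q-1) f g N Q E f≡′ (≡.trans (cong (p *_) g≡suc) g≡)))
    where
    n = v ∸ 3
    g = 2 ^ (n ∸ 1) ∸ 1
    g≡suc : suc g ≡ 2 ^ (n ∸ 1)
    g≡suc = ℕ.m+[n∸m]≡n (ℕ.m^n>0 2 (n ∸ 1))
    square : suc f * suc f ≡ 2 ^ (2 * n)
    square = ≡.trans (cong₂ _*_ f≡ f≡) (≡.trans (≡.sym (ℕ.^-distribˡ-+-* 2 n n))
      (cong (λ k → 2 ^ (n + k)) (≡.sym (ℕ.+-identityʳ n))))

  cardinality⇒dimension : ∀ (V : VectorSpace) v →
    Inverse (LeftModule.≈ᴹ-setoid V) (≡.setoid (Fin (2 ^ v))) → HasDim V (whole V) v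
  cardinality⇒dimension V v size = ≡.subst (HasDim V (whole V)) l≡v
    (b , independent⇒basis (whole V) independent (λ _ → _)
      λ {x} _ → let (a , c) , eq = spans x in c , ≈ᴹ-trans (≈ᴹ-sym (no-prefix a c)) eq)
    where
    open Spans V
    open Extension bitField V (2 ^ v) size using (extend; count)
    extended = extend {p = Vector.[]} λ { [] _ → ≡.refl }
    l = proj₁ extended
    b : Vector Carrierᴹ l
    b = proj₁ (proj₂ extended)
    jointly : JointlyIndependent Vector.[] b
    jointly = proj₁ (proj₂ (proj₂ extended))
    spans : ∀ x → ∃[ ac ] combine Vector.[] b ac ≈ᴹ x
    spans = proj₂ (proj₂ (proj₂ extended))
    no-prefix : ∀ a c → combine Vector.[] b (a , c) ≈ᴹ combination c b
    no-prefix [] c = ≈ᴹ-trans (+ᴹ-congʳ (combination-[] _)) (+ᴹ-identityˡ _)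
    independent : Independent b
    independent c eq = proj₂ (jointly [] c (≈ᴹ-trans (no-prefix [] c) eq))
    l≡v : l ≡ v
    l≡v = ≡.sym (2^-injective (≡.trans (count jointly spans) (ℕ.+-identityʳ (2 ^ l))))

  module Ambient {C : Configuration} (S : Setting C) (f : ℕ)
    (size : Inverse (Setting.setoid S) (≡.setoid (Fin (suc f)))) (V : VectorSpace)
    (coordinates : WordFamily.Coordinates S f size V)
    (surjective : ∀ x → ∃[ p ] LeftModule._≈ᴹ_ V (WordFamily.Coordinates.pt coordinates p) x)
    {v : ℕ} (f≡ : suc f ≡ 2 ^ (v ∸ 3)) (3≤v : 3 ≤ v) where
    open WordFamily S f size
    open Coordinates coordinates
    open LeftModule V
    open Inverse size using (to; from; to-cong; strictlyInverseˡ; strictlyInverseʳ)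
    private
      module S = Setting S
      bits³ = Vec-finite Bool-finite 3
      pairs = ×-finite bits³ (↔-refl {A = Fin (suc f)})

    ambient-size : Inverse ≈ᴹ-setoid (≡.setoid (Fin (2 ^ v)))
    ambient-size = ≡.subst (λ k → Inverse ≈ᴹ-setoid (≡.setoid (Fin k))) size≡ (record
      { to        = encode
      ; from      = decode
      ; to-cong   = encode-cong
      ; from-cong = λ { ≡.refl → ≈ᴹ-refl }
      ; inverse   = (λ { {i} eq → ≡.trans (encode-cong eq) (encode-decode i) })
                  , (λ { {x} ≡.refl → decode-encode x })
      })
      where
      encode : Carrierᴹ → Fin (8 * suc f)
      encode x = let (a , y) , _ = surjective x in Inverse.to pairs (a , to y)
      decode : Fin (8 * suc f) → Carrierᴹ
      decode i = let a , k = Inverse.from pairs i in pt (a , from k)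
      encode-cong : ∀ {x y} → x ≈ᴹ y → encode x ≡ encode y
      encode-cong {x} {y} x≈y =
        let p , q = pt-injective (≈ᴹ-trans (proj₂ (surjective x))
              (≈ᴹ-trans x≈y (≈ᴹ-sym (proj₂ (surjective y)))))
        in cong (Inverse.to pairs) (cong₂ _,_ p (to-cong q))
      encode-decode : ∀ i → encode (decode i) ≡ i
      encode-decode i =
        let a , k = Inverse.from pairs i
            p , q = pt-injective (proj₂ (surjective (decode i)))
        in ≡.trans (cong (Inverse.to pairs) (cong₂ _,_ p (≡.trans (to-cong q) (strictlyInverseˡ k))))
          (Inverse.strictlyInverseˡ pairs i)
      decode-encode : ∀ x → decode (encode x) ≈ᴹ x
      decode-encode x =
        let (a , y) , eq = surjective x in
        ≈ᴹ-trans (≈ᴹ-reflexive (cong (λ (a , k) → pt (a , from k))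
            (Inverse.strictlyInverseʳ pairs (a , to y))))
          (≈ᴹ-trans (pt-cong (≡.refl , strictlyInverseʳ y)) eq)
      size≡ : 8 * suc f ≡ 2 ^ v
      size≡ = ≡.trans (cong (8 *_) f≡) (≡.trans (≡.sym (ℕ.^-distribˡ-+-* 2 3 (v ∸ 3)))
        (cong (2 ^_) (ℕ.m+[n∸m]≡n 3≤v)))

    ambient : HasDim V (whole V) v
    ambient = cardinality⇒dimension V v ambient-size

    _≈?_ : ∀ x y → Dec (x ≈ᴹ y)
    _≈?_ = Search._≈?_ V ambient-size ambient

    module _ (r : Fin f) (t : Fin S.N) (k : Fin (Configuration.keptSize C)) where

      subspaceCode : Code V v M 4 3
      subspaceCode = Spans.code V _≈?_ ambient (family r t k)

      A₂-≥ : ∃[ A ] IsA₂ v 4 3 A × M ≤ A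
      A₂-≥ = Search.maximum V ambient-size ambient (family r t k)

  nonzeroCount : ℕ → ℕ
  nonzeroCount n = 2 ^ n ∸ 1

  suc-nonzeroCount : ∀ n → suc (nonzeroCount n) ≡ 2 ^ n
  suc-nonzeroCount n = ℕ.m+[n∸m]≡n (ℕ.m^n>0 2 n)

  power-inhabited : ∀ d l → Fin ((2 ^ d) ^ l)
  power-inhabited d l = fromℕ< (ℕ.m^n>0 (2 ^ d) {{ℕ.m^n≢0 2 d}} l)

  module ProductCode (C : Configuration) (k₀ : Fin (Configuration.keptSize C)) (m : ℕ) {v : ℕ}
    (n≡ : v ∸ 3 ≡ Configuration.degree C * suc m) (3≤v : 3 ≤ v) where
    open Configuration C using (degree; keptSize; newSize; ring₂; 1≢0)
    open ProductSetting C m using (productRing; setting)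
    open ProductSetting C m public using (N)
    private
      f = nonzeroCount (v ∸ 3)

      f≡ : suc f ≡ 2 ^ (v ∸ 3)
      f≡ = suc-nonzeroCount (v ∸ 3)

    N-size : suc f ≡ 2 ^ degree * N
    N-size = ≡.trans f≡ (≡.trans (cong (2 ^_) n≡) (≡.sym (ℕ.^-*-assoc 2 degree (suc m))))

    private
      size : Inverse (Setting.setoid setting) (≡.setoid (Fin (suc f)))
      size = ≡.subst (λ k → Inverse (Setting.setoid setting) (≡.setoid (Fin k))) (≡.sym N-size)
        (ProductSetting.size C m)

      space : Char2Ring → VectorSpace
      space R = Scalars.scalarModule bits R (bitsHomomorphism R)

      V : VectorSpace
      V = DirectProduct.leftModule (space (Ring₂.char2Ring (vectors bits 3))) (space productRing)

      open WordFamily setting f size using (Coordinates; nz-surjective)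

      coordinates : Coordinates V
      coordinates = record
        { pt         = id
        ; pt-cong    = id
        ; pt-+       = λ _ _ _ _ → ≡.refl , ≡.refl
        ; pt-trivial = λ _ → id
        }

      module A = Ambient setting f size V coordinates (λ x → x , ≡.refl , ≡.refl) f≡ 3≤v

    A₂-≥ : ∃[ A ] IsA₂ v 4 3 A × codeSize f N (keptSize + newSize) ≤ A
    A₂-≥ = A.A₂-≥ (proj₁ (nz-surjective {Char2Ring.1# productRing} (λ p → 1≢0 (cong head p))))
      (power-inhabited degree m) k₀

  finiteField : ∀ {n} → GF2^ n → FiniteField
  finiteField {n} F = record
    { char2Ring = record { commutativeRing = commutativeRing ; 1+1≈0 = 1+1≈0 }
    ; 1≉0       = 1≉0
    ; inverses  = inverses
    ; f         = nonzeroCount n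
    ; size      = ≡.subst (λ k → Inverse setoid (≡.setoid (Fin k))) (≡.sym (suc-nonzeroCount n)) cardinality
    }
    where open GF2^ F

  module FieldCode (C : Configuration) (k₀ : Fin (Configuration.keptSize C)) {v : ℕ} (3≤v : 3 ≤ v)
    (F : GF2^ (v ∸ 3))
    (h : Homomorphism (Configuration.ring₂ C) (FiniteField.char2Ring (finiteField F))) where
    open Configuration C using (degree; keptSize; newSize; ring₂; w; w-+; w-nonzero)
    open FieldSetting C (finiteField F) h public using (N; N-size)
    private
      module F = GF2^ F
      field′ = finiteField F
      open FiniteField field′ using (f; size)

      open FieldSetting C field′ h using (setting; U-equivariant; ι-nonzero)
      open Homomorphism h
      open Spans F.space using (span; unit; combination; combination-additive;
        independent⇒basis; combination-unit; Independent)

      ι-w-+ : ∀ x y → ι (w (x +ᵇ y)) F.≈ ι (w x) F.+ꟳ ι (w y)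
      ι-w-+ x y = F.trans (F.reflexive (cong ι (w-+ x y))) (ι-+ (w x) (w y))

      ι-w-nonzero : ∀ x → ι (w x) F.≈ F.0# → x ≡ 0ᵇ
      ι-w-nonzero x p = w-nonzero x (decidable-stable (w x ≟ Configuration.0# C) λ wx≢0 → ι-nonzero wx≢0 p)
        where open ConfigurationProperties C using (_≟_)

      basis : Vector F.Carrier 3
      basis k = ι (w (unit k))

      combination-basis : ∀ x → combination x basis F.≈ ι (w x)
      combination-basis = combination-additive (ι ∘ w) ι-w-+

    W : Subspace F.space
    W = span basis

    W-dimension : HasDim F.space W 3
    W-dimension = basis , independent⇒basis W
      (λ x p → ι-w-nonzero x (F.trans (F.sym (combination-basis x)) p))
      (λ k → unit k , combination-unit k basis) id

    private
      V = W×F F W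
      module V = LeftModule V

      open WordFamily setting f size hiding (M)

      coordinates : Coordinates V
      coordinates = record
        { pt         = λ (x , y) → (ι (w x) , x , combination-basis x) , y
        ; pt-cong    = λ { (≡.refl , q) → F.refl , q }
        ; pt-+       = λ x _ x′ _ → ι-w-+ x x′ , F.refl
        ; pt-trivial = λ (x , _) (p , q) → ι-w-nonzero x p , q
        }

      surjective : ∀ x → ∃[ p ] Coordinates.pt coordinates p V.≈ᴹ x
      surjective ((_ , a , p) , y) = (a , y) , F.trans (F.sym (combination-basis a)) p , F.refl

      module A = Ambient setting f size V coordinates surjective (suc-nonzeroCount (v ∸ 3)) 3≤v
      open Coordinates coordinates

    M : ℕ
    M = codeSize f N (keptSize + newSize)

    fieldCode : Code V v M 4 3
    fieldCode = A.subspaceCode (proj₁ (nz-surjective F.1≉0)) (inhabited N-size) k₀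
      where
      inhabited : ∀ {N} → suc f ≡ 2 ^ degree * N → Fin N
      inhabited {zero}  p = contradiction (≡.trans p (ℕ.*-zeroʳ (2 ^ degree))) λ ()
      inhabited {suc N} _ = zero

    invariant : Invariant V (Σᵥ F W) fieldCode
    invariant g (s , s≉0 , g≈) i = j , (λ {y} → image⊆ {y}) , (λ {y} → ⊆image {y})
      where
      open Equivariance U-equivariant (FieldTheory.integral field′)
      module VS = Spans V
      open import Relation.Binary.Reasoning.Setoid V.≈ᴹ-setoid
      j = Inverse.to index-finite (act s≉0 (index i))
      scaled : V.Carrierᴹ → V.Carrierᴹ
      scaled (x , y) = x , s F.*ꟳ y
      scaled-cong : ∀ x y → x V.≈ᴹ y → scaled x V.≈ᴹ scaled y
      scaled-cong _ _ (p , q) = p , F.*-congˡ q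
      same : ∀ a → scaled (VS.combination a (plane i)) V.≈ᴹ VS.combination a (plane j)
      same a = begin
        scaled (VS.combination a (plane i))        ≈⟨ scaled-cong (VS.combination a (plane i)) (pt (word (index i) a))
                                                        (combination-plane i a) ⟩
        scaled (pt (word (index i) a))             ≈⟨ pt-cong (word-act s≉0 (index i) a) ⟨
        pt (word (act s≉0 (index i)) a)
          ≡⟨ cong (λ j → pt (word j a)) (Inverse.strictlyInverseʳ index-finite (act s≉0 (index i))) ⟨
        pt (word (index j) a)                      ≈⟨ combination-plane j a ⟨
        VS.combination a (plane j)                 ∎
      image⊆ : ∀ {y} → Image V g (VS.span (plane i)) y → Subspace.member (VS.span (plane j)) y
      image⊆ {y} (x , (a , p) , q) = a , (begin
        VS.combination a (plane j)                 ≈⟨ same a ⟨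
        scaled (VS.combination a (plane i))        ≈⟨ scaled-cong (VS.combination a (plane i)) x p ⟩
        scaled x                                   ≈⟨ g≈ (proj₁ x) (proj₂ x) ⟨
        g x                                        ≈⟨ q ⟩
        y                                          ∎)
      ⊆image : ∀ {y} → Subspace.member (VS.span (plane j)) y → Image V g (VS.span (plane i)) y
      ⊆image {y} (a , p) = VS.combination a (plane i) ,
        (a , V.≈ᴹ-refl {VS.combination a (plane i)}) , (begin
        g (VS.combination a (plane i))             ≈⟨ g≈ _ _ ⟩
        scaled (VS.combination a (plane i))        ≈⟨ same a ⟩
        VS.combination a (plane j)                 ≈⟨ p ⟩
        y                                          ∎)

  module Embed (F : FiniteField) {n} (f≡ : suc (FiniteField.f F) ≡ 2 ^ n) (n≢0 : n ≢ 0) where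
    open FiniteField F using (char2Ring; _≈_; trans; sym; reflexive)
    open FieldTheory F using (φ^; φ^-cong; solvable)

    squares : (K : Ring₂) → ℕ → Ring₂.Carrier K → Ring₂.Carrier K
    squares K zero    x = x
    squares K (suc k) x = squares K k (Ring₂._⊗_ K x x)

    φ^-ι : ∀ {K} (h : Homomorphism K char2Ring) k x →
      φ^ k (Homomorphism.ι h x) ≈ Homomorphism.ι h (squares K k x)
    φ^-ι h zero    x = FiniteField.refl F
    φ^-ι h (suc k) x = trans (φ^-cong k (sym (Homomorphism.ι-* h x x))) (φ^-ι h k _)

    adjoinRoot : ∀ {K} → Homomorphism K char2Ring → ∀ γ k j → n ≡ j * (k + k) → squares K k γ ≡ γ →
      Homomorphism (Quadratic.extension K γ) char2Ring
    adjoinRoot h γ k j n≡ fixed = adjoin h (proj₁ root) (proj₂ root)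
      where
      open Homomorphism h using (ι)
      root = solvable f≡ n≢0 k j n≡ (trans (φ^-ι h k γ) (reflexive (cong ι fixed)))

    embed₄ : ∀ j → n ≡ j * 2 → Homomorphism F₄ char2Ring
    embed₄ j n≡ = adjoinRoot {bits} (bitsHomomorphism char2Ring) true 1 j n≡ ≡.refl

    embed₁₆ : ∀ j → n ≡ j * 4 → Homomorphism F₁₆ char2Ring
    embed₁₆ j n≡ = adjoinRoot {F₄} (embed₄ (j * 2) (≡.trans n≡ (≡.sym (ℕ.*-assoc j 2 2))))
      (false , true) 2 j n≡ ≡.refl

    embed₂₅₆ : ∀ j → n ≡ j * 8 → Homomorphism F₂₅₆ char2Ring
    embed₂₅₆ j n≡ = adjoinRoot {F₁₆} (embed₁₆ (j * 2) (≡.trans n≡ (≡.sym (ℕ.*-assoc j 2 4))))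
      ((false , false) , (false , true)) 4 j n≡ ≡.refl

  half-power : ∀ {n h} → n ≢ 0 → 2 ^ n ≡ 2 * h → 2 ^ (n ∸ 1) ≡ h
  half-power {zero}  n≢0 _ = contradiction ≡.refl n≢0
  half-power {suc n} _   p = ℕ.*-cancelˡ-≡ (2 ^ n) _ 2 p

  bound₁₆ : ∀ {v} N → v ∸ 3 ≢ 0 → suc (nonzeroCount (v ∸ 3)) ≡ 16 * N →
    bound v (+ 9 ℚ./ 8) ℚ.≤ (+ codeSize (nonzeroCount (v ∸ 3)) N 19 ℚ./ 1)
  bound₁₆ {v} N n≢0 f≡ = bound-≤ 9 7 {v} N 16 3 (suc-nonzeroCount (v ∸ 3)) f≡
    (≡.trans (cong (9 *_) (half-power {v ∸ 3} {8 * N} n≢0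
      (≡.trans (≡.sym (suc-nonzeroCount (v ∸ 3))) (≡.trans f≡ (ℕ.*-assoc 2 8 N)))))
      (solve 1 (λ N → con 9 :* (con 8 :* N) := con 24 :* (N :* con 3)) ≡.refl N))
    where open +-*-Solver

  bound₂₅₆ : ∀ {v} N → v ∸ 3 ≢ 0 → suc (nonzeroCount (v ∸ 3)) ≡ 256 * N →
    bound v (+ 81 ℚ./ 64) ℚ.≤ (+ codeSize (nonzeroCount (v ∸ 3)) N 310 ℚ./ 1)
  bound₂₅₆ {v} N n≢0 f≡ = bound-≤ 81 63 {v} N 256 54 (suc-nonzeroCount (v ∸ 3)) f≡
    (≡.trans (cong (81 *_) (half-power {v ∸ 3} {128 * N} n≢0
      (≡.trans (≡.sym (suc-nonzeroCount (v ∸ 3))) (≡.trans f≡ (ℕ.*-assoc 2 128 N)))))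
      (solve 1 (λ N → con 81 :* (con 128 :* N) := con 192 :* (N :* con 54)) ≡.refl N))
    where open +-*-Solver

  natural-≤ : ∀ {m n} → m ≤ n → (+ m ℚ./ 1) ℚ.≤ (+ n ℚ./ 1)
  natural-≤ {m} {n} m≤n = ℚ.toℚᵘ-cancel-≤ (begin
    ℚ.toℚᵘ (+ m ℚ./ 1)   ≃⟨ ℚ.toℚᵘ-fromℚᵘ (mkℚᵘ (+ m) 0) ⟩
    mkℚᵘ (+ m) 0         ≤⟨ *≤* (ℤ.*-monoʳ-≤-nonNeg (+ 1) (ℤ.+≤+ m≤n)) ⟩
    mkℚᵘ (+ n) 0         ≃⟨ ℚ.toℚᵘ-fromℚᵘ (mkℚᵘ (+ n) 0) ⟨
    ℚ.toℚᵘ (+ n ℚ./ 1)   ∎)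
    where open ℚᵘ.≤-Reasoning

  residue : ∀ v {r} → v % 8 ≡ r → v ≡ r + v / 8 * 8
  residue v p = ≡.trans (m≡m%n+[m/n]*n v 8) (cong (_+ v / 8 * 8) p)

  module Case₁₆ (v : ℕ) (v≡ : v % 8 ≡ 7) where
    private
      j : ℕ
      j = suc (v / 8 + v / 8)

      n≡ : v ∸ 3 ≡ 4 * j
      n≡ = ≡.trans (cong (_∸ 3) (residue v v≡))
        (solve 1 (λ q → con 4 :+ q :* con 8 := con 4 :* (con 1 :+ (q :+ q))) ≡.refl (v / 8))
        where open +-*-Solver

      n≢0 : v ∸ 3 ≢ 0
      n≢0 p = contradiction (≡.trans (≡.sym n≡) p) λ ()

      3≤v : 3 ≤ v
      3≤v = ≡.subst (3 ≤_) (≡.sym (residue v v≡)) (s≤s (s≤s (s≤s z≤n)))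

    invariantCode : (F : GF2^ (v ∸ 3)) → ∃[ W ] HasDim (GF2^.space F) W 3 ×
      (∃[ M ] Σ (Code (W×F F W) v M 4 3) λ C →
        Invariant (W×F F W) (Σᵥ F W) C × bound v (+ 9 ℚ./ 8) ℚ.≤ (+ M ℚ./ 1))
    invariantCode F = W , W-dimension , M , fieldCode , invariant , bound₁₆ {v} N n≢0 N-size
      where
      h : Homomorphism F₁₆ (FiniteField.char2Ring (finiteField F))
      h = Embed.embed₁₆ (finiteField F) {v ∸ 3} (suc-nonzeroCount (v ∸ 3)) n≢0 j (≡.trans n≡ (ℕ.*-comm 4 j))
      open FieldCode configuration₁₆ zero {v} 3≤v F h

    A₂-bound : ∃[ A ] IsA₂ v 4 3 A × bound v (+ 9 ℚ./ 8) ℚ.≤ (+ A ℚ./ 1)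
    A₂-bound =
      let A , isA₂ , M≤A = A₂-≥ in A , isA₂ , ℚ.≤-trans (bound₁₆ {v} N n≢0 N-size) (natural-≤ M≤A)
      where open ProductCode configuration₁₆ zero (v / 8 + v / 8) {v} n≡ 3≤v

  module Case₂₅₆ (v : ℕ) (v≡ : v % 8 ≡ 3) (11≤v : 11 ≤ v) where
    private
      n≡′ : v ∸ 3 ≡ v / 8 * 8
      n≡′ = cong (_∸ 3) (residue v v≡)

      positive : ∃[ m ] v / 8 ≡ suc m
      positive with v / 8 | residue v v≡
      ... | suc m | _ = m , ≡.refl
      ... | zero  | p = contradiction (≡.subst (11 ≤_) p 11≤v) λ { (s≤s (s≤s (s≤s ()))) }

      m : ℕ
      m = proj₁ positive

      n≡ : v ∸ 3 ≡ 8 * suc m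
      n≡ = ≡.trans n≡′ (≡.trans (cong (_* 8) (proj₂ positive)) (ℕ.*-comm (suc m) 8))

      n≢0 : v ∸ 3 ≢ 0
      n≢0 p = contradiction (≡.trans (≡.sym n≡) p) λ ()

      3≤v : 3 ≤ v
      3≤v = ℕ.≤-trans (s≤s (s≤s (s≤s z≤n))) 11≤v

    invariantCode : (F : GF2^ (v ∸ 3)) → ∃[ W ] HasDim (GF2^.space F) W 3 ×
      (∃[ M ] Σ (Code (W×F F W) v M 4 3) λ C →
        Invariant (W×F F W) (Σᵥ F W) C × bound v (+ 81 ℚ./ 64) ℚ.≤ (+ M ℚ./ 1))
    invariantCode F = W , W-dimension , M , fieldCode , invariant , bound₂₅₆ {v} N n≢0 N-size
      where
      h : Homomorphism F₂₅₆ (FiniteField.char2Ring (finiteField F))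
      h = Embed.embed₂₅₆ (finiteField F) {v ∸ 3} (suc-nonzeroCount (v ∸ 3)) n≢0 (v / 8) n≡′
      open FieldCode configuration₂₅₆ zero {v} 3≤v F h

    A₂-bound : ∃[ A ] IsA₂ v 4 3 A × bound v (+ 81 ℚ./ 64) ℚ.≤ (+ A ℚ./ 1)
    A₂-bound =
      let A , isA₂ , M≤A = A₂-≥ in A , isA₂ , ℚ.≤-trans (bound₂₅₆ {v} N n≢0 N-size) (natural-≤ M≤A)
      where open ProductCode configuration₂₅₆ zero m {v} n≡ 3≤v

mainTheorem1 : (v : ℕ) → .{{_ : NonZero v}} →
    (v % 8 ≡ 7 →
    ((F : GF2^ (v ∸ 3)) →
    ∃[ W ] HasDim (GF2^.space F) W 3 ×
    (∃[ M ] Σ (Code (W×F F W) v M 4 3) λ C →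
    Invariant (W×F F W) (Σᵥ F W) C ×
    bound v (+ 9 ℚ./ 8) ℚ.≤ (+ M ℚ./ 1)))
    × (∃[ A ] IsA₂ v 4 3 A × bound v (+ 9 ℚ./ 8) ℚ.≤ (+ A ℚ./ 1)))
    ×
    (v % 8 ≡ 3 → 11 ≤ v →
    ((F : GF2^ (v ∸ 3)) →
    ∃[ W ] HasDim (GF2^.space F) W 3 ×
    (∃[ M ] Σ (Code (W×F F W) v M 4 3) λ C →
    Invariant (W×F F W) (Σᵥ F W) C ×
    bound v (+ 81 ℚ./ 64) ℚ.≤ (+ M ℚ./ 1)))
    × (∃[ A ] IsA₂ v 4 3 A × bound v (+ 81 ℚ./ 64) ℚ.≤ (+ A ℚ./ 1)))
mainTheorem1 v =
    (λ v≡ → Construction.Case₁₆.invariantCode v v≡ , Construction.Case₁₆.A₂-bound v v≡)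
  , (λ v≡ 11≤v → Construction.Case₂₅₆.invariantCode v v≡ 11≤v , Construction.Case₂₅₆.A₂-bound v v≡ 11≤v)
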